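{- Let $G$ be a finite simple graph of order $n$ with minimum degree $\delta$, circumference $c$ and toughness $\tau(G) > 1$. Then either $c \geq \min\{n, 2\delta + 4\}$, or $G$ is the Petersen graph.
   Context: All graphs are finite, undirected, without loops or multiple edges. The circumference $c$ is the length (number of edges) of a longest cycle of $G$. For $S \subseteq V(G)$, $G \setminus S$ denotes the subgraph induced by $V(G)\setminus S$, and $s(H)$ denotes the number of connected components of a graph $H$. A graph $G$ is $t$-tough if $|S| \geq t\, s(G\setminus S)$ for every subset $S \subseteq V(G)$ with $s(G\setminus S) > 1$. The toughness $\tau(G)$ is the maximum $t$ for which $G$ is $t$-tough, with the convention $\tau(K_n)=\infty$ for all $n\ge 1$. -}

module Defs where

open import Data.Bool using (Bool; true; false; _∨_; _∧_; if_then_else_)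
open import Data.Nat as ℕ using (ℕ; zero; suc; _+_; _∸_; _<ᵇ_; _≡ᵇ_; _%_)
open import Data.Fin using (Fin; toℕ)
open import Data.Fin.Subset using (Subset; _∈_; _∉_; ∣_∣)
open import Data.Vec using (tabulate)
open import Data.Integer using (+_)
open import Data.Rational.Unnormalised as Q using (ℚᵘ; _/_)
open import Data.Sum using (_⊎_)
open import Data.Product using (Σ; Σ-syntax; ∃; _×_)
open import Function.Bundles using (_⤖_; Bijection; _⇔_)
open import Function.Definitions using (Injective)
open import Relation.Binary.PropositionalEquality using (_≡_)

record Graph (n : ℕ) : Set where
  field
    adj    : Fin n → Fin n → Bool
    sym    : ∀ u v → adj u v ≡ adj v u
    irrefl : ∀ v → adj v v ≡ false

open Graph public

module _ {n : ℕ} (G : Graph n) where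

  Adj : Fin n → Fin n → Set
  Adj u v = adj G u v ≡ true

  deg : Fin n → ℕ
  deg v = ∣ tabulate (adj G v) ∣

  IsMinDegree : ℕ → Set
  IsMinDegree δ = (∀ v → δ ℕ.≤ deg v) × (∃ λ v → deg v ≡ δ)

  record Cycle (k : ℕ) : Set where
    field
      length≥3 : 3 ℕ.≤ k
      vert     : Fin k → Fin n
      distinct : Injective _≡_ _≡_ vert
      edges    : ∀ (i j : Fin k) →
                 (toℕ j ≡ suc (toℕ i) ⊎ (toℕ i ≡ k ∸ 1 × toℕ j ≡ 0)) →
                 Adj (vert i) (vert j)

  IsCircumference : ℕ → Set
  IsCircumference c = Cycle c × (∀ k → Cycle k → k ℕ.≤ c)

  data Conn (S : Subset n) : Fin n → Fin n → Set where
    here : ∀ {u} → u ∉ S → Conn S u u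
    step : ∀ {u w v} → u ∉ S → Adj u w → Conn S w v → Conn S u v

  -- s(G ∖ S) = k : the vertices of G ∖ S are labelled onto Fin k so that
  -- two vertices get the same label iff they lie in the same component.
  NumComponents : Subset n → ℕ → Set
  NumComponents S k =
    Σ[ lab ∈ ((v : Fin n) → v ∉ S → Fin k) ]
      ((∀ u v (pu : u ∉ S) (pv : v ∉ S) → (lab u pu ≡ lab v pv) ⇔ Conn S u v)
       × (∀ (i : Fin k) → Σ[ v ∈ Fin n ] Σ[ pv ∈ v ∉ S ] lab v pv ≡ i))

  Tough : ℚᵘ → Set
  Tough t = ∀ (S : Subset n) (k : ℕ) → NumComponents S k → 1 ℕ.< k →
            t Q.* (+ k / 1) Q.≤ (+ ∣ S ∣ / 1)

  ToughnessGreaterThanOne : Set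
  ToughnessGreaterThanOne = Σ[ t ∈ ℚᵘ ] (Q.1ℚᵘ Q.< t × Tough t)

-- The Petersen graph on Fin 10: outer 5-cycle 0-1-2-3-4-0,
-- inner pentagram 5+i ~ 5+((i+2) mod 5), spokes i ~ 5+i (i < 5).
petersenℕ : ℕ → ℕ → Bool
petersenℕ i j =
  ((i <ᵇ 5) ∧ (j <ᵇ 5) ∧ ((j ≡ᵇ ((i + 1) % 5)) ∨ (i ≡ᵇ ((j + 1) % 5))))
  ∨ ((4 <ᵇ i) ∧ (4 <ᵇ j) ∧
       ((j ∸ 5 ≡ᵇ ((i ∸ 5 + 2) % 5)) ∨ (i ∸ 5 ≡ᵇ ((j ∸ 5 + 2) % 5))))
  ∨ ((j ≡ᵇ i + 5) ∨ (i ≡ᵇ j + 5))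

petersenAdj : Fin 10 → Fin 10 → Bool
petersenAdj u v = petersenℕ (toℕ u) (toℕ v)

IsPetersen : ∀ {n} → Graph n → Set
IsPetersen {n} G =
  Σ[ φ ∈ (Fin n ⤖ Fin 10) ]
    (∀ u v → adj G u v ≡ petersenAdj (Bijection.to φ u) (Bijection.to φ v))

-- Let C be a longest cycle with at most 2δ + 3 vertices, x a vertex off C, H the component of x in G − C and A the
-- set of neighbours of H on C.  A path through H between two vertices of A can replace part of C, so the segments of
-- C between consecutive vertices of A are at least as long as such paths.  Inside H, repeatedly passing to a part that
-- hangs on one vertex and has large degrees gives d with δ ≤ |A| + d such that any two vertices of A are joined
-- through H by a path on d + 1 vertices (for d = 0, H is just x).  Each segment then has d + 1 + f vertices, where the
-- excesses f add up to at most 3 − (|A| − 2) d.  An edge between two segments needs total excess 2 on them and is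
-- confined to few positions; a longer bridge is impossible.  As the toughness exceeds 1, removing A leaves fewer than |A|
-- components, and removing A with one more vertex at most |A|, so that many such edges exist.  Lengthening C through
-- pairs of them excludes everything except d = 0 with three segments on two vertices each, joined cyclically, and
-- then every further vertex or edge lengthens C: G is the Petersen graph.
module Submission where

open import Defs
open import Data.Bool as Bool using (Bool; true; false; if_then_else_)
open import Data.Empty using (⊥; ⊥-elim)
open import Data.Fin as Fin using (Fin; zero; suc; toℕ; fromℕ; inject₁; #_)
import Data.Fin.Properties as Finₚ
open import Data.Fin.Subset using (Subset; ∣_∣) renaming (_∈_ to _∈ˢ_; _∉_ to _∉ˢ_)
import Data.Integer as ℤ
import Data.Integer.Properties as ℤₚ
open import Data.List using (List; []; _∷_; _++_; length; filter; map; allFin; lookup)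
import Data.List.Properties as Listₚ
open import Data.List.Membership.Propositional using (_∈_; _∉_; find; lose)
import Data.List.Membership.Propositional.Properties as ∈ₚ
import Data.List.Relation.Unary.Any.Properties as Anyₚ
open import Data.List.Relation.Unary.All as All using (All)
import Data.List.Relation.Unary.All.Properties as Allₚ
open import Data.List.Relation.Unary.AllPairs as AllPairs using (AllPairs)
import Data.List.Relation.Unary.AllPairs.Properties as AllPairsₚ
open import Data.List.Relation.Unary.Any as Any using (here; there)
open import Data.List.Relation.Unary.Unique.Propositional using (Unique)
import Data.List.Relation.Unary.Unique.Propositional.Properties as Uniqueₚ
open import Data.Nat as ℕ using (ℕ; zero; suc; _+_; _*_; _∸_; _⊓_; _≤_; _<_; _≤?_; z≤n; s≤s)
import Data.Nat.Properties as ℕₚ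
open import Data.Nat.Tactic.RingSolver using (solve)
import Data.Maybe
open import Data.Product using (Σ-syntax; ∃; ∃₂; _×_; _,_; proj₁; proj₂)
open import Data.Rational.Unnormalised as ℚᵘ using (ℚᵘ; _/_)
import Data.Rational.Unnormalised.Properties as ℚᵘₚ
open import Data.Sum using (_⊎_; inj₁; inj₂; [_,_]′)
open import Data.Unit using (⊤; tt)
open import Data.Vec as Vec using (tabulate)
import Data.Vec.Properties as Vecₚ
open import Function using (id; case_of_)
open import Function.Bundles using (mk⤖; mk⇔)
open import Function.Definitions using (Injective; Surjective)
open import Relation.Binary.PropositionalEquality using (_≡_; _≢_; refl; trans; cong; cong₂; subst; subst₂) renaming (sym to ≡-sym)
open import Relation.Nullary using (¬_; Dec; yes; no; does; contradiction)
open import Relation.Nullary.Decidable using (¬?; _×-dec_; _⊎-dec_; _→-dec_; map′; from-yes)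

-- Every rerouted cycle must be shown to be simple and to have a known length. Both are read off one
-- identity: for an arbitrary weight on the vertices, the new cycle and the dropped vertices
-- together weigh as much as `C` and the detour. Indicator weights give simplicity, the constant
-- weight gives the length, and each instance is an identity in a commutative semiring. The bound on
-- the excesses comes from c = (d + 2)|A| + (sum of excesses), c ≤ 2δ + 3 and δ ≤ |A| + d. As |A| ≥
-- 3, it is at most 3 - d, so two cross edges, each of cost 2, never lie on four different segments.
-- Since H is itself a component, deleting A leaves the segments in at most |A| - 2 groups. So even
-- after two segments are merged by hand there is a further cross edge. Deleting one more vertex
-- allows |A| - 1 groups, so the cross edges cannot all meet in one vertex that shares its segment.
-- These two facts destroy every star-like pattern; the case that needs both at once is a center on
-- three vertices. The Petersen graph, with δ = 3 and c = 9 = 2δ + 3, attains all these bounds.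

-- Linear inequalities by certificate, and indicator weights.

-- A linear consequence is certified by the sum `X ≤ Y` of the hypotheses used, taken with
-- multiplicity, and a slack `s`; what remains is a ring identity. Most counting arguments below use
-- this form or its contradictory variant.
farkas : ∀ {a b X Y} s → X ≤ Y → b + X ≡ a + Y + s → a ≤ b
farkas {a} {b} {X} {Y} s h e = ℕₚ.+-cancelʳ-≤ Y a b
  (ℕₚ.≤-trans (ℕₚ.m≤m+n (a + Y) s) (ℕₚ.≤-trans (ℕₚ.≤-reflexive (≡-sym e)) (ℕₚ.+-monoʳ-≤ b h)))

farkas-⊥ : ∀ {X Y} s → X ≤ Y → X ≡ Y + suc s → ⊥
farkas-⊥ {X} {Y} s h e =
  ℕₚ.<-irrefl refl (ℕₚ.<-≤-trans (ℕₚ.m<m+n Y (s≤s z≤n)) (ℕₚ.≤-trans (ℕₚ.≤-reflexive (≡-sym e)) h))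

infixr 5 _⊞_
_⊞_ : ∀ {a b c d} → a ≤ b → c ≤ d → a + c ≤ b + d
_⊞_ = ℕₚ.+-mono-≤

ind : ∀ {n} → Fin n → Fin n → ℕ
ind z v = if does (z Fin.≟ v) then 1 else 0

ind-refl : ∀ {n} (z : Fin n) → ind z z ≡ 1
ind-refl z with z Fin.≟ z
... | yes _ = refl
... | no ne = contradiction refl ne

ind-≢ : ∀ {n} {z v : Fin n} → z ≢ v → ind z v ≡ 0
ind-≢ {z = z} {v} ne with z Fin.≟ v
... | yes eq = contradiction eq ne
... | no _ = refl

ind≤1 : ∀ {n} (z v : Fin n) → ind z v ≤ 1
ind≤1 z v with z Fin.≟ v
... | yes _ = s≤s z≤n
... | no _ = z≤n

ind-≡ : ∀ {n} {z v : Fin n} → 1 ≤ ind z v → z ≡ v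
ind-≡ {z = z} {v} h with z Fin.≟ v
... | yes eq = eq
... | no _ = contradiction h λ ()

sum≥1 : ∀ a {b} → 1 ≤ a + b → (1 ≤ a) ⊎ (1 ≤ b)
sum≥1 zero h = inj₂ h
sum≥1 (suc a) h = inj₁ (s≤s z≤n)

-- Paths with additive weights, and cycles.

module Paths {n : ℕ} (G : Graph n) where

  infix 4 _~_
  _~_ : Fin n → Fin n → Set
  u ~ v = Adj G u v

  ~-sym : ∀ {u v} → u ~ v → v ~ u
  ~-sym {u} {v} e = trans (Graph.sym G v u) e

  ~-irrefl : ∀ {v} → ¬ v ~ v
  ~-irrefl {v} e with trans (≡-sym e) (Graph.irrefl G v)
  ... | ()

  ~⇒≢ : ∀ {u v} → u ~ v → u ≢ v
  ~⇒≢ e refl = ~-irrefl e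

  _~?_ : ∀ u v → Dec (u ~ v)
  u ~? v = adj G u v Bool.≟ true

  -- Reversal is a constructor so that every additive weight of a composite path computes to a sum over its pieces.
  infixr 5 _⊕⟨_⟩_
  data Path : Fin n → Fin n → Set where
    [_] : ∀ v → Path v v
    _⊕⟨_⟩_ : ∀ {u v w z} → Path u v → v ~ w → Path w z → Path u z
    rv : ∀ {u v} → Path u v → Path v u

  wt : ∀ {u v} → (Fin n → ℕ) → Path u v → ℕ
  wt f [ v ] = f v
  wt f (p ⊕⟨ _ ⟩ q) = wt f p + wt f q
  wt f (rv p) = wt f p

  one : Fin n → ℕ
  one _ = 1

  len : ∀ {u v} → Path u v → ℕ
  len = wt one

  -- A record because `wt` computes: an unfolded inequality would no longer determine the vertex and
  -- the path for inference.
  record On {u v : Fin n} (z : Fin n) (p : Path u v) : Set where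
    constructor mkOn
    field occ : 1 ≤ wt (ind z) p
  open On public

  On? : ∀ {u v} z (p : Path u v) → Dec (On z p)
  On? z p = map′ mkOn occ (1 ≤? wt (ind z) p)

  record Simple {u v : Fin n} (p : Path u v) : Set where
    constructor mkSimple
    field mult : ∀ z → wt (ind z) p ≤ 1
  open Simple public

  On-src : ∀ {u v} (p : Path u v) → On u p
  On-tgt : ∀ {u v} (p : Path u v) → On v p
  On-src [ v ] = mkOn (ℕₚ.≤-reflexive (≡-sym (ind-refl v)))
  On-src (p ⊕⟨ _ ⟩ q) = mkOn (ℕₚ.≤-trans (occ (On-src p)) (ℕₚ.m≤m+n _ _))
  On-src (rv p) = mkOn (occ (On-tgt p))
  On-tgt [ v ] = mkOn (ℕₚ.≤-reflexive (≡-sym (ind-refl v)))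
  On-tgt (p ⊕⟨ _ ⟩ q) = mkOn (ℕₚ.≤-trans (occ (On-tgt q)) (ℕₚ.m≤n+m _ _))
  On-tgt (rv p) = mkOn (occ (On-src p))

  On-[] : ∀ {z v} → On z [ v ] → z ≡ v
  On-[] h = ind-≡ (occ h)

  On-⊕ : ∀ {z u v w x} {p : Path u v} {e : v ~ w} {q : Path w x} → On z (p ⊕⟨ e ⟩ q) → On z p ⊎ On z q
  On-⊕ {z} {p = p} h with sum≥1 (wt (ind z) p) (occ h)
  ... | inj₁ h₁ = inj₁ (mkOn h₁)
  ... | inj₂ h₂ = inj₂ (mkOn h₂)

  On-⊕ˡ : ∀ {z u v w x} {p : Path u v} {e : v ~ w} {q : Path w x} → On z p → On z (p ⊕⟨ e ⟩ q)
  On-⊕ˡ h = mkOn (ℕₚ.≤-trans (occ h) (ℕₚ.m≤m+n _ _))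

  On-⊕ʳ : ∀ {z u v w x} {p : Path u v} {e : v ~ w} {q : Path w x} → On z q → On z (p ⊕⟨ e ⟩ q)
  On-⊕ʳ h = mkOn (ℕₚ.≤-trans (occ h) (ℕₚ.m≤n+m _ _))

  On-rv : ∀ {z u v} {p : Path u v} → On z (rv p) → On z p
  On-rv h = mkOn (occ h)

  ¬On⇒0 : ∀ {z u v} {p : Path u v} → ¬ On z p → wt (ind z) p ≡ 0
  ¬On⇒0 {z} {p = p} h with wt (ind z) p in eq
  ... | zero = refl
  ... | suc _ = contradiction (mkOn (subst (1 ≤_) (≡-sym eq) (s≤s z≤n))) h

  len≥1 : ∀ {u v} (p : Path u v) → 1 ≤ len p
  len≥1 [ v ] = s≤s z≤n
  len≥1 (p ⊕⟨ _ ⟩ q) = ℕₚ.≤-trans (len≥1 p) (ℕₚ.m≤m+n _ _)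
  len≥1 (rv p) = len≥1 p

  -- One identity for all weights yields the lengths of the pieces, their simplicity and their
  -- vertex sets. The vertex `z` ends one piece and starts the other, so it is counted twice.
  split : ∀ {u v z} (p : Path u v) → On z p →
          Σ[ a ∈ Path u z ] Σ[ b ∈ Path z v ] (∀ f → wt f a + wt f b ≡ wt f p + f z)
  split [ v ] h with refl ← On-[] h = [ v ] , [ v ] , λ f → refl
  split {z = z} (p ⊕⟨ e ⟩ q) h with On-⊕ h
  ... | inj₁ h₁ with a , b , eq ← split p h₁ = a , b ⊕⟨ e ⟩ q ,
          λ f → trans (≡-sym (ℕₚ.+-assoc (wt f a) _ _)) (trans (cong (_+ wt f q) (eq f)) (l (wt f p) (f z) (wt f q)))
    where
    l : ∀ x y w → x + y + w ≡ x + w + y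
    l x y w = solve (x ∷ y ∷ w ∷ [])
  ... | inj₂ h₂ with a , b , eq ← split q h₂ = p ⊕⟨ e ⟩ a , b ,
          λ f → trans (ℕₚ.+-assoc (wt f p) _ _) (trans (cong (wt f p +_) (eq f)) (≡-sym (ℕₚ.+-assoc (wt f p) _ _)))
  split (rv p) h with a , b , eq ← split p (On-rv h) = rv b , rv a , λ f → trans (ℕₚ.+-comm (wt f b) _) (eq f)

  infixr 5 _∷⟨_⟩_
  -- Cons form of a path. A `Path` may be nested and reversed anywhere, so the single positions that
  -- `Cycle` asks for become accessible only after this normalisation, which preserves all weights.
  data LPath : Fin n → Fin n → Set where
    [_]ˡ : ∀ v → LPath v v
    _∷⟨_⟩_ : ∀ u {w v} → u ~ w → LPath w v → LPath u v

  fromL : ∀ {u v} → LPath u v → Path u v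
  fromL [ v ]ˡ = [ v ]
  fromL (u ∷⟨ e ⟩ p) = [ u ] ⊕⟨ e ⟩ fromL p

  appendL : ∀ {u v w z} → LPath u v → v ~ w → LPath w z → LPath u z
  appendL [ v ]ˡ e q = v ∷⟨ e ⟩ q
  appendL (u ∷⟨ d ⟩ p) e q = u ∷⟨ d ⟩ appendL p e q

  revL : ∀ {u v} → LPath u v → LPath v u
  revL [ v ]ˡ = [ v ]ˡ
  revL (u ∷⟨ e ⟩ p) = appendL (revL p) (~-sym e) [ u ]ˡ

  toL : ∀ {u v} → Path u v → LPath u v
  toL [ v ] = [ v ]ˡ
  toL (p ⊕⟨ e ⟩ q) = appendL (toL p) e (toL q)
  toL (rv p) = revL (toL p)

  wt-appendL : ∀ f {u v w z} (p : LPath u v) (e : v ~ w) (q : LPath w z) →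
               wt f (fromL (appendL p e q)) ≡ wt f (fromL p) + wt f (fromL q)
  wt-appendL f [ v ]ˡ e q = refl
  wt-appendL f (u ∷⟨ _ ⟩ p) e q = trans (cong (f u +_) (wt-appendL f p e q)) (≡-sym (ℕₚ.+-assoc (f u) _ _))

  wt-revL : ∀ f {u v} (p : LPath u v) → wt f (fromL (revL p)) ≡ wt f (fromL p)
  wt-revL f [ v ]ˡ = refl
  wt-revL f (u ∷⟨ e ⟩ p) = trans (wt-appendL f (revL p) (~-sym e) [ u ]ˡ) (trans (cong (_+ f u) (wt-revL f p)) (ℕₚ.+-comm _ (f u)))

  wt-toL : ∀ f {u v} (p : Path u v) → wt f (fromL (toL p)) ≡ wt f p
  wt-toL f [ v ] = refl
  wt-toL f (p ⊕⟨ e ⟩ q) = trans (wt-appendL f (toL p) e (toL q)) (cong₂ _+_ (wt-toL f p) (wt-toL f q))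
  wt-toL f (rv p) = trans (wt-revL f (toL p)) (wt-toL f p)

  size : ∀ {u v} → LPath u v → ℕ
  size [ v ]ˡ = 0
  size (u ∷⟨ _ ⟩ p) = suc (size p)

  size-len : ∀ {u v} (p : LPath u v) → suc (size p) ≡ len (fromL p)
  size-len [ v ]ˡ = refl
  size-len (u ∷⟨ _ ⟩ p) = cong suc (size-len p)

  at : ∀ {u v} (p : LPath u v) → Fin (suc (size p)) → Fin n
  at [ v ]ˡ _ = v
  at (u ∷⟨ _ ⟩ p) zero = u
  at (u ∷⟨ _ ⟩ p) (suc i) = at p i

  at-On : ∀ {u v} (p : LPath u v) i → On (at p i) (fromL p)
  at-On [ v ]ˡ i = On-src [ v ]
  at-On (u ∷⟨ e ⟩ p) zero = On-src ([ u ] ⊕⟨ e ⟩ fromL p)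
  at-On (u ∷⟨ _ ⟩ p) (suc i) = On-⊕ʳ (at-On p i)

  at-zero : ∀ {u v} (p : LPath u v) i → toℕ i ≡ 0 → at p i ≡ u
  at-zero [ v ]ˡ i _ = refl
  at-zero (u ∷⟨ _ ⟩ p) zero _ = refl

  at-last : ∀ {u v} (p : LPath u v) i → toℕ i ≡ size p → at p i ≡ v
  at-last [ v ]ˡ i _ = refl
  at-last (u ∷⟨ _ ⟩ p) (suc i) eq = at-last p i (ℕₚ.suc-injective eq)

  at-suc : ∀ {u v} (p : LPath u v) i j → toℕ j ≡ suc (toℕ i) → at p i ~ at p j
  at-suc [ v ]ˡ zero zero ()
  at-suc (u ∷⟨ e ⟩ p) zero (suc j) eq = subst (u ~_) (≡-sym (at-zero p j (ℕₚ.suc-injective eq))) e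
  at-suc (u ∷⟨ _ ⟩ p) (suc i) (suc j) eq = at-suc p i j (ℕₚ.suc-injective eq)

  simple-tail : ∀ {u w v} {e : u ~ w} {p : Path w v} → Simple ([ u ] ⊕⟨ e ⟩ p) → Simple p × ¬ On u p
  simple-tail {u} {p = p} s = mkSimple (λ z → ℕₚ.≤-trans (ℕₚ.m≤n+m _ (ind z u)) (mult s z)) ,
    λ h → ℕₚ.<-irrefl refl (ℕₚ.≤-trans (s≤s (occ h)) (subst (λ k → k + wt (ind u) p ≤ 1) (ind-refl u) (mult s u)))

  at-injective : ∀ {u v} (p : LPath u v) → Simple (fromL p) → ∀ {i j} → at p i ≡ at p j → i ≡ j
  at-injective [ v ]ˡ s {zero} {zero} _ = refl
  at-injective (u ∷⟨ _ ⟩ p) s {zero} {zero} _ = refl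
  at-injective (u ∷⟨ _ ⟩ p) s {zero} {suc j} eq =
    contradiction (subst (λ z → On z (fromL p)) (≡-sym eq) (at-On p j)) (proj₂ (simple-tail s))
  at-injective (u ∷⟨ _ ⟩ p) s {suc i} {zero} eq =
    contradiction (subst (λ z → On z (fromL p)) eq (at-On p i)) (proj₂ (simple-tail s))
  at-injective (u ∷⟨ _ ⟩ p) s {suc i} {suc j} eq = cong suc (at-injective p (proj₁ (simple-tail s)) eq)

  closedL⇒Cycle : ∀ {u v} (p : LPath u v) → v ~ u → Simple (fromL p) → 3 ≤ suc (size p) → Cycle G (suc (size p))
  closedL⇒Cycle p e s h = record
    { length≥3 = h
    ; vert = at p
    ; distinct = at-injective p s
    ; edges = λ { i j (inj₁ eq) → at-suc p i j eq
                ; i j (inj₂ (eq , eq′)) → subst₂ _~_ (≡-sym (at-last p i eq)) (≡-sym (at-zero p j eq′)) e } }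

  closed⇒Cycle : ∀ {u v} (p : Path u v) → v ~ u → Simple p → 3 ≤ len p → Cycle G (len p)
  closed⇒Cycle p e s h = subst (Cycle G) eq (closedL⇒Cycle (toL p) e
      (mkSimple λ z → subst (_≤ 1) (≡-sym (wt-toL (ind z) p)) (mult s z)) (subst (3 ≤_) (≡-sym eq) h))
    where
    eq : suc (size (toL p)) ≡ len p
    eq = trans (size-len (toL p)) (wt-toL one p)

  along : ∀ m (f : Fin (suc m) → Fin n) → (∀ i → f (inject₁ i) ~ f (suc i)) → Path (f zero) (f (fromℕ m))
  along zero f e = [ f zero ]
  along (suc m) f e = [ f zero ] ⊕⟨ e zero ⟩ along m (λ i → f (suc i)) (λ i → e (suc i))

  len-along : ∀ m f e → len (along m f e) ≡ suc m
  len-along zero f e = refl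
  len-along (suc m) f e = cong suc (len-along m (λ i → f (suc i)) (λ i → e (suc i)))

  On-along : ∀ m f e {z} → On z (along m f e) → ∃ λ i → z ≡ f i
  On-along zero f e h = zero , On-[] h
  On-along (suc m) f e h with On-⊕ h
  ... | inj₁ h₁ = zero , On-[] h₁
  ... | inj₂ h₂ with i , eq ← On-along m (λ i → f (suc i)) (λ i → e (suc i)) h₂ = suc i , eq

  Simple-along : ∀ m f e → Injective _≡_ _≡_ f → Simple (along m f e)
  Simple-along zero f e inj = mkSimple λ z → ind≤1 z (f zero)
  Simple-along (suc m) f e inj = mkSimple mul
    where
    rest = along m (λ i → f (suc i)) (λ i → e (suc i))
    mul : ∀ z → ind z (f zero) + wt (ind z) rest ≤ 1
    mul z with z Fin.≟ f zero
    ... | no _ = mult (Simple-along m (λ i → f (suc i)) (λ i → e (suc i)) (λ eq → Finₚ.suc-injective (inj eq))) z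
    ... | yes refl = ℕₚ.≤-reflexive (cong suc (¬On⇒0 {p = rest} λ h → absurd (On-along m _ _ h)))
      where
      absurd : ¬ ∃ λ i → f zero ≡ f (suc i)
      absurd (i , eq) with inj eq
      ... | ()

  record Closed (c : ℕ) : Set where
    field
      {s t} : Fin n
      path : Path s t
      close : t ~ s
      simple : Simple path
      len≡ : len path ≡ c

  Cycle⇒Closed : ∀ {c} → Cycle G c → Closed c
  Cycle⇒Closed {suc m} C = record
    { path = along m vert e ; close = edges (fromℕ m) zero (inj₂ (Finₚ.toℕ-fromℕ m , refl))
    ; simple = Simple-along m vert e distinct ; len≡ = len-along m vert e }
    where
    open Cycle C
    e : ∀ i → vert (inject₁ i) ~ vert (suc i)
    e i = edges (inject₁ i) (suc i) (inj₁ (cong suc (≡-sym (Finₚ.toℕ-inject₁ i))))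
  Cycle⇒Closed {zero} C = contradiction (Cycle.length≥3 C) λ ()

-- Counting in duplicate-free lists.

unique-⊆⇒length≤ : ∀ {A : Set} {xs ys : List A} → Unique xs → (∀ {x} → x ∈ xs → x ∈ ys) → length xs ≤ length ys
unique-⊆⇒length≤ {xs = []} _ _ = z≤n
unique-⊆⇒length≤ {xs = x ∷ xs} {ys} (x∉ AllPairs.∷ u) sub with as , bs , refl ← ∈ₚ.∈-∃++ (sub (here refl)) =
  ℕₚ.≤-trans (s≤s (unique-⊆⇒length≤ u sub′)) (ℕₚ.≤-reflexive eq)
  where
  eq : suc (length (as ++ bs)) ≡ length (as ++ x ∷ bs)
  eq = trans (cong suc (Listₚ.length-++ as)) (trans (≡-sym (ℕₚ.+-suc (length as) _)) (≡-sym (Listₚ.length-++ as)))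
  sub′ : ∀ {y} → y ∈ xs → y ∈ as ++ bs
  sub′ y∈ with ∈ₚ.∈-++⁻ as (sub (there y∈))
  ... | inj₁ h = ∈ₚ.∈-++⁺ˡ h
  ... | inj₂ (here refl) = contradiction refl (All.lookup x∉ y∈)
  ... | inj₂ (there h) = ∈ₚ.∈-++⁺ʳ as h

elems : ∀ {n} → Subset n → List (Fin n)
elems Vec.[] = []
elems (true Vec.∷ p) = zero ∷ map suc (elems p)
elems (false Vec.∷ p) = map suc (elems p)

length-elems : ∀ {n} (p : Subset n) → length (elems p) ≡ ∣ p ∣
length-elems Vec.[] = refl
length-elems (true Vec.∷ p) = cong suc (trans (Listₚ.length-map suc (elems p)) (length-elems p))
length-elems (false Vec.∷ p) = trans (Listₚ.length-map suc (elems p)) (length-elems p)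

elems-unique : ∀ {n} (p : Subset n) → Unique (elems p)
elems-unique Vec.[] = AllPairs.[]
elems-unique (true Vec.∷ p) =
  All.tabulate (λ h eq → case ∈ₚ.∈-map⁻ suc h of λ { (_ , _ , eq′) → case trans eq eq′ of λ () })
  AllPairs.∷ Uniqueₚ.map⁺ Finₚ.suc-injective (elems-unique p)
elems-unique (false Vec.∷ p) = Uniqueₚ.map⁺ Finₚ.suc-injective (elems-unique p)

∈-elems⁻ : ∀ {n} (p : Subset n) {v} → v ∈ elems p → Vec.lookup p v ≡ true
∈-elems⁻ (true Vec.∷ p) (here refl) = refl
∈-elems⁻ (true Vec.∷ p) (there h) with _ , h′ , refl ← ∈ₚ.∈-map⁻ suc h = ∈-elems⁻ p h′
∈-elems⁻ (false Vec.∷ p) h with _ , h′ , refl ← ∈ₚ.∈-map⁻ suc h = ∈-elems⁻ p h′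

length-filter-split : ∀ {A : Set} {P : A → Set} (P? : ∀ x → Dec (P x)) xs →
                      length xs ≡ length (filter P? xs) + length (filter (λ x → ¬? (P? x)) xs)
length-filter-split P? [] = refl
length-filter-split P? (x ∷ xs) with P? x
... | yes _ = cong suc (length-filter-split P? xs)
... | no _ = trans (cong suc (length-filter-split P? xs)) (≡-sym (ℕₚ.+-suc _ _))

∈-elems⁺ : ∀ {n} (p : Subset n) {v} → Vec.lookup p v ≡ true → v ∈ elems p
∈-elems⁺ (true Vec.∷ p) {zero} _ = here refl
∈-elems⁺ (true Vec.∷ p) {suc v} eq = there (∈ₚ.∈-map⁺ suc (∈-elems⁺ p eq))
∈-elems⁺ (false Vec.∷ p) {suc v} eq = ∈ₚ.∈-map⁺ suc (∈-elems⁺ p eq)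

-- Walks, components and the use of toughness.

module Walks {n : ℕ} (G : Graph n) where

  open Paths G

  open import Data.List.Membership.DecPropositional (Fin._≟_ {n}) public using (_∈?_; _∉?_)

  nbrs : Fin n → List (Fin n)
  nbrs v = elems (tabulate (adj G v))

  length-nbrs : ∀ v → length (nbrs v) ≡ deg G v
  length-nbrs v = length-elems (tabulate (adj G v))

  nbrs-unique : ∀ v → Unique (nbrs v)
  nbrs-unique v = elems-unique (tabulate (adj G v))

  ∈-nbrs⁻ : ∀ {v w} → w ∈ nbrs v → v ~ w
  ∈-nbrs⁻ {v} {w} h = trans (≡-sym (Vecₚ.lookup∘tabulate (adj G v) w)) (∈-elems⁻ (tabulate (adj G v)) h)

  ∈-nbrs⁺ : ∀ {v w} → v ~ w → w ∈ nbrs v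
  ∈-nbrs⁺ {v} {w} e = ∈-elems⁺ (tabulate (adj G v)) (trans (Vecₚ.lookup∘tabulate (adj G v) w) e)

  data Walk (P : Fin n → Set) : Fin n → Fin n → Set where
    stop : ∀ {u} → P u → Walk P u u
    step : ∀ {u w v} → P u → u ~ w → Walk P w v → Walk P u v

  walk-trans : ∀ {P u v w} → Walk P u v → Walk P v w → Walk P u w
  walk-trans (stop _) q = q
  walk-trans (step h e p) q = step h e (walk-trans p q)

  walk-src : ∀ {P u v} → Walk P u v → P u
  walk-src (stop h) = h
  walk-src (step h _ _) = h

  walk-tgt : ∀ {P u v} → Walk P u v → P v
  walk-tgt (stop h) = h
  walk-tgt (step _ _ p) = walk-tgt p

  walk-snoc : ∀ {P u v w} → Walk P u v → v ~ w → P w → Walk P u w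
  walk-snoc p e h = walk-trans p (step (walk-tgt p) e (stop h))

  walk-sym : ∀ {P u v} → Walk P u v → Walk P v u
  walk-sym (stop h) = stop h
  walk-sym (step h e p) = walk-snoc (walk-sym p) (~-sym e) h

  -- Every vertex of a walk from `u` is reached by an initial part of it. So a component, defined as
  -- a set of reachable vertices, is connected within itself.
  walk-confined : ∀ {P u v} → Walk P u v → Walk (λ z → Walk P u z) u v
  walk-confined {P} {u} p = go (stop (walk-src p)) p
    where
    go : ∀ {w v} → Walk P u w → Walk P w v → Walk (λ z → Walk P u z) w v
    go q (stop h) = stop q
    go q (step h e r) = step q e (go (walk-snoc q e (walk-src r)) r)

  wt≥tgt : ∀ f {u v} (p : Path u v) → f v ≤ wt f p
  wt≥src : ∀ f {u v} (p : Path u v) → f u ≤ wt f p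
  wt≥tgt f [ v ] = ℕₚ.≤-refl
  wt≥tgt f (p ⊕⟨ _ ⟩ q) = ℕₚ.≤-trans (wt≥tgt f q) (ℕₚ.m≤n+m _ _)
  wt≥tgt f (rv p) = wt≥src f p
  wt≥src f [ v ] = ℕₚ.≤-refl
  wt≥src f (p ⊕⟨ _ ⟩ q) = ℕₚ.≤-trans (wt≥src f p) (ℕₚ.m≤m+n _ _)
  wt≥src f (rv p) = wt≥tgt f p

  split-suffix≤ : ∀ {u v z} (p : Path u v) (a : Path u z) (b : Path z v) →
                  (∀ f → wt f a + wt f b ≡ wt f p + f z) → ∀ f → wt f b ≤ wt f p
  split-suffix≤ {z = z} p a b eq f = lemma (wt f a) (wt f b) (wt f p) (f z) (eq f) (wt≥tgt f a)
    where
    lemma : ∀ x y w k → x + y ≡ w + k → k ≤ x → y ≤ w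
    lemma x y w k e h = ℕₚ.+-cancelʳ-≤ k y w
      (ℕₚ.≤-trans (ℕₚ.+-monoʳ-≤ y h) (ℕₚ.≤-reflexive (trans (ℕₚ.+-comm y x) e)))

  On-suffix : ∀ {u v x y z} {p : Path u v} {b : Path x y} → (∀ f → wt f b ≤ wt f p) → On z b → On z p
  On-suffix h o = mkOn (ℕₚ.≤-trans (occ o) (h _))

  -- If the new first vertex already lies on the simple path found for the rest, everything before
  -- it on that path is cut away.
  simplify : ∀ {P u v} → Walk P u v → Σ[ p ∈ Path u v ] Simple p × (∀ {z} → On z p → P z)
  simplify {u = u} (stop h) = [ u ] , mkSimple (λ z → ind≤1 z u) , λ o → subst _ (≡-sym (On-[] o)) h
  simplify {P} {u} (step h e w) with simplify w
  ... | p , s , all with On? u p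
  ... | yes o with a , b , eq ← split p o =
    b , mkSimple (λ z → ℕₚ.≤-trans (split-suffix≤ p a b eq (ind z)) (mult s z)) ,
    λ o′ → all (On-suffix {p = p} {b = b} (split-suffix≤ p a b eq) o′)
  ... | no ¬o = [ u ] ⊕⟨ e ⟩ p , mkSimple mul , all′
    where
    mul : ∀ z → ind z u + wt (ind z) p ≤ 1
    mul z with z Fin.≟ u
    ... | yes refl = ℕₚ.≤-reflexive (cong suc (¬On⇒0 ¬o))
    ... | no _ = mult s z
    all′ : ∀ {z} → On z ([ u ] ⊕⟨ e ⟩ p) → P z
    all′ o with On-⊕ o
    ... | inj₁ o₁ = subst P (≡-sym (On-[] o₁)) h
    ... | inj₂ o₂ = all o₂

  path⇒walk : ∀ {P u v} (p : LPath u v) → (∀ {z} → On z (fromL p) → P z) → Walk P u v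
  path⇒walk [ v ]ˡ h = stop (h (On-src [ v ]))
  path⇒walk (u ∷⟨ e ⟩ p) h = step (h (On-⊕ˡ (On-src [ u ]))) e (path⇒walk p (λ o → h (On-⊕ʳ o)))

  WalkN : (Fin n → Set) → ℕ → Fin n → Fin n → Set
  WalkN P zero u v = u ≡ v × P u
  WalkN P (suc m) u v = P u × ∃ λ w → u ~ w × WalkN P m w v

  walkN⇒walk : ∀ {P} m {u v} → WalkN P m u v → Walk P u v
  walkN⇒walk zero (refl , h) = stop h
  walkN⇒walk (suc m) (h , w , e , p) = step h e (walkN⇒walk m p)

  walkN? : ∀ {P} → (∀ z → Dec (P z)) → ∀ m u v → Dec (WalkN P m u v)
  walkN? P? zero u v = (u Fin.≟ v) ×-dec P? u
  walkN? P? (suc m) u v = P? u ×-dec Finₚ.any? (λ w → (u ~? w) ×-dec walkN? P? m w v)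

  pathN : ∀ {P u v} (p : LPath u v) → (∀ {z} → On z (fromL p) → P z) → WalkN P (size p) u v
  pathN [ v ]ˡ h = refl , h (On-src [ v ])
  pathN (u ∷⟨ e ⟩ p) h = h (On-⊕ˡ (On-src [ u ])) , _ , e , pathN p (λ o → h (On-⊕ʳ o))

  -- A walk reduces to a simple path, which has at most `n` vertices, so it suffices to try the step
  -- numbers below `n`.
  walk? : ∀ {P} → (∀ z → Dec (P z)) → ∀ u v → Dec (Walk P u v)
  walk? {P} P? u v = map′ (λ (i , w) → walkN⇒walk (toℕ i) w) there′ (Finₚ.any? (λ i → walkN? P? (toℕ i) u v))
    where
    there′ : Walk P u v → ∃ λ (i : Fin n) → WalkN P (toℕ i) u v
    there′ w with p , s , all ← simplify w = Fin.fromℕ< lt , subst (λ k → WalkN P k u v) (≡-sym (Finₚ.toℕ-fromℕ< lt))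
        (pathN (toL p) (λ {z} o → all (mkOn (subst (1 ≤_) (wt-toL (ind z) p) (occ o)))))
      where
      s′ : Simple (fromL (toL p))
      s′ = mkSimple λ z → subst (_≤ 1) (≡-sym (wt-toL (ind z) p)) (mult s z)
      lt : suc (size (toL p)) ≤ n
      lt = Finₚ.injective⇒≤ (at-injective (toL p) s′)

  module _ (l : List (Fin n)) where

    cut : Subset n
    cut = tabulate (λ v → does (v ∈? l))

    ∈-cut⁻ : ∀ {v} → v ∈ˢ cut → v ∈ l
    ∈-cut⁻ {v} h with v ∈? l | trans (≡-sym (Vecₚ.lookup∘tabulate (λ v → does (v ∈? l)) v)) (Vecₚ.[]=⇒lookup h)
    ... | yes h′ | _ = h′
    ... | no _ | ()

    ∈-cut⁺ : ∀ {v} → v ∈ l → v ∈ˢ cut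
    ∈-cut⁺ {v} h = Vecₚ.lookup⇒[]= v cut (trans (Vecₚ.lookup∘tabulate (λ v → does (v ∈? l)) v) eq)
      where
      eq : does (v ∈? l) ≡ true
      eq with v ∈? l
      ... | yes _ = refl
      ... | no h′ = contradiction h h′

    ∣cut∣≤ : ∣ cut ∣ ≤ length l
    ∣cut∣≤ = subst (_≤ length l) (length-elems cut) (unique-⊆⇒length≤ (elems-unique cut)
      (λ h → ∈-cut⁻ (Vecₚ.lookup⇒[]= _ cut (∈-elems⁻ cut h))))

    conn⇒walk : ∀ {u v} → Conn G cut u v → Walk (_∉ l) u v
    conn⇒walk (here h) = stop (λ h′ → h (∈-cut⁺ h′))
    conn⇒walk (step h e p) = step (λ h′ → h (∈-cut⁺ h′)) e (conn⇒walk p)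

    walk⇒conn : ∀ {u v} → Walk (_∉ l) u v → Conn G cut u v
    walk⇒conn (stop h) = here (λ h′ → h (∈-cut⁻ h′))
    walk⇒conn (step h e p) = step (λ h′ → h (∈-cut⁻ h′)) e (walk⇒conn p)

    Separated : List (Fin n) → Set
    Separated = AllPairs (λ u v → ¬ Walk (_∉ l) u v)

    -- Greedy completion: a vertex of `xs` off the cut joins the representatives if no walk leads
    -- from it to an earlier one. Run over all vertices, this gives one representative per
    -- component, and `components` uses the positions as labels.
    extend : ∀ xs rs → All (_∉ l) rs → Separated rs →
             Σ[ rs′ ∈ List (Fin n) ] All (_∉ l) rs′ × Separated rs′ × length rs ≤ length rs′ ×
             (∀ {r} → r ∈ rs → r ∈ rs′) ×
             (∀ {x} → x ∈ xs → x ∉ l → Any.Any (Walk (_∉ l) x) rs′)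
    extend [] rs out sep = rs , out , sep , ℕₚ.≤-refl , id , λ ()
    extend (x ∷ xs) rs out sep with x ∈? l
    ... | yes x∈ with rs′ , out′ , sep′ , le , sub , cov ← extend xs rs out sep =
      rs′ , out′ , sep′ , le , sub , λ { (here refl) h → contradiction x∈ h ; (there h) → cov h }
    ... | no x∉ with Any.any? (walk? (_∉? l) x) rs
    ... | yes a with rs′ , out′ , sep′ , le , sub , cov ← extend xs rs out sep =
      rs′ , out′ , sep′ , le , sub , λ { (here refl) _ → let r , r∈ , w = find a in lose (sub r∈) w ; (there h) → cov h }
    ... | no ¬a with rs′ , out′ , sep′ , le , sub , cov ←
              extend xs (x ∷ rs) (x∉ All.∷ out) (Allₚ.¬Any⇒All¬ rs ¬a AllPairs.∷ sep) =
      rs′ , out′ , sep′ , ℕₚ.≤-trans (ℕₚ.n≤1+n _) le , (λ h → sub (there h)) ,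
      λ { (here refl) _ → lose (sub (here refl)) (stop x∉) ; (there h) → cov h }

    lookup-separated : ∀ {rs} → Separated rs → ∀ i j → Walk (_∉ l) (lookup rs i) (lookup rs j) → i ≡ j
    lookup-separated (_ AllPairs.∷ _) zero zero _ = refl
    lookup-separated (h AllPairs.∷ _) zero (suc j) w = contradiction w (All.lookup h (∈ₚ.∈-lookup j))
    lookup-separated (h AllPairs.∷ _) (suc i) zero w = contradiction (walk-sym w) (All.lookup h (∈ₚ.∈-lookup i))
    lookup-separated (_ AllPairs.∷ s) (suc i) (suc j) w = cong suc (lookup-separated s i j w)

    components : ∀ rs → All (_∉ l) rs → Separated rs → ∃ λ k → NumComponents G cut k × length rs ≤ k
    components rs out sep with rs′ , out′ , sep′ , le , _ , cov ← extend (allFin n) rs out sep =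
      length rs′ , (lab , (λ u v pu pv → mk⇔ (to pu pv) (from pu pv)) , onto) , le
      where
      found : ∀ v → v ∉ˢ cut → Any.Any (Walk (_∉ l) v) rs′
      found v h = cov (∈ₚ.∈-allFin v) (λ h′ → h (∈-cut⁺ h′))
      lab : ∀ v → v ∉ˢ cut → Fin (length rs′)
      lab v h = Any.index (found v h)
      labWalk : ∀ v (h : v ∉ˢ cut) → Walk (_∉ l) v (lookup rs′ (lab v h))
      labWalk v h = Anyₚ.lookup-index (found v h)
      to : ∀ {u v} (pu : u ∉ˢ cut) (pv : v ∉ˢ cut) → lab u pu ≡ lab v pv → Conn G cut u v
      to {u} {v} pu pv eq = walk⇒conn (walk-trans (labWalk u pu)
        (subst (λ i → Walk (_∉ l) (lookup rs′ i) v) (≡-sym eq) (walk-sym (labWalk v pv))))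
      from : ∀ {u v} (pu : u ∉ˢ cut) (pv : v ∉ˢ cut) → Conn G cut u v → lab u pu ≡ lab v pv
      from {u} {v} pu pv c = lookup-separated sep′ _ _
        (walk-trans (walk-sym (labWalk u pu)) (walk-trans (conn⇒walk c) (labWalk v pv)))
      onto : ∀ i → Σ[ v ∈ Fin n ] Σ[ pv ∈ (v ∉ˢ cut) ] lab v pv ≡ i
      onto i = v , pv , lookup-separated sep′ _ _ (walk-sym (labWalk v pv))
        where
        v = lookup rs′ i
        pv : v ∉ˢ cut
        pv h = All.lookup out′ (∈ₚ.∈-lookup i) (∈-cut⁻ h)

  -- Separated vertices lie in different components, so there are k ≥ 2 components and k < t k ≤
  -- `∣ cut l ∣`. Strictness between integers gains the `suc` on which all later uses depend; the
  -- rational toughness is unfolded only here.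
  tough⇒cut-large : ToughnessGreaterThanOne G → ∀ l rs → All (_∉ l) rs → Separated l rs → 2 ≤ length rs →
                    suc (length rs) ≤ length l
  tough⇒cut-large (t , 1<t , tough) l rs out sep two with components l rs out sep
  ... | k , nc , le = ℕₚ.≤-trans (s≤s le) (ℕₚ.≤-trans (ℕₚ.≰⇒> k≮) (∣cut∣≤ l))
    where
    positive : ∀ k → 1 < k → ℚᵘ.Positive ((ℤ.+ k) / 1)
    positive (suc _) _ = _
    1<k : 1 < k
    1<k = ℕₚ.≤-trans two le
    k/1 = (ℤ.+ k) / 1
    instance
      k-pos : ℚᵘ.Positive k/1
      k-pos = positive k 1<k
    strict : k/1 ℚᵘ.< (ℤ.+ ∣ cut l ∣) / 1
    strict = ℚᵘₚ.<-≤-trans (ℚᵘₚ.<-respˡ-≃ (ℚᵘₚ.*-identityˡ k/1) (ℚᵘₚ.*-monoˡ-<-pos k/1 1<t)) (tough (cut l) k nc 1<k)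
    k≮ : ¬ (∣ cut l ∣ ≤ k)
    k≮ h = ℚᵘₚ.<-irrefl ℚᵘₚ.≃-refl (ℚᵘₚ.<-≤-trans strict
      (ℚᵘ.*≤* (ℤₚ.*-monoʳ-≤-nonNeg (ℤ.+ 1) (ℤ.+≤+ h))))

-- Lobes: parts of a connected set that hang on a single vertex.

module Lobes {n : ℕ} (G : Graph n) where

  open Paths G
  open Walks G

  len≥2 : ∀ {u v} (p : Path u v) → u ≢ v → 2 ≤ len p
  len≥2 [ v ] ne = contradiction refl ne
  len≥2 (p ⊕⟨ _ ⟩ q) _ = len≥1 p ⊞ len≥1 q
  len≥2 (rv p) ne = len≥2 p (λ eq → ne (≡-sym eq))

  glueL : ∀ {u b v} (q : LPath u b) (p : Path b v) → Σ[ r ∈ Path u v ] (∀ f → wt f r + f b ≡ wt f (fromL q) + wt f p)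
  glueL [ b ]ˡ p = p , λ f → ℕₚ.+-comm (wt f p) _
  glueL (u ∷⟨ e ⟩ q) p with r , eq ← glueL q p =
    [ u ] ⊕⟨ e ⟩ r , λ f → trans (ℕₚ.+-assoc (f u) _ _) (trans (cong (f u +_) (eq f)) (≡-sym (ℕₚ.+-assoc (f u) _ _)))

  glue : ∀ {u b v} (q : Path u b) (p : Path b v) → Simple q → Simple p → (∀ {z} → On z q → On z p → z ≡ b) →
         Σ[ r ∈ Path u v ] Simple r × (∀ {z} → On z r → On z q ⊎ On z p) × len q ≤ len r × len p ≤ len r
  glue {b = b} q p sq sp disj with r , eq₀ ← glueL (toL q) p = r , mkSimple mul , on ,
      ℕₚ.+-cancelʳ-≤ 1 _ _ (ℕₚ.≤-trans (ℕₚ.+-monoʳ-≤ (len q) (len≥1 p)) (ℕₚ.≤-reflexive (≡-sym (eq one)))) ,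
      ℕₚ.+-cancelʳ-≤ 1 _ _ (ℕₚ.≤-trans (ℕₚ.≤-reflexive (ℕₚ.+-comm (len p) 1))
        (ℕₚ.≤-trans (ℕₚ.+-monoˡ-≤ (len p) (len≥1 q)) (ℕₚ.≤-reflexive (≡-sym (eq one)))))
    where
    eq : ∀ f → wt f r + f b ≡ wt f q + wt f p
    eq f = trans (eq₀ f) (cong (_+ wt f p) (wt-toL f q))
    mul : ∀ z → wt (ind z) r ≤ 1
    mul z with z Fin.≟ b | On? z q | On? z p
    ... | yes refl | _ | _ = ℕₚ.+-cancelʳ-≤ (ind z z) _ 1 (ℕₚ.≤-trans (ℕₚ.≤-reflexive (eq (ind z)))
          (ℕₚ.≤-trans (mult sq z ⊞ mult sp z) (ℕₚ.≤-reflexive (cong suc (≡-sym (ind-refl z))))))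
    ... | no ne | yes h | yes h′ = contradiction (disj h h′) ne
    ... | no ne | _ | no h = ℕₚ.≤-trans (ℕₚ.m≤m+n _ _) (ℕₚ.≤-trans (ℕₚ.≤-reflexive (eq (ind z)))
          (subst (λ k → wt (ind z) q + k ≤ 1) (≡-sym (¬On⇒0 h)) (ℕₚ.≤-trans (ℕₚ.≤-reflexive (ℕₚ.+-identityʳ _)) (mult sq z))))
    ... | no ne | no h | _ = ℕₚ.≤-trans (ℕₚ.m≤m+n _ _) (ℕₚ.≤-trans (ℕₚ.≤-reflexive (eq (ind z)))
          (subst (λ k → k + wt (ind z) p ≤ 1) (≡-sym (¬On⇒0 h)) (mult sp z)))
    on : ∀ {z} → On z r → On z q ⊎ On z p
    on {z} h with sum≥1 (wt (ind z) q) (subst (1 ≤_) (eq (ind z)) (ℕₚ.≤-trans (occ h) (ℕₚ.m≤m+n _ _)))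
    ... | inj₁ h₁ = inj₁ (mkOn h₁)
    ... | inj₂ h₂ = inj₂ (mkOn h₂)

  consPath : ∀ {x u v} (e : x ~ u) {p : Path u v} → Simple p → ¬ On x p → Simple ([ x ] ⊕⟨ e ⟩ p)
  consPath {x} e {p} s ¬o = mkSimple mul
    where
    mul : ∀ z → ind z x + wt (ind z) p ≤ 1
    mul z with z Fin.≟ x
    ... | yes refl = ℕₚ.≤-reflexive (cong suc (¬On⇒0 ¬o))
    ... | no _ = mult s z

  degIn : ∀ {K : Fin n → Set} → (∀ z → Dec (K z)) → Fin n → ℕ
  degIn K? v = length (filter K? (nbrs v))

  degIn-mono : ∀ {K L : Fin n → Set} (K? : ∀ z → Dec (K z)) (L? : ∀ z → Dec (L z)) {y} →
               (∀ {z} → K z → y ~ z → L z) → degIn K? y ≤ degIn L? y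
  degIn-mono K? L? {y} f = unique-⊆⇒length≤ (Uniqueₚ.filter⁺ K? (nbrs-unique y))
    (λ h → let h′ , k = ∈ₚ.∈-filter⁻ K? h in ∈ₚ.∈-filter⁺ L? h′ (f k (∈-nbrs⁻ h′)))

  order : ∀ {K : Fin n → Set} → (∀ z → Dec (K z)) → ℕ
  order K? = length (filter K? (allFin n))

  order-mono : ∀ {K L : Fin n → Set} (K? : ∀ z → Dec (K z)) (L? : ∀ z → Dec (L z)) →
               (∀ {z} → K z → L z) → order K? ≤ order L?
  order-mono K? L? f = unique-⊆⇒length≤ (Uniqueₚ.filter⁺ K? (Uniqueₚ.allFin⁺ n))
    (λ h → ∈ₚ.∈-filter⁺ L? (∈ₚ.∈-allFin _) (f (proj₂ (∈ₚ.∈-filter⁻ K? {xs = allFin n} h))))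

  order-< : ∀ {K L : Fin n → Set} (K? : ∀ z → Dec (K z)) (L? : ∀ z → Dec (L z)) {x} →
            (∀ {z} → K z → L z) → L x → ¬ K x → order K? < order L?
  order-< {K} K? L? {x} f lx ¬kx = unique-⊆⇒length≤ {xs = x ∷ filter K? (allFin n)}
    (All.tabulate (λ h eq → ¬kx (subst K (≡-sym eq) (proj₂ (∈ₚ.∈-filter⁻ K? {xs = allFin n} h))))
      AllPairs.∷ Uniqueₚ.filter⁺ K? (Uniqueₚ.allFin⁺ n))
    (λ { (here refl) → ∈ₚ.∈-filter⁺ L? (∈ₚ.∈-allFin _) lx
       ; (there h) → ∈ₚ.∈-filter⁺ L? (∈ₚ.∈-allFin _) (f (proj₂ (∈ₚ.∈-filter⁻ K? {xs = allFin n} h))) })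

  -- D hangs on the rest of K through the single vertex b, and b reaches each vertex of D by a path with d edges or more.
  record Lobe (K : Fin n → Set) (d : ℕ) (x : Fin n) : Set₁ where
    field
      D : Fin n → Set
      D? : ∀ z → Dec (D z)
      b y₀ : Fin n
      Dy₀ : D y₀
      D⊆K : ∀ {z} → D z → K z
      x∉D : ¬ D x
      b∈K : K b
      b∉D : ¬ D b
      closed : ∀ {y z} → D y → K z → y ~ z → D z ⊎ z ≡ b
      long : ∀ {y} → D y → Σ[ p ∈ Path b y ] Simple p × (∀ {z} → On z p → D z ⊎ z ≡ b) × suc d ≤ len p

    -- Edges of `K` leave `D` only towards `b`, so a walk that starts outside `D` cannot enter `D`
    -- before its first visit to `b`, where it is cut off.
    avoid : ∀ {w} → ¬ D w → Walk K w b → Walk (λ z → K z × ¬ D z) w b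
    avoid ¬w (stop k) = stop (k , ¬w)
    avoid {w} ¬w (step {w = z} k e r) with w Fin.≟ b
    ... | yes refl = stop (k , ¬w)
    ... | no w≢b with D? z
    ... | yes dz = contradiction (closed dz k (~-sym e)) [ ¬w , w≢b ]′
    ... | no ¬z = step (k , ¬w) e (avoid ¬z r)

    -- The approach to `b` stays off `D`, while the long path from `b` stays in `D` and `b`. They
    -- meet only in `b`, and the composite is at least as long as the second.
    across : ∀ {w y} → ¬ D w → Walk K w b → D y →
             Σ[ p ∈ Path w y ] Simple p × (∀ {z} → On z p → K z) × suc d ≤ len p
    across ¬w r dy with q , sq , onq ← simplify (avoid ¬w r) | p , sp , onp , lp ← long dy
      with g , sg , ong , _ , lg ← glue q p sq sp (λ o o′ → case onp o′ of λ { (inj₁ dz) → contradiction dz (proj₂ (onq o)) ; (inj₂ eq) → eq }) =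
      g , sg , (λ o → case ong o of λ { (inj₁ o₁) → proj₁ (onq o₁) ; (inj₂ o₂) → case onp o₂ of λ { (inj₁ dz) → D⊆K dz ; (inj₂ refl) → b∈K } }) ,
      ℕₚ.≤-trans lp lg

    Core : Fin n → Set
    Core z = D z ⊎ z ≡ b

    Core? : ∀ z → Dec (Core z)
    Core? z = D? z ⊎-dec (z Fin.≟ b)

    core-walk : ∀ {y} → Core y → Walk Core b y
    core-walk (inj₂ refl) = stop (inj₂ refl)
    core-walk (inj₁ dy) with p , _ , onp , _ ← long dy =
      path⇒walk (toL p) (λ {z} o → onp (mkOn (subst (1 ≤_) (wt-toL (ind z) p) (occ o))))

  -- The root of `Q` is the vertex `b` of `P`, which `Q` excludes from its lobe; so the lobe of `Q`
  -- lies in that of `P`. Its edges in `K` stay in the core of `P`, where `Q` controls them.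
  transfer : ∀ {K L : Fin n → Set} {d e x x′} (P : Lobe L e x′) →
             (∀ {y z} → Lobe.D P y → K z → y ~ z → Lobe.Core P z) → (∀ {z} → Lobe.Core P z → K z) → ¬ Lobe.D P x →
             Lobe (Lobe.Core P) d (Lobe.b P) → Lobe K d x
  transfer P cl sub ¬x Q = record
    { D = Q.D ; D? = Q.D? ; b = Q.b ; y₀ = Q.y₀ ; Dy₀ = Q.Dy₀ ; D⊆K = λ h → sub (Q.D⊆K h)
    ; x∉D = λ h → ¬x (inD h) ; b∈K = sub Q.b∈K ; b∉D = Q.b∉D
    ; closed = λ dy kz e → Q.closed dy (cl (inD dy) kz e) e ; long = Q.long }
    where
    module P = Lobe P
    module Q = Lobe Q
    inD : ∀ {z} → Q.D z → P.D z
    inD h with Q.D⊆K h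
    ... | inj₁ d = d
    ... | inj₂ refl = contradiction h Q.x∉D

  -- Inductive step of `lobe`: `K₁` is to be a component of `K` without `x`, `x′` a neighbour of `x`
  -- in it, and `P` a lobe seen from `x′` whose bound is one too low. Either `x` has a neighbour in
  -- the lobe and `whole` applies, or it has none and `inner` does.
  module Step {K K₁ : Fin n → Set} (K₁? : ∀ z → Dec (K₁ z)) {x x′ : Fin n} {e : ℕ} (kx : K x) (x~x′ : x ~ x′)
              (K₁x′ : K₁ x′) (K₁⊆K : ∀ {z} → K₁ z → K z) (¬K₁x : ¬ K₁ x)
              (grow : ∀ {y z} → K₁ y → K z → y ~ z → z ≢ x → K₁ z)
              (conn : ∀ {y} → K₁ y → Walk K₁ x′ y) (P : Lobe K₁ (suc e) x′) where

    open Lobe P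

    cl : ∀ {y z} → K₁ y → K z → y ~ z → K₁ z ⊎ z ≡ x
    cl {z = z} ky kz e with z Fin.≟ x
    ... | yes eq = inj₂ eq
    ... | no ne = inj₁ (grow ky kz e ne)

    Far : Fin n → Fin n → Set
    Far u y = Σ[ p ∈ Path u y ] Simple p × (∀ {z} → On z p → K₁ z) × suc (suc e) ≤ len p

    via : ∀ {u y} (e′ : x ~ u) → Far u y →
          Σ[ p ∈ Path x y ] Simple p × (∀ {z} → On z p → K₁ z ⊎ z ≡ x) × suc (suc (suc e)) ≤ len p
    via {u} e′ (p , s , on , l) = [ x ] ⊕⟨ e′ ⟩ p , consPath e′ s (λ o → ¬K₁x (on o)) , on′ , s≤s l
      where
      on′ : ∀ {z} → On z ([ x ] ⊕⟨ e′ ⟩ p) → K₁ z ⊎ z ≡ x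
      on′ o with On-⊕ o
      ... | inj₁ o₁ = inj₂ (On-[] o₁)
      ... | inj₂ o₂ = inj₁ (on o₂)

    far-core : ∀ {y} → D y → Far x′ y
    far-core dy = across x∉D (conn b∈K) dy

    far-rest : ∀ {x″ y} → D x″ → ¬ D y → K₁ y → Far x″ y
    far-rest dx″ ¬dy ky with p , sp , onp , lp ← across ¬dy (walk-trans (walk-sym (conn ky)) (conn b∈K)) dx″ =
      rv p , mkSimple (mult sp) , (λ o → onp (On-rv o)) , lp

    -- With neighbours `x′` outside and `x″` inside the lobe, `x` can start on the side opposite to
    -- its target: a target in `D` is reached from `x′`, any other from `x″`. Either path uses a
    -- long stretch between `b` and a vertex of `D`, and the step from `x` adds the missing vertex.
    whole : ∀ {x″} → D x″ → x ~ x″ → Lobe K (suc (suc e)) x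
    whole {x″} dx″ x~x″ = record
      { D = K₁ ; D? = K₁? ; b = x ; y₀ = x′ ; Dy₀ = K₁x′ ; D⊆K = K₁⊆K ; x∉D = ¬K₁x ; b∈K = kx ; b∉D = ¬K₁x
      ; closed = cl ; long = far }
      where
      far : ∀ {y} → K₁ y → Σ[ p ∈ Path x y ] Simple p × (∀ {z} → On z p → K₁ z ⊎ z ≡ x) × suc (suc (suc e)) ≤ len p
      far {y} ky with D? y
      ... | yes dy = via x~x′ (far-core dy)
      ... | no ¬dy = via x~x″ (far-rest dx″ ¬dy ky)

    core⊆ : ∀ {z} → Core z → K₁ z
    core⊆ (inj₁ d) = D⊆K d
    core⊆ (inj₂ refl) = b∈K

    -- No vertex of `D` is adjacent to `x`, so all neighbours in `K` of such a vertex lie in the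
    -- core. Deleting `x` has cost these vertices nothing, and the full degree bound is available
    -- for a second search in the core with root `b`.
    inner : ¬ (∃ λ z → D z × x ~ z) → Lobe Core (suc (suc e)) b → Lobe K (suc (suc e)) x
    inner none = transfer P (inner-closed none) (λ c → K₁⊆K (core⊆ c)) (λ h → ¬K₁x (D⊆K h))
      where
      inner-closed : ¬ (∃ λ z → D z × x ~ z) → ∀ {y z} → D y → K z → y ~ z → Core z
      inner-closed none {y} {z} dy kz e with z Fin.≟ x
      ... | yes refl = contradiction (y , dy , ~-sym e) none
      ... | no ne = closed dy (grow (D⊆K dy) kz e ne) e

    core-deg : (K? : ∀ z → Dec (K z)) → ¬ (∃ λ z → D z × x ~ z) → (∀ {y} → K y → y ≢ x → suc (suc e) ≤ degIn K? y) →
               ∀ {y} → Core y → y ≢ b → suc (suc e) ≤ degIn Core? y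
    core-deg K? none degs (inj₂ eq) ne = contradiction eq ne
    core-deg K? none degs {y} (inj₁ dy) _ = ℕₚ.≤-trans (degs (K₁⊆K (D⊆K dy)) (λ eq → ¬K₁x (subst K₁ eq (D⊆K dy))))
      (degIn-mono K? Core? sub)
      where
      sub : ∀ {z} → K z → y ~ z → Core z
      sub {z} kz e with z Fin.≟ x
      ... | yes refl = contradiction (y , dy , ~-sym e) none
      ... | no ne = closed dy (grow (D⊆K dy) kz e ne) e

  first-step : ∀ {K x y} → Walk K x y → y ≢ x → ∃ λ w → x ~ w × K w
  first-step (stop _) ne = contradiction refl ne
  first-step (step _ e w) _ = _ , e , walk-src w

  module Rest {K : Fin n → Set} (K? : ∀ z → Dec (K z)) {x x′ : Fin n} (x~x′ : x ~ x′) (kx′ : K x′) where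

    Kx : Fin n → Set
    Kx z = K z × z ≢ x

    Comp : Fin n → Set
    Comp z = Walk Kx x′ z

    Comp? : ∀ z → Dec (Comp z)
    Comp? = walk? (λ z → K? z ×-dec ¬? (z Fin.≟ x)) x′

    root : Comp x′
    root = stop (kx′ , λ eq → ~⇒≢ x~x′ (≡-sym eq))

    Comp⊆K : ∀ {z} → Comp z → K z
    Comp⊆K w = proj₁ (walk-tgt w)

    x∉Comp : ∀ {z} → Comp z → z ≢ x
    x∉Comp w = proj₂ (walk-tgt w)

    grow : ∀ {y z} → Comp y → K z → y ~ z → z ≢ x → Comp z
    grow k kz e ne = walk-snoc k e (kz , ne)

    deg-drop : ∀ {e y} → Comp y → suc e ≤ degIn K? y → e ≤ degIn Comp? y
    deg-drop {e} {y} ky le = ℕₚ.≤-pred (ℕₚ.≤-trans le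
      (unique-⊆⇒length≤ {ys = x ∷ filter Comp? (nbrs y)} (Uniqueₚ.filter⁺ K? (nbrs-unique y)) sub))
      where
      sub : ∀ {z} → z ∈ filter K? (nbrs y) → z ∈ x ∷ filter Comp? (nbrs y)
      sub {z} h with ∈ₚ.∈-filter⁻ K? h | z Fin.≟ x
      ... | _ | yes eq = here eq
      ... | h′ , kz | no ne = there (∈ₚ.∈-filter⁺ Comp? h′ (grow ky kz (∈-nbrs⁻ h′) ne))

    other : 2 ≤ degIn K? x′ → ∃ λ z → Comp z × z ≢ x′
    other le = pick (filter K? (nbrs x′)) (Uniqueₚ.filter⁺ K? (nbrs-unique x′)) id le
      where
      good : ∀ {z} → z ∈ filter K? (nbrs x′) → z ≢ x → ∃ λ z → Comp z × z ≢ x′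
      good {z} h ne = let h′ , kz = ∈ₚ.∈-filter⁻ K? h in
        z , grow root kz (∈-nbrs⁻ h′) ne , λ eq → ~⇒≢ (∈-nbrs⁻ h′) (≡-sym eq)
      pick : ∀ l → Unique l → (∀ {z} → z ∈ l → z ∈ filter K? (nbrs x′)) → 2 ≤ length l → ∃ λ z → Comp z × z ≢ x′
      pick (a ∷ c ∷ l) ((ne All.∷ _) AllPairs.∷ _) sub _ with a Fin.≟ x
      ... | no a≢x = good (sub (here refl)) a≢x
      ... | yes refl = good (sub (there (here refl))) (λ eq → ne (≡-sym eq))
      pick (_ ∷ []) _ _ (s≤s ())

  -- For `d` equal to 1 all of `K` except `x` serves. Otherwise deleting `x` lowers degrees by at
  -- most one, a lobe with the bound one lower exists in a component of the rest, and `Step` either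
  -- enlarges it or restarts in its core. Both recursive calls concern sets smaller than `K`, which
  -- `m` records.
  lobe : ∀ m {K : Fin n → Set} (K? : ∀ z → Dec (K z)) {x d} → K x → (∀ {y} → K y → Walk K x y) → 1 ≤ d →
         (∀ {y} → K y → y ≢ x → d ≤ degIn K? y) → (∃ λ y → K y × y ≢ x) → order K? ≤ m → Lobe K d x
  lobe m {K} K? {x} {suc zero} kx conn _ _ (y₀ , k₀ , ne₀) _ = record
    { D = λ z → K z × z ≢ x ; D? = λ z → K? z ×-dec ¬? (z Fin.≟ x) ; b = x ; y₀ = y₀ ; Dy₀ = k₀ , ne₀
    ; D⊆K = proj₁ ; x∉D = λ h → proj₂ h refl ; b∈K = kx ; b∉D = λ h → proj₂ h refl
    ; closed = λ _ kz _ → orRoot kz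
    ; long = λ (ky , ne) → let p , s , on = simplify (conn ky) in p , s , (λ o → orRoot (on o)) , len≥2 p (λ eq → ne (≡-sym eq)) }
    where
    orRoot : ∀ {z} → K z → (K z × z ≢ x) ⊎ z ≡ x
    orRoot {z} kz with z Fin.≟ x
    ... | yes eq = inj₂ eq
    ... | no ne = inj₁ (kz , ne)
  lobe zero K? {x} {suc (suc e)} kx _ _ _ _ le =
    contradiction (ℕₚ.≤-trans (∈ₚ.∈-length (∈ₚ.∈-filter⁺ K? (∈ₚ.∈-allFin x) kx)) le) λ ()
  lobe (suc m) {K} K? {x} {suc (suc e)} kx conn _ degs (y₀ , k₀ , ne₀) le with first-step (conn k₀) ne₀
  ... | x′ , x~x′ , kx′ = go (lobe m Comp? root walk-confined (s≤s z≤n) (λ ky _ → deg-drop ky (degs (Comp⊆K ky) (x∉Comp ky)))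
          (other (ℕₚ.≤-trans (s≤s (s≤s z≤n)) (degs kx′ (x∉Comp root)))) le₁)
    where
    open Rest K? x~x′ kx′
    le₁ : order Comp? ≤ m
    le₁ = ℕₚ.≤-pred (ℕₚ.≤-trans (order-< Comp? K? Comp⊆K kx (λ k → x∉Comp k refl)) le)
    go : Lobe Comp (suc e) x′ → Lobe K (suc (suc e)) x
    go P with Finₚ.any? (λ z → Lobe.D? P z ×-dec (x ~? z))
    ... | yes (x″ , dx″ , x~x″) = Step.whole Comp? kx x~x′ root Comp⊆K (λ k → x∉Comp k refl) grow walk-confined P dx″ x~x″
    ... | no none = S.inner none (lobe m P.Core? (inj₂ refl) P.core-walk (s≤s z≤n) (S.core-deg K? none degs)
            (P.y₀ , inj₁ P.Dy₀ , λ eq → P.b∉D (subst P.D eq P.Dy₀)) (ℕₚ.≤-trans (order-mono P.Core? Comp? S.core⊆) le₁))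
      where
      module P = Lobe P
      module S = Step Comp? kx x~x′ root Comp⊆K (λ k → x∉Comp k refl) grow walk-confined P

  -- All neighbours in `K` of vertices of `D` lie in the core, so the degrees survive there, and
  -- `lobe` can be run anew from the root `b` with the higher bound.
  lobe-refine : ∀ {K : Fin n → Set} (K? : ∀ z → Dec (K z)) {d x} (P : Lobe K d x) →
                (∀ {y} → Lobe.D P y → suc d ≤ degIn K? y) → Σ[ Q ∈ Lobe K (suc d) x ] (∀ {z} → Lobe.D Q z → Lobe.D P z)
  lobe-refine K? {d} P degs = Q , λ h → inD h
    where
    open Lobe P
    core⊆ : ∀ {z} → Core z → _
    core⊆ (inj₁ d) = D⊆K d
    core⊆ (inj₂ refl) = b∈K
    degs′ : ∀ {y} → Core y → y ≢ b → suc d ≤ degIn Core? y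
    degs′ (inj₂ eq) ne = contradiction eq ne
    degs′ (inj₁ dy) _ = ℕₚ.≤-trans (degs dy) (degIn-mono K? Core? (λ kz e → closed dy kz e))
    R : Lobe Core (suc d) b
    R = lobe (order Core?) Core? (inj₂ refl) core-walk (s≤s z≤n) degs′ (y₀ , inj₁ Dy₀ , λ eq → b∉D (subst D eq Dy₀)) ℕₚ.≤-refl
    Q = transfer P closed core⊆ x∉D R
    inD : ∀ {z} → Lobe.D R z → D z
    inD h with Lobe.D⊆K R h
    ... | inj₁ d = d
    ... | inj₂ refl = contradiction h (Lobe.x∉D R)

-- A case distinction as a function of the decision, to be rewritten from a proof or a refutation
-- without abstracting over the decision procedure.
choose : ∀ {P X : Set} → Dec P → X → X → X
choose (yes _) a b = a
choose (no _) a b = b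

choose-yes : ∀ {P X : Set} (d : Dec P) {a b : X} → P → choose d a b ≡ a
choose-yes (yes _) _ = refl
choose-yes (no ¬p) p = contradiction p ¬p

choose-no : ∀ {P X : Set} (d : Dec P) {a b : X} → ¬ P → choose d a b ≡ b
choose-no (yes p) ¬p = contradiction p ¬p
choose-no (no _) _ = refl

-- Decomposition of a closed path at a vertex set.

module Segments {n : ℕ} (G : Graph n) (A : Fin n → Set) where

  open Paths G

  -- The part of a cycle strictly between consecutive vertices of `A`. Its body is a `Path`, hence
  -- nonempty; for a longest cycle `pinched-NoAA` justifies this.
  record Seg (p q : Fin n) : Set where
    constructor seg
    field
      {a b} : Fin n
      body : Path a b
      enter : p ~ a
      leave : b ~ q
      p∈A : A p
      q∈A : A q
      free : ∀ {z} → On z body → ¬ A z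

  infixr 5 _∷ˢ_ _++ˢ_
  data Segs : Fin n → Fin n → Set where
    []ˢ : ∀ {p} → Segs p p
    _∷ˢ_ : ∀ {p q r} → Seg p q → Segs q r → Segs p r

  -- Each segment counts together with the vertex before it and the final end is left out, so that
  -- on a closed sequence every vertex counts once.
  wtˢ : ∀ {p q} → (Fin n → ℕ) → Segs p q → ℕ
  wtˢ f []ˢ = 0
  wtˢ f (_∷ˢ_ {p} g ss) = f p + wt f (Seg.body g) + wtˢ f ss

  count : ∀ {p q} → Segs p q → ℕ
  count []ˢ = 0
  count (_ ∷ˢ ss) = suc (count ss)

  heads : ∀ {p q} → Segs p q → List (Fin n)
  heads []ˢ = []
  heads (_∷ˢ_ {p} _ ss) = p ∷ heads ss

  length-heads : ∀ {p q} (ss : Segs p q) → length (heads ss) ≡ count ss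
  length-heads []ˢ = refl
  length-heads (_ ∷ˢ ss) = cong suc (length-heads ss)

  heads⊆A : ∀ {p q z} (ss : Segs p q) → z ∈ heads ss → A z
  heads⊆A (g ∷ˢ _) (here refl) = Seg.p∈A g
  heads⊆A (_ ∷ˢ ss) (there h) = heads⊆A ss h

  _++ˢ_ : ∀ {p q r} → Segs p q → Segs q r → Segs p r
  []ˢ ++ˢ ts = ts
  (g ∷ˢ ss) ++ˢ ts = g ∷ˢ (ss ++ˢ ts)

  wtˢ-++ : ∀ f {p q r} (ss : Segs p q) (ts : Segs q r) → wtˢ f (ss ++ˢ ts) ≡ wtˢ f ss + wtˢ f ts
  wtˢ-++ f []ˢ ts = refl
  wtˢ-++ f (_∷ˢ_ {p} g ss) ts = trans (cong (f p + wt f (Seg.body g) +_) (wtˢ-++ f ss ts)) (≡-sym (ℕₚ.+-assoc (f p + _) _ _))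

  count-++ : ∀ {p q r} (ss : Segs p q) (ts : Segs q r) → count (ss ++ˢ ts) ≡ count ss + count ts
  count-++ []ˢ ts = refl
  count-++ (g ∷ˢ ss) ts = cong suc (count-++ ss ts)

  ++ˢ-assoc : ∀ {p q r s} (ss : Segs p q) (ts : Segs q r) (us : Segs r s) → (ss ++ˢ ts) ++ˢ us ≡ ss ++ˢ (ts ++ˢ us)
  ++ˢ-assoc []ˢ ts us = refl
  ++ˢ-assoc (g ∷ˢ ss) ts us = cong (g ∷ˢ_) (++ˢ-assoc ss ts us)

  []ˢ-++ : ∀ {p q} (ss : Segs p q) → ss ++ˢ []ˢ ≡ ss
  []ˢ-++ []ˢ = refl
  []ˢ-++ (g ∷ˢ ss) = cong (g ∷ˢ_) ([]ˢ-++ ss)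

  arc : ∀ {p q} → Segs p q → Path p q
  arc ([]ˢ {p}) = [ p ]
  arc (_∷ˢ_ {p} g ss) = [ p ] ⊕⟨ Seg.enter g ⟩ Seg.body g ⊕⟨ Seg.leave g ⟩ arc ss

  wt-arc : ∀ f {p q} (ss : Segs p q) → wt f (arc ss) ≡ wtˢ f ss + f q
  wt-arc f []ˢ = refl
  wt-arc f {q = q} (_∷ˢ_ {p} g ss) = trans (cong (λ k → f p + (wt f (Seg.body g) + k)) (wt-arc f ss)) (lemma (f p) (wt f (Seg.body g)) (wtˢ f ss) (f q))
    where
    lemma : ∀ x y z w → x + (y + (z + w)) ≡ x + y + z + w
    lemma x y z w = solve (x ∷ y ∷ z ∷ w ∷ [])

  record AtSeg {p q} (z : Fin n) (ss : Segs p q) : Set where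
    constructor atSeg
    field
      {l r} : Fin n
      pre : Segs p l
      g : Seg l r
      post : Segs r q
      split≡ : ss ≡ pre ++ˢ (g ∷ˢ post)
      on : On z (Seg.body g)

  locate : ∀ {p q z} (ss : Segs p q) → 1 ≤ wtˢ (ind z) ss → z ∈ heads ss ⊎ AtSeg z ss
  locate {z = z} (_∷ˢ_ {p} g ss) h with sum≥1 (ind z p + _) h
  ... | inj₁ h₁ with sum≥1 (ind z p) h₁
  ... | inj₁ h₂ = inj₁ (here (ind-≡ h₂))
  ... | inj₂ h₂ = inj₂ (atSeg []ˢ g ss refl (mkOn h₂))
  locate {z = z} (g ∷ˢ ss) h | inj₂ h₁ with locate ss h₁
  ... | inj₁ m = inj₁ (there m)
  ... | inj₂ (atSeg pre g′ post eq on) = inj₂ (atSeg (g ∷ˢ pre) g′ post (cong (g ∷ˢ_) eq) on)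

  record AtHead {p q} (z : Fin n) (ss : Segs p q) : Set where
    constructor atHead
    field
      pre : Segs p z
      {r} : Fin n
      g : Seg z r
      post : Segs r q
      split≡ : ss ≡ pre ++ˢ (g ∷ˢ post)

  locateHead : ∀ {p q z} (ss : Segs p q) → z ∈ heads ss → AtHead z ss
  locateHead (g ∷ˢ ss) (here refl) = atHead []ˢ g ss refl
  locateHead (g ∷ˢ ss) (there h) with atHead pre g′ post eq ← locateHead ss h = atHead (g ∷ˢ pre) g′ post (cong (g ∷ˢ_) eq)

  firsts : ∀ {p q} → Segs p q → List (Fin n)
  firsts []ˢ = []
  firsts (g ∷ˢ ss) = Seg.a g ∷ firsts ss

  length-firsts : ∀ {p q} (ss : Segs p q) → length (firsts ss) ≡ count ss
  length-firsts []ˢ = refl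
  length-firsts (_ ∷ˢ ss) = cong suc (length-firsts ss)

  -- First vertex and order of the segment that contains z.
  info : ∀ {p q} → Segs p q → Fin n → Fin n × ℕ
  info []ˢ z = z , 0
  info (g ∷ˢ ss) z = choose (On? z (Seg.body g)) (Seg.a g , len (Seg.body g)) (info ss z)

  bodies : ∀ {p q} → (Fin n → ℕ) → Segs p q → ℕ
  bodies f []ˢ = 0
  bodies f (g ∷ˢ ss) = wt f (Seg.body g) + bodies f ss

  bodies≤ : ∀ f {p q} (ss : Segs p q) → bodies f ss ≤ wtˢ f ss
  bodies≤ f []ˢ = z≤n
  bodies≤ f (_∷ˢ_ {p} g ss) = ℕₚ.m≤n+m (wt f (Seg.body g)) (f p) ⊞ bodies≤ f ss

  info-here : ∀ {p q r z} (g : Seg p q) (ss : Segs q r) → On z (Seg.body g) → info (g ∷ˢ ss) z ≡ (Seg.a g , len (Seg.body g))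
  info-here {z = z} g ss o = choose-yes (On? z (Seg.body g)) o

  info-none : ∀ {p q z} (ss : Segs p q) → ¬ 1 ≤ bodies (ind z) ss → info ss z ≡ (z , 0)
  info-none []ˢ _ = refl
  info-none {z = z} (g ∷ˢ ss) none = trans (choose-no (On? z (Seg.body g)) (λ o → none (ℕₚ.≤-trans (occ o) (ℕₚ.m≤m+n _ _))))
    (info-none ss (λ h → none (ℕₚ.≤-trans h (ℕₚ.m≤n+m _ _))))

  info-left : ∀ {p q r z} (ss : Segs p q) (ts : Segs q r) → 1 ≤ bodies (ind z) ss → info (ss ++ˢ ts) z ≡ info ss z
  info-left {z = z} (g ∷ˢ ss) ts h = go (On? z (Seg.body g))
    where
    go : (o? : Dec (On z (Seg.body g))) → choose o? (Seg.a g , len (Seg.body g)) (info (ss ++ˢ ts) z) ≡ choose o? (Seg.a g , len (Seg.body g)) (info ss z)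
    go (yes _) = refl
    go (no ¬o) = info-left ss ts (subst (λ k → 1 ≤ k + bodies (ind z) ss) (¬On⇒0 ¬o) h)

  info-right : ∀ {p q r z} (ss : Segs p q) (ts : Segs q r) → ¬ 1 ≤ bodies (ind z) ss → info (ss ++ˢ ts) z ≡ info ts z
  info-right []ˢ ts _ = refl
  info-right {z = z} (g ∷ˢ ss) ts none = trans (choose-no (On? z (Seg.body g)) (λ o → none (ℕₚ.≤-trans (occ o) (ℕₚ.m≤m+n _ _))))
    (info-right ss ts (λ h → none (ℕₚ.≤-trans h (ℕₚ.m≤n+m _ _))))

  -- `info` searches from the left, so its answer could depend on the starting point; a vertex that
  -- occurs at most once is found in the same segment from anywhere.
  info-rotate : ∀ {p q z} (ss : Segs p q) (ts : Segs q p) → wtˢ (ind z) ss + wtˢ (ind z) ts ≤ 1 → info (ts ++ˢ ss) z ≡ info (ss ++ˢ ts) z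
  info-rotate {z = z} ss ts le with 1 ≤? bodies (ind z) ss | 1 ≤? bodies (ind z) ts
  ... | yes h | yes h′ = contradiction (ℕₚ.≤-trans (ℕₚ.≤-trans h (bodies≤ (ind z) ss) ⊞ ℕₚ.≤-trans h′ (bodies≤ (ind z) ts)) le) λ { (s≤s ()) }
  ... | yes h | no h′ = trans (info-right ts ss h′) (≡-sym (info-left ss ts h))
  ... | no h | yes h′ = trans (info-left ts ss h′) (≡-sym (info-right ss ts h))
  ... | no h | no h′ = trans (info-right ts ss h′) (trans (info-none ss h) (trans (≡-sym (info-none ts h′)) (≡-sym (info-right ss ts h))))

  NoAA : ∀ {u v} → LPath u v → Set
  NoAA [ v ]ˡ = ⊤
  NoAA (_∷⟨_⟩_ u {w} e p) = ¬ (A u × A w) × NoAA p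

  module _ (A? : ∀ z → Dec (A z)) where

    chop : ∀ {u v} (p : LPath u v) → A u → A v → NoAA p → Σ[ ss ∈ Segs u v ] (∀ f → wtˢ f ss + f v ≡ wt f (fromL p))
    -- `acc` is the segment body read so far. Its last vertex `w` is also the first vertex of the
    -- remaining path, which explains the extra `f w`.
    chopFrom : ∀ {u a w v} → A u → u ~ a → (acc : Path a w) → (∀ {z} → On z acc → ¬ A z) → (p : LPath w v) → A v → NoAA p →
               Σ[ ss ∈ Segs u v ] (∀ f → wtˢ f ss + f v + f w ≡ f u + wt f acc + wt f (fromL p))
    chop [ v ]ˡ _ _ _ = []ˢ , λ f → refl
    chop (_∷⟨_⟩_ u {w} e p) au av (naa , noaa)
      with ss , eq ← chopFrom au e [ w ] (λ o aw → naa (au , subst A (On-[] o) aw)) p av noaa =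
      ss , λ f → ℕₚ.+-cancelʳ-≡ (f w) _ _ (trans (eq f) (lemma (f u) (f w) (wt f (fromL p))))
      where
      lemma : ∀ x y z → x + y + z ≡ x + z + y
      lemma x y z = solve (x ∷ y ∷ z ∷ [])
    chopFrom au e acc free [ v ]ˡ av _ = contradiction av (free (On-tgt acc))
    chopFrom {u} {w = w} {v = v} au e acc free (_∷⟨_⟩_ w {w′} d p) av (_ , noaa) with A? w′
    ... | yes aw′ with ss , eq ← chop p aw′ av noaa =
      seg acc e d au aw′ free ∷ˢ ss , λ f → trans (lemma (f u) (wt f acc) (wtˢ f ss) (f v) (f w))
        (trans (cong (λ k → f u + wt f acc + (f w + k)) (eq f)) refl)
      where
      lemma : ∀ x y z t s → x + y + z + t + s ≡ x + y + (s + (z + t))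
      lemma x y z t s = solve (x ∷ y ∷ z ∷ t ∷ s ∷ [])
    ... | no ¬aw′ with ss , eq ← chopFrom au e (acc ⊕⟨ d ⟩ [ w′ ])
                          (λ o → [ free , (λ o₂ → subst (λ z → ¬ A z) (≡-sym (On-[] o₂)) ¬aw′) ]′ (On-⊕ o)) p av noaa =
      ss , λ f → ℕₚ.+-cancelʳ-≡ (f w′) _ _ (trans (l₁ (wtˢ f ss + f v) (f w) (f w′))
        (trans (cong (_+ f w) (eq f)) (l₂ (f u) (wt f acc) (f w′) (wt f (fromL p)) (f w))))
      where
      l₁ : ∀ x y z → x + y + z ≡ x + z + y
      l₁ x y z = solve (x ∷ y ∷ z ∷ [])
      l₂ : ∀ x y z t s → x + (y + z) + t + s ≡ x + y + (s + t) + z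
      l₂ x y z t s = solve (x ∷ y ∷ z ∷ t ∷ s ∷ [])

-- Exchanges on a longest cycle.

record Setting : Set where
  field
    {n} : ℕ
    G : Graph n
    tgh : ToughnessGreaterThanOne G
    c δ : ℕ
    3≤c : 3 ≤ c
    longest : ∀ k → Cycle G k → k ≤ c
    δ≤deg : ∀ v → δ ≤ deg G v
    c≤ : c ≤ 2 * δ + 3

record OffVertex (S : Setting) : Set where
  open Setting S
  open Paths G
  field
    C : Closed c
    x : Fin n
    x∉C : ¬ On x (Closed.path C)

module LongestCycle (S : Setting) where

  open Setting S
  open Paths G
  open Walks G
  open Lobes G

  simple⇒len≤c : ∀ {u v} (p : Path u v) → v ~ u → Simple p → len p ≤ c
  simple⇒len≤c p e s with 3 ≤? len p
  ... | yes h = longest _ (closed⇒Cycle p e s h)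
  ... | no h = ℕₚ.≤-trans (ℕₚ.<⇒≤ (ℕₚ.≰⇒> h)) 3≤c

  -- `T` weighs the vertices at hand without repetition, usually the cycle and a detour, and `lost`
  -- those that the new closed path omits. At indicators the identity makes the path simple, at
  -- `one` it compares its length with `c`.
  exchange : (T : (Fin n → ℕ) → ℕ) → (∀ z → T (ind z) ≤ 1) → ∀ {u v} (p : Path u v) → v ~ u →
             (lost : (Fin n → ℕ) → ℕ) → (∀ f → wt f p + lost f ≡ T f) → T one ≤ c + lost one
  exchange T T≤1 p e lost eq = ℕₚ.≤-trans (ℕₚ.≤-reflexive (≡-sym (eq one))) (ℕₚ.+-monoˡ-≤ (lost one)
    (simple⇒len≤c p e (mkSimple λ z → ℕₚ.≤-trans (ℕₚ.m≤m+n _ _) (ℕₚ.≤-trans (ℕₚ.≤-reflexive (eq (ind z))) (T≤1 z)))))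

  -- When a segment is split at a vertex, that vertex belongs to both halves, and dropping one half
  -- does not lose it. `gain` stands for such doubly counted vertices.
  exchange-gain : (T : (Fin n → ℕ) → ℕ) → (∀ z → T (ind z) ≤ 1) → ∀ {u v} (p : Path u v) → v ~ u →
                  (lost gain : (Fin n → ℕ) → ℕ) → (∀ f → gain f ≤ lost f) → (∀ f → wt f p + lost f ≡ T f + gain f) →
                  T one + gain one ≤ c + lost one
  exchange-gain T T≤1 p e lost gain g≤l eq = ℕₚ.≤-trans (ℕₚ.≤-reflexive (≡-sym (eq one))) (ℕₚ.+-monoˡ-≤ (lost one)
    (simple⇒len≤c p e (mkSimple λ z → ℕₚ.≤-trans (ℕₚ.+-cancelʳ-≤ (lost (ind z)) _ _
      (ℕₚ.≤-trans (ℕₚ.≤-reflexive (eq (ind z))) (ℕₚ.+-monoʳ-≤ _ (g≤l (ind z))))) (T≤1 z))))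

  -- The component off the cycle, its attachments and the bridges.

  module Outside (X : OffVertex S) where

    open OffVertex X
    open Closed C public

    OnC : Fin n → Set
    OnC z = On z path

    OnC? : ∀ z → Dec (OnC z)
    OnC? z = On? z path

    H : Fin n → Set
    H = Walk (λ z → ¬ OnC z) x

    H? : ∀ z → Dec (H z)
    H? = walk? (λ z → ¬? (OnC? z)) x

    H∉C : ∀ {z} → H z → ¬ OnC z
    H∉C = walk-tgt

    A : Fin n → Set
    A z = OnC z × ∃ λ y → z ~ y × H y

    A? : ∀ z → Dec (A z)
    A? z = OnC? z ×-dec Finₚ.any? (λ y → (z ~? y) ×-dec H? y)

    open Segments G A public

    record Link (p q : Fin n) (h : ℕ) : Set where
      constructor link
      field
        {y y′} : Fin n
        via : Path y y′
        simp : Simple via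
        inH : ∀ {z} → On z via → H z
        py : p ~ y
        yq : y′ ~ q
        long : h ≤ len via

    Link-sym : ∀ {p q h} → Link p q h → Link q p h
    Link-sym (link via simp inH py yq long) = link (rv via) (mkSimple (mult simp)) (λ o → inH (On-rv o)) (~-sym yq) (~-sym py) long

    A⇒Link : ∀ {p q} → A p → A q → Link p q 1
    A⇒Link (_ , y , py , hy) (_ , y′ , qy , hy′)
      with w , s , on ← simplify (walk-trans (walk-sym (walk-confined hy)) (walk-confined hy′)) =
      link w s on py (~-sym qy) (len≥1 w)

    -- Paths with interior off the cycle and off H; these are the links between different segments that toughness produces.
    data Bridge : Fin n → Fin n → Set where
      edge : ∀ {u v} → u ~ v → Bridge u v
      off : ∀ {u s t v} → u ~ s → (p : Path s t) → t ~ v → Simple p → (∀ {z} → On z p → ¬ OnC z × ¬ H z) → Bridge u v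

    wtᵇ : ∀ {u v} → (Fin n → ℕ) → Bridge u v → ℕ
    wtᵇ f (edge _) = 0
    wtᵇ f (off _ p _ _ _) = wt f p

    Bridge-sym : ∀ {u v} → Bridge u v → Bridge v u
    Bridge-sym (edge e) = edge (~-sym e)
    Bridge-sym (off e p d s o) = off (~-sym d) (rv p) (~-sym e) (mkSimple (mult s)) (λ h → o (On-rv h))

    join : ∀ {a u v b} → Path a u → Bridge u v → Path v b → Path a b
    join p (edge e) q = p ⊕⟨ e ⟩ q
    join p (off e r d _ _) q = p ⊕⟨ e ⟩ r ⊕⟨ d ⟩ q

    wt-join : ∀ f {a u v b} (p : Path a u) (B : Bridge u v) (q : Path v b) → wt f (join p B q) ≡ wt f p + (wtᵇ f B + wt f q)
    wt-join f p (edge e) q = refl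
    wt-join f p (off e r d _ _) q = refl

    total : (Fin n → ℕ) → ℕ
    total f = wt f path

    total≤1 : ∀ z → total (ind z) ≤ 1
    total≤1 = mult simple

    total-link≤1 : ∀ {p q h} (L : Link p q h) z → total (ind z) + wt (ind z) (Link.via L) ≤ 1
    total-link≤1 L z with OnC? z
    ... | yes o = subst (λ k → total (ind z) + k ≤ 1) (≡-sym (¬On⇒0 (λ o′ → H∉C (Link.inH L o′) o)))
          (ℕₚ.≤-trans (ℕₚ.≤-reflexive (ℕₚ.+-identityʳ _)) (total≤1 z))
    ... | no ¬o = subst (λ k → k + wt (ind z) (Link.via L) ≤ 1) (≡-sym (¬On⇒0 ¬o)) (mult (Link.simp L) z)

    total-link-bridge≤1 : ∀ {p q h u v} (L : Link p q h) (B : Bridge u v) z →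
                          total (ind z) + wt (ind z) (Link.via L) + wtᵇ (ind z) B ≤ 1
    total-link-bridge≤1 L (edge _) z = ℕₚ.≤-trans (ℕₚ.≤-reflexive (ℕₚ.+-identityʳ _)) (total-link≤1 L z)
    total-link-bridge≤1 L (off _ p _ s o) z with On? z p
    ... | no ¬on = subst (λ k → total (ind z) + wt (ind z) (Link.via L) + k ≤ 1) (≡-sym (¬On⇒0 ¬on))
          (ℕₚ.≤-trans (ℕₚ.≤-reflexive (ℕₚ.+-identityʳ _)) (total-link≤1 L z))
    ... | yes on = subst₂ (λ j k → j + k + wt (ind z) p ≤ 1) (≡-sym (¬On⇒0 (proj₁ (o on))))
          (≡-sym (¬On⇒0 (λ o′ → proj₂ (o on) (Link.inH L o′)))) (mult s z)

    module _ (l : List (Fin n)) (A⊆l : ∀ {z} → A z → z ∈ l) where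

      record Cross (lab : Fin n → Fin n) : Set where
        constructor cross
        field
          {u v} : Fin n
          uC : OnC u
          vC : OnC v
          u∉l : u ∉ l
          v∉l : v ∉ l
          apart : lab u ≢ lab v
          bridge : Bridge u v

      -- The walk is followed from its last vertex on the cycle; u is that vertex.
      walk⇒cross : ∀ lab {u v} → OnC u → OnC v → lab u ≢ lab v → Walk (_∉ l) u v → Cross lab
      walk⇒cross-off : ∀ lab {u s t v} → OnC u → u ∉ l → u ~ s → Walk (λ z → ¬ OnC z) s t → OnC v → lab u ≢ lab v →
                       Walk (_∉ l) t v → Cross lab
      walk⇒cross lab uC vC ne (stop _) = contradiction refl ne
      walk⇒cross lab {u} uC vC ne (step {w = w} u∉ e r) with OnC? w
      ... | no ¬wC = walk⇒cross-off lab uC u∉ e (stop ¬wC) vC ne r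
      ... | yes wC with lab u Fin.≟ lab w
      ... | yes eq = walk⇒cross lab wC vC (λ eq′ → ne (trans eq eq′)) r
      ... | no ne′ = cross uC wC u∉ (walk-src r) ne′ (edge e)
      walk⇒cross-off lab uC u∉ us st vC ne (stop _) = contradiction vC (walk-tgt st)
      walk⇒cross-off lab {u} uC u∉ us st vC ne (step {w = w} t∉ e r) with OnC? w
      ... | no ¬wC = walk⇒cross-off lab uC u∉ us (walk-snoc st e ¬wC) vC ne r
      ... | yes wC with lab u Fin.≟ lab w
      ... | yes eq = walk⇒cross lab wC vC (λ eq′ → ne (trans eq eq′)) r
      ... | no ne′ with p , s , on ← simplify (walk-confined st) =
        cross uC wC u∉ (walk-src r) ne′ (off us p e s λ o → walk-tgt (on o) ,
          λ hz → u∉ (A⊆l (uC , _ , us , walk-trans hz (walk-sym (on o)))))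

      -- A vertex of the cycle next to `H` belongs to `A` and therefore to the cut.
      H-isolated : ∀ {h v} → H h → OnC v → ¬ Walk (_∉ l) h v
      H-isolated hh vC (stop _) = H∉C hh vC
      H-isolated hh vC (step {w = w} _ e r) with OnC? w
      ... | yes wC = walk-src r (A⊆l (wC , _ , ~-sym e , hh))
      ... | no ¬wC = H-isolated (walk-snoc hh e ¬wC) vC r

      separated-or-joined : ∀ rs → Unique rs → Separated l rs ⊎ ∃₂ λ u v → u ∈ rs × v ∈ rs × u ≢ v × Walk (_∉ l) u v
      separated-or-joined [] _ = inj₁ AllPairs.[]
      separated-or-joined (r ∷ rs) (r∉ AllPairs.∷ u) with Any.any? (walk? (_∉? l) r) rs
      ... | yes a = let v , v∈ , w = find a in inj₂ (r , v , here refl , there v∈ , All.lookup r∉ v∈ , w)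
      ... | no ¬a with separated-or-joined rs u
      ... | inj₁ s = inj₁ (Allₚ.¬Any⇒All¬ rs ¬a AllPairs.∷ s)
      ... | inj₂ (u , v , u∈ , v∈ , ne , w) = inj₂ (u , v , there u∈ , there v∈ , ne , w)

      -- Were the representatives pairwise separated, they and `x` would be `suc (length rs)`
      -- separated vertices, no fewer than the cut has, against the toughness. So two of them are
      -- joined outside the cut, and as their labels differ, the label changes along some bridge.
      crossing : (∀ {z} → z ∈ l → OnC z) → (lab : Fin n → Fin n) → ∀ rs → Unique rs →
                 (∀ {r} → r ∈ rs → OnC r × r ∉ l × lab r ≡ r) → 1 ≤ length rs → length l ≤ suc (length rs) → Cross lab
      crossing l⊆C lab rs uniq reps one≤ le with separated-or-joined rs uniq
      ... | inj₂ (u , v , u∈ , v∈ , ne , w) = walk⇒cross lab (proj₁ (reps u∈)) (proj₁ (reps v∈))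
              (λ eq → ne (trans (≡-sym (proj₂ (proj₂ (reps u∈)))) (trans eq (proj₂ (proj₂ (reps v∈)))))) w
      ... | inj₁ s = contradiction (ℕₚ.≤-trans (tough⇒cut-large tgh l (x ∷ rs)
              ((λ h → x∉C (l⊆C h)) All.∷ All.tabulate (λ h → proj₁ (proj₂ (reps h))))
              (All.tabulate (λ h → H-isolated (stop x∉C) (proj₁ (reps h))) AllPairs.∷ s) (s≤s one≤)) le) (ℕₚ.<-irrefl refl)

    -- Without attachments the empty set would separate `x` from the cycle.
    A-nonempty : ∃ λ p → A p
    A-nonempty with Finₚ.any? A?
    ... | yes h = h
    ... | no none = contradiction (tough⇒cut-large tgh [] (x ∷ s ∷ []) ((λ ()) All.∷ (λ ()) All.∷ All.[])
            ((H-isolated [] (λ {z} h → contradiction (z , h) none) (stop x∉C) (On-src path) All.∷ All.[])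
             AllPairs.∷ All.[] AllPairs.∷ AllPairs.[]) (s≤s (s≤s z≤n))) λ ()

    pinched : ∀ {p} → OnC p → Σ[ q ∈ LPath p p ] (∀ f → wt f (fromL q) ≡ total f + f p)
    pinched {p} o with a , b , eq ← split path o = toL (b ⊕⟨ close ⟩ a) , λ f →
      trans (wt-toL f (b ⊕⟨ close ⟩ a)) (trans (ℕₚ.+-comm (wt f b) _) (eq f))

    -- Two consecutive vertices of `A` could be joined through `H` instead of directly, and the
    -- cycle would grow. The part already passed is carried along in `pre`, so that the whole cycle
    -- is at hand for this exchange.
    pinched-NoAA : ∀ {p u} (pre : Path p u) (suf : LPath u p) → (∀ f → wt f pre + wt f (fromL suf) ≡ total f + f p + f u) → NoAA suf
    pinched-NoAA pre [ v ]ˡ eq = tt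
    pinched-NoAA {p} pre (_∷⟨_⟩_ u {w} e suf) eq = noAA , pinched-NoAA (pre ⊕⟨ e ⟩ [ w ]) suf eq′
      where
      eq₁ : ∀ f → wt f pre + wt f (fromL suf) ≡ total f + f p
      eq₁ f = ℕₚ.+-cancelʳ-≡ (f u) _ _ (trans (lemma (wt f pre) (wt f (fromL suf)) (f u)) (eq f))
        where
        lemma : ∀ x y z → x + y + z ≡ x + (z + y)
        lemma x y z = solve (x ∷ y ∷ z ∷ [])
      eq′ : ∀ f → wt f pre + f w + wt f (fromL suf) ≡ total f + f p + f w
      eq′ f = trans (lemma (wt f pre) (f w) (wt f (fromL suf))) (cong (_+ f w) (eq₁ f))
        where
        lemma : ∀ x y z → x + y + z ≡ x + z + y
        lemma x y z = solve (x ∷ y ∷ z ∷ [])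
      noAA : ¬ (A u × A w)
      noAA (au , aw) with r , eqr ← glueL suf pre | L@(link via simp inH py yq long) ← A⇒Link au aw =
        farkas-⊥ 0 (exchange (λ f → total f + wt f via) (total-link≤1 L) (r ⊕⟨ py ⟩ via) yq (λ _ → 0) eq₂ ⊞ long)
          (trans (cong (λ k → k + wt one via + 1) len≡) (lemma₂ c (wt one via)))
        where
        lemma₂ : ∀ c v → c + v + 1 ≡ c + 0 + v + 1
        lemma₂ c v = solve (c ∷ v ∷ [])
        eq₂ : ∀ f → wt f r + wt f via + 0 ≡ total f + wt f via
        eq₂ f = trans (ℕₚ.+-identityʳ _) (cong (_+ wt f via) (ℕₚ.+-cancelʳ-≡ (f p) _ _
          (trans (eqr f) (trans (ℕₚ.+-comm (wt f (fromL suf)) _) (eq₁ f)))))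

    record Around (p : Fin n) : Set where
      constructor around
      field
        segs : Segs p p
        whole : ∀ f → wtˢ f segs ≡ total f

    chopped : ∀ {p} → A p → Around p
    chopped {p} ap@(pC , _) with q , eq ← pinched pC
      with ss , eqs ← chop A? q ap ap (pinched-NoAA [ p ] q (λ f → trans (cong (f p +_) (eq f)) (ℕₚ.+-comm (f p) _))) =
      around ss (λ f → ℕₚ.+-cancelʳ-≡ (f p) _ _ (trans (eqs f) (eq f)))

    abstract
      base : Around (proj₁ A-nonempty)
      base = chopped (proj₂ A-nonempty)

      a : ℕ
      a = count (Around.segs base)

      info₀ : Fin n → Fin n × ℕ
      info₀ = info (Around.segs base)

    -- Stands for being a rotation of the base decomposition; only the invariants in use are kept.
    -- An argument may thus start the cycle at whichever segment it studies, while `a` and `info₀`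
    -- stay fixed.
    record Whole {p : Fin n} (ss : Segs p p) : Set where
      constructor mkWhole
      field
        covers : ∀ f → wtˢ f ss ≡ total f
        count≡ : count ss ≡ a
        info≡ : ∀ z → info ss z ≡ info₀ z
    open Whole public

    abstract
      base-whole : Whole (Around.segs base)
      base-whole = mkWhole (Around.whole base) refl (λ _ → refl)

    rotate : ∀ {p q} (ss : Segs p q) (ts : Segs q p) → Whole (ss ++ˢ ts) → Whole (ts ++ˢ ss)
    rotate ss ts w = mkWhole
      (λ f → trans (wtˢ-++ f ts ss) (trans (ℕₚ.+-comm (wtˢ f ts) _) (trans (≡-sym (wtˢ-++ f ss ts)) (covers w f))))
      (trans (count-++ ts ss) (trans (ℕₚ.+-comm (count ts) _) (trans (≡-sym (count-++ ss ts)) (count≡ w))))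
      (λ z → trans (info-rotate ss ts (ℕₚ.≤-trans (ℕₚ.≤-reflexive (trans (≡-sym (wtˢ-++ (ind z) ss ts)) (covers w (ind z)))) (total≤1 z))) (info≡ w z))

    occurs : ∀ {p z} {ss : Segs p p} → Whole ss → OnC z → 1 ≤ wtˢ (ind z) ss
    occurs {z = z} w o = ℕₚ.≤-trans (occ o) (ℕₚ.≤-reflexive (≡-sym (covers w (ind z))))

    once : ∀ {p} {ss : Segs p p} → Whole ss → ∀ z → wtˢ (ind z) ss ≤ 1
    once w z = ℕₚ.≤-trans (ℕₚ.≤-reflexive (covers w (ind z))) (total≤1 z)

    A⇒head : ∀ {p z} {ss : Segs p p} → Whole ss → A z → z ∈ heads ss
    A⇒head {ss = ss} w az with locate ss (occurs w (proj₁ az))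
    ... | inj₁ h = h
    ... | inj₂ s = contradiction az (Seg.free (AtSeg.g s) (AtSeg.on s))

    free⇒seg : ∀ {p z} {ss : Segs p p} → Whole ss → OnC z → ¬ A z → AtSeg z ss
    free⇒seg {ss = ss} w o ¬az with locate ss (occurs w o)
    ... | inj₁ h = contradiction (heads⊆A ss h) ¬az
    ... | inj₂ s = s

    record RootSeg (z : Fin n) : Set where
      constructor rootSeg
      field
        {p q} : Fin n
        g : Seg p q
        rest : Segs q p
        on : On z (Seg.body g)
        whole : Whole (g ∷ˢ rest)

    root-at : ∀ {z} → OnC z → ¬ A z → RootSeg z
    root-at o ¬az with atSeg pre g post eq on ← free⇒seg base-whole o ¬az =
      rootSeg g (post ++ˢ pre) on (rotate pre (g ∷ˢ post) (subst Whole eq base-whole))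

    record RootHead (z : Fin n) : Set where
      constructor rootHead
      field
        {q} : Fin n
        g : Seg z q
        rest : Segs q z
        whole : Whole (g ∷ˢ rest)

    root-head : ∀ {z} → A z → RootHead z
    root-head az with atHead pre g post eq ← locateHead (Around.segs base) (A⇒head base-whole az) =
      rootHead g (post ++ˢ pre) (rotate pre (g ∷ˢ post) (subst Whole eq base-whole))

    body⊆C : ∀ {p q} (g : Seg p q) (rest : Segs q p) → Whole (g ∷ˢ rest) → ∀ {z} → On z (Seg.body g) → OnC z
    body⊆C {p} g rest w {z} o = mkOn (ℕₚ.≤-trans (occ o) (ℕₚ.≤-trans
        (ℕₚ.≤-trans (ℕₚ.m≤n+m (wt (ind z) (Seg.body g)) (ind z p)) (ℕₚ.m≤m+n (ind z p + wt (ind z) (Seg.body g)) (wtˢ (ind z) rest)))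
        (ℕₚ.≤-reflexive (covers w (ind z)))))

    -- The vertices of `A` separate `x` from a segment, and two components demand three deleted
    -- vertices.
    a≥3 : 3 ≤ a
    a≥3 = subst (3 ≤_) (trans (length-heads segs) (count≡ w))
        (tough⇒cut-large tgh (heads segs) (x ∷ Seg.a g ∷ [])
          ((λ h → x∉C (proj₁ (heads⊆A segs h))) All.∷ (λ h → Seg.free g (On-src (Seg.body g)) (heads⊆A segs h)) All.∷ All.[])
          ((H-isolated (heads segs) (A⇒head w) (stop x∉C) aC All.∷ All.[]) AllPairs.∷ All.[] AllPairs.∷ AllPairs.[])
          (s≤s (s≤s z≤n)))
      where
      r = root-head (proj₂ A-nonempty)
      g = RootHead.g r
      segs = g ∷ˢ RootHead.rest r
      w = RootHead.whole r
      aC : OnC (Seg.a g)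
      aC = body⊆C g (RootHead.rest r) w (On-src (Seg.body g))

    ends-≢ : ∀ {p q} (g : Seg p q) (rest : Segs q p) → Whole (g ∷ˢ rest) → p ≢ q
    ends-≢ g []ˢ w _ = contradiction (ℕₚ.≤-trans a≥3 (ℕₚ.≤-reflexive (≡-sym (count≡ w)))) λ { (s≤s ()) }
    ends-≢ {p} g (h ∷ˢ rest) w refl = contradiction (subst (λ i → i + b + (i + b′ + r) ≤ 1) (ind-refl p) (once w p))
        λ { (s≤s le) → contradiction (ℕₚ.≤-trans (ℕₚ.m≤n+m _ b) le) λ () }
      where
      b = wt (ind p) (Seg.body g)
      b′ = wt (ind p) (Seg.body h)
      r = wtˢ (ind p) rest

    link-body : ∀ {p q h} (g : Seg p q) (rest : Segs q p) → Whole (g ∷ˢ rest) → Link p q h → h ≤ len (Seg.body g)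
    link-body {p} {h = h} g rest w L = farkas 0 (ex ⊞ Link.long L)
        (trans (cong (λ k → i + (k + v + h)) len≡) (lemma i c v h))
      where
      via = Link.via L
      i = len (Seg.body g)
      v = len via
      lemma : ∀ i c v h → i + (c + v + h) ≡ h + (c + i + v) + 0
      lemma i c v h = solve (i ∷ c ∷ v ∷ h ∷ [])
      ex : total one + v ≤ c + i
      ex = exchange (λ f → total f + wt f via) (total-link≤1 L) (arc rest ⊕⟨ Link.py L ⟩ via) (Link.yq L) (λ f → wt f (Seg.body g))
        (λ f → trans (cong (λ k → k + wt f via + wt f (Seg.body g)) (wt-arc f rest))
          (trans (lemma′ (wtˢ f rest) (f p) (wt f via) (wt f (Seg.body g))) (cong (_+ wt f via) (covers w f))))
        where
        lemma′ : ∀ r p v b → r + p + v + b ≡ p + b + r + v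
        lemma′ r p v b = solve (r ∷ p ∷ v ∷ b ∷ [])

    wtᵇ-sym : ∀ f {u v} (B : Bridge u v) → wtᵇ f (Bridge-sym B) ≡ wtᵇ f B
    wtᵇ-sym f (edge _) = refl
    wtᵇ-sym f (off _ _ _ _ _) = refl

    -- Either pair of link ends allows an exchange: drop what precedes u and v in their segments, or what follows them.
    crossing-bound : ∀ {p q p′ q′ u v h} (g : Seg p q) (ss₁ : Segs q p′) (g′ : Seg p′ q′) (ss₂ : Segs q′ p) →
      Whole (g ∷ˢ (ss₁ ++ˢ (g′ ∷ˢ ss₂))) → Link p p′ h → Link q q′ h → (B : Bridge u v) →
      (pre : Path (Seg.a g) u) (suf : Path u (Seg.b g)) (pre′ : Path (Seg.a g′) v) (suf′ : Path v (Seg.b g′)) →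
      (∀ f → wt f pre + wt f suf ≡ wt f (Seg.body g) + f u) → (∀ f → wt f pre′ + wt f suf′ ≡ wt f (Seg.body g′) + f v) →
      h + wtᵇ one B + 2 ≤ len pre + len pre′ × h + wtᵇ one B + 2 ≤ len suf + len suf′
    crossing-bound {p} {q} {p′} {q′} {u} {v} {h} g ss₁ g′ ss₂ w L L′ B pre suf pre′ suf′ eq eq′ = bound L ex₁ , bound L′ ex₂
      where
      I = Seg.body g
      I′ = Seg.body g′
      sum≡ : ∀ f l → wt f pre + wt f suf + (wt f pre′ + wt f suf′) + wtˢ f ss₁ + wtˢ f ss₂ + f p + f p′ + l ≡ total f + l + (f u + f v)
      sum≡ f l = trans (cong₂ (λ i j → i + j + wtˢ f ss₁ + wtˢ f ss₂ + f p + f p′ + l) (eq f) (eq′ f))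
        (trans (lemma (wt f I) (f u) (wt f I′) (f v) (wtˢ f ss₁) (wtˢ f ss₂) (f p) (f p′) l)
          (cong (λ k → k + l + (f u + f v)) (trans (cong (f p + wt f I +_) (≡-sym (wtˢ-++ f ss₁ (g′ ∷ˢ ss₂)))) (covers w f))))
        where
        lemma : ∀ i u i′ v s t p p′ l → i + u + (i′ + v) + s + t + p + p′ + l ≡ p + i + (s + (p′ + i′ + t)) + l + (u + v)
        lemma i u i′ v s t p p′ l = solve (i ∷ u ∷ i′ ∷ v ∷ s ∷ t ∷ p ∷ p′ ∷ l ∷ [])
      bound : ∀ {r s} (L : Link r s h) {k} → total one + (len (Link.via L) + wtᵇ one B) + 2 ≤ c + k → h + wtᵇ one B + 2 ≤ k
      bound L {k} ex = farkas 0 (ex ⊞ Link.long L)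
        (trans (cong (λ t → k + (t + (len (Link.via L) + wtᵇ one B) + 2 + h)) len≡) (lemma k c (len (Link.via L)) (wtᵇ one B) h))
        where
        lemma : ∀ k c v b h → k + (c + (v + b) + 2 + h) ≡ h + b + 2 + (c + k + v) + 0
        lemma k c v b h = solve (k ∷ c ∷ v ∷ b ∷ h ∷ [])
      both≤1 : ∀ {r s} (L : Link r s h) z → total (ind z) + (wt (ind z) (Link.via L) + wtᵇ (ind z) B) ≤ 1
      both≤1 L z = ℕₚ.≤-trans (ℕₚ.≤-reflexive (≡-sym (ℕₚ.+-assoc (total (ind z)) _ _))) (total-link-bridge≤1 L B z)
      -- The new cycle follows `ss₂`, the link from `p` to `p′`, `ss₁` backwards, and the bridge; of
      -- the two segments it keeps what lies from `u` and from `v` onwards.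
      ex₁ : total one + (len (Link.via L) + wtᵇ one B) + 2 ≤ c + (len pre + len pre′)
      ex₁ = exchange-gain (λ f → total f + (wt f (Link.via L) + wtᵇ f B)) (both≤1 L)
        (arc ss₂ ⊕⟨ Link.py L ⟩ Link.via L ⊕⟨ Link.yq L ⟩ rv (arc ss₁) ⊕⟨ ~-sym (Seg.leave g) ⟩ join (rv suf) B suf′) (Seg.leave g′)
        (λ f → wt f pre + wt f pre′) (λ f → f u + f v) (λ f → wt≥tgt f pre ⊞ wt≥tgt f pre′)
        λ f → trans (cong₂ (λ i j → i + (wt f (Link.via L) + (wt f (arc ss₁) + j)) + (wt f pre + wt f pre′)) (wt-arc f ss₂) (wt-join f (rv suf) B suf′))
          (trans (cong (λ k → wtˢ f ss₂ + f p + (wt f (Link.via L) + (k + (wt f suf + (wtᵇ f B + wt f suf′)))) + (wt f pre + wt f pre′)) (wt-arc f ss₁))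
          (trans (lemma (wtˢ f ss₂) (f p) (wt f (Link.via L)) (wtˢ f ss₁) (f p′) (wt f suf) (wtᵇ f B) (wt f suf′) (wt f pre) (wt f pre′))
            (sum≡ f (wt f (Link.via L) + wtᵇ f B))))
        where
        lemma : ∀ t p l s p′ y b y′ z z′ → t + p + (l + (s + p′ + (y + (b + y′)))) + (z + z′) ≡ z + y + (z′ + y′) + s + t + p + p′ + (l + b)
        lemma t p l s p′ y b y′ z z′ = solve (t ∷ p ∷ l ∷ s ∷ p′ ∷ y ∷ b ∷ y′ ∷ z ∷ z′ ∷ [])
      ex₂ : total one + (len (Link.via L′) + wtᵇ one B) + 2 ≤ c + (len suf + len suf′)
      ex₂ = exchange-gain (λ f → total f + (wt f (Link.via L′) + wtᵇ f B)) (both≤1 L′)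
        (arc ss₁ ⊕⟨ Seg.enter g′ ⟩ join pre′ (Bridge-sym B) (rv pre) ⊕⟨ ~-sym (Seg.enter g) ⟩ rv (arc ss₂) ⊕⟨ ~-sym (Link.yq L′) ⟩ rv (Link.via L′))
        (~-sym (Link.py L′))
        (λ f → wt f suf + wt f suf′) (λ f → f u + f v) (λ f → wt≥src f suf ⊞ wt≥src f suf′)
        λ f → trans (cong₂ (λ i j → i + (j + (wt f (arc ss₂) + wt f (Link.via L′))) + (wt f suf + wt f suf′)) (wt-arc f ss₁) (wt-join f pre′ (Bridge-sym B) (rv pre)))
          (trans (cong₂ (λ i j → wtˢ f ss₁ + f p′ + (wt f pre′ + (i + wt f pre) + (j + wt f (Link.via L′))) + (wt f suf + wt f suf′)) (wtᵇ-sym f B) (wt-arc f ss₂))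
          (trans (lemma (wtˢ f ss₂) (f p) (wt f (Link.via L′)) (wtˢ f ss₁) (f p′) (wt f suf) (wtᵇ f B) (wt f suf′) (wt f pre) (wt f pre′))
            (sum≡ f (wt f (Link.via L′) + wtᵇ f B))))
        where
        lemma : ∀ t p l s p′ y b y′ z z′ → s + p′ + (z′ + (b + z) + (t + p + l)) + (y + y′) ≡ z + y + (z′ + y′) + s + t + p + p′ + (l + b)
        lemma t p l s p′ y b y′ z z′ = solve (t ∷ p ∷ l ∷ s ∷ p′ ∷ y ∷ b ∷ y′ ∷ z ∷ z′ ∷ [])

    shift : ∀ {p q r} (g : Seg p q) (ss : Segs q r) (ts : Segs r p) → Whole (g ∷ˢ (ss ++ˢ ts)) → Whole (ss ++ˢ (ts ++ˢ (g ∷ˢ []ˢ)))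
    shift g ss ts w = subst Whole (++ˢ-assoc ss ts (g ∷ˢ []ˢ)) (rotate (g ∷ˢ []ˢ) (ss ++ˢ ts) w)

    stretch : ∀ k → (∀ {p q} (g : Seg p q) (rest : Segs q p) → Whole (g ∷ˢ rest) → k ≤ len (Seg.body g)) →
              ∀ {p q} (ss : Segs p q) (ts : Segs q p) → Whole (ss ++ˢ ts) → (1 + k) * count ss ≤ wtˢ one ss
    stretch k long []ˢ ts w = ℕₚ.≤-reflexive (ℕₚ.*-zeroʳ k)
    stretch k long (g ∷ˢ ss) ts w = farkas 0 (long g (ss ++ˢ ts) w ⊞ stretch k long ss (ts ++ˢ (g ∷ˢ []ˢ)) (shift g ss ts w))
        (lemma (len (Seg.body g)) (wtˢ one ss) k (count ss))
      where
      lemma : ∀ b s k m → 1 + b + s + (k + (1 + k) * m) ≡ (1 + k) * (1 + m) + (b + s) + 0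
      lemma b s k m = solve (b ∷ s ∷ k ∷ m ∷ [])

    body≥1 : ∀ {p q} (g : Seg p q) (rest : Segs q p) → Whole (g ∷ˢ rest) → 1 ≤ len (Seg.body g)
    body≥1 g _ _ = len≥1 (Seg.body g)

    -- On the way from an `Out` head to an `In` head some segment starts in `Out` and ends in `In`.
    -- That one is at least as long as a link on `suc d` vertices; the others have at least one
    -- vertex.
    mixed : ∀ {In Out : Fin n → Set} (In? : ∀ z → Dec (In z)) d → (∀ {z} → A z → In z ⊎ Out z) →
            (∀ {p q} → Out p → In q → p ≢ q → Link p q (suc d)) →
            ∀ {p q} (ss : Segs p q) (ts : Segs q p) → Whole (ss ++ˢ ts) → p ≢ q → Out p → In q → 2 * count ss + d ≤ wtˢ one ss
    mixed In? d either L []ˢ ts w p≢q op iq = contradiction refl p≢q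
    mixed {In} In? d either L {q = q} (_∷ˢ_ {q = r} g ss) ts w p≢q op iq with In? r
    ... | yes ir = farkas 0 (link-body g (ss ++ˢ ts) w (L op ir (ends-≢ g _ w)) ⊞
                        stretch 1 body≥1 ss (ts ++ˢ (g ∷ˢ []ˢ)) (shift g ss ts w))
          (lemma (len (Seg.body g)) (wtˢ one ss) d (count ss))
      where
      lemma : ∀ b s d m → 1 + b + s + (1 + d + 2 * m) ≡ 2 * (1 + m) + d + (b + s) + 0
      lemma b s d m = solve (b ∷ s ∷ d ∷ m ∷ [])
    ... | no ¬ir = farkas 0 (body≥1 g _ w ⊞ mixed In? d either L ss (ts ++ˢ (g ∷ˢ []ˢ)) (shift g ss ts w)
                        (λ eq → ¬ir (subst In (≡-sym eq) iq)) ([ (λ ir → contradiction ir ¬ir) , id ]′ (either (Seg.q∈A g))) iq)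
          (lemma (len (Seg.body g)) (wtˢ one ss) d (count ss))
      where
      lemma : ∀ b s d m → 1 + b + s + (1 + (2 * m + d)) ≡ 2 * (1 + m) + d + (b + s) + 0
      lemma b s d m = solve (b ∷ s ∷ d ∷ m ∷ [])

    -- The kind changes on both arcs of the cycle between `p` and `q`, once in either direction, so
    -- the surplus `d` is earned twice.
    mixed-pair : ∀ {In Out : Fin n → Set} (In? : ∀ z → Dec (In z)) (Out? : ∀ z → Dec (Out z)) d → (∀ {z} → A z → In z ⊎ Out z) →
                 (∀ {p q} → Out p → In q → p ≢ q → Link p q (suc d)) →
                 ∀ {p q} (ss : Segs p q) (ts : Segs q p) → Whole (ss ++ˢ ts) → p ≢ q → Out p → In q → 2 * a + 2 * d ≤ c
    mixed-pair {In} {Out} In? Out? d either L {p} {q} ss ts w p≢q op iq =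
        goal (wtˢ one ss) (wtˢ one ts) (count ss) (count ts) sum≡ num≡ first second
      where
      first : 2 * count ss + d ≤ wtˢ one ss
      first = mixed {In} {Out} In? d either L ss ts w p≢q op iq
      second : 2 * count ts + d ≤ wtˢ one ts
      swapped : ∀ {z} → A z → Out z ⊎ In z
      swapped az = [ inj₂ , inj₁ ]′ (either az)
      L′ : ∀ {p q} → In p → Out q → p ≢ q → Link p q (suc d)
      L′ ip oq ne = Link-sym (L oq ip (λ eq → ne (≡-sym eq)))
      second = mixed {Out} {In} Out? d swapped L′ ts ss (rotate ss ts w) (λ eq → p≢q (≡-sym eq)) iq op
      sum≡ : wtˢ one ss + wtˢ one ts ≡ c
      sum≡ = trans (≡-sym (wtˢ-++ one ss ts)) (trans (covers w one) len≡)
      num≡ : count ss + count ts ≡ a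
      num≡ = trans (≡-sym (count-++ ss ts)) (count≡ w)
      goal : ∀ x y m k {a c} → x + y ≡ c → m + k ≡ a → 2 * m + d ≤ x → 2 * k + d ≤ y → 2 * a + 2 * d ≤ c
      goal x y m k refl refl h h′ = farkas 0 (h ⊞ h′) (lemma x y d m k)
        where
        lemma : ∀ x y d m k → x + y + (2 * m + d + (2 * k + d)) ≡ 2 * (m + k) + 2 * d + (x + y) + 0
        lemma x y d m k = solve (x ∷ y ∷ d ∷ m ∷ k ∷ [])

    split-at : ∀ {p q} → A p → A q → Σ[ ss ∈ Segs p q ] Σ[ ts ∈ Segs q p ] Whole (ss ++ˢ ts)
    split-at {p} {q} ap aq = start (root-head ap)
      where
      go : ∀ {segs : Segs p p} → AtHead q segs → Whole segs → Σ[ ss ∈ Segs p q ] Σ[ ts ∈ Segs q p ] Whole (ss ++ˢ ts)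
      go (atHead pre g′ post refl) w = pre , g′ ∷ˢ post , w
      start : RootHead p → Σ[ ss ∈ Segs p q ] Σ[ ts ∈ Segs q p ] Whole (ss ++ˢ ts)
      start (rootHead g rest w) = go (locateHead (g ∷ˢ rest) (A⇒head w aq)) w

    mixed-total : ∀ {In Out : Fin n → Set} (In? : ∀ z → Dec (In z)) (Out? : ∀ z → Dec (Out z)) d → (∀ {z} → A z → In z ⊎ Out z) →
                  (∀ {p q} → Out p → In q → p ≢ q → Link p q (suc d)) →
                  ∀ {p q} → A p → A q → p ≢ q → Out p → In q → 2 * a + 2 * d ≤ c
    mixed-total {In} {Out} In? Out? d either L {p} {q} ap aq p≢q op iq = go (split-at ap aq)
      where
      go : Σ[ ss ∈ Segs p q ] Σ[ ts ∈ Segs q p ] Whole (ss ++ˢ ts) → 2 * a + 2 * d ≤ c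
      go (ss , ts , w) = mixed-pair {In} {Out} In? Out? d either L ss ts w p≢q op iq

    -- Longer cycles for the critical chord patterns.

    too-long : ∀ {p q h u v} (L : Link p q (suc h)) (new : Path u v) → v ~ u → (∀ f → wt f new ≡ total f + wt f (Link.via L)) → ⊥
    too-long {h = h} L new e eq = farkas-⊥ h (exchange (λ f → total f + wt f (Link.via L)) (total-link≤1 L) new e (λ _ → 0)
        (λ f → trans (ℕₚ.+-identityʳ _) (eq f)) ⊞ Link.long L)
        (trans (cong (λ k → k + wt one (Link.via L) + suc h) len≡) (lemma c (wt one (Link.via L)) h))
      where
      lemma : ∀ c v h → c + v + (1 + h) ≡ c + 0 + v + (1 + h)
      lemma c v h = solve (c ∷ v ∷ h ∷ [])

    -- A link on two vertices pays for the loss of one.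
    too-long-but-one : ∀ {p q h u v} z (L : Link p q (suc (suc h))) (new : Path u v) → v ~ u →
                       (∀ f → wt f new + f z ≡ total f + wt f (Link.via L)) → ⊥
    too-long-but-one {h = h} z L new e eq = farkas-⊥ h (exchange (λ f → total f + wt f (Link.via L)) (total-link≤1 L) new e (λ f → f z) eq ⊞ Link.long L)
        (trans (cong (λ k → k + wt one (Link.via L) + suc (suc h)) len≡) (lemma c (wt one (Link.via L)) h))
      where
      lemma : ∀ c v h → c + v + (2 + h) ≡ c + 1 + v + (1 + h)
      lemma c v h = solve (c ∷ v ∷ h ∷ [])

    too-long-bridge : ∀ {p q h u v s t} (L : Link p q (suc h)) (B : Bridge s t) (new : Path u v) → v ~ u →
                      (∀ f → wt f new ≡ total f + wt f (Link.via L) + wtᵇ f B) → ⊥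
    too-long-bridge {h = h} L B new e eq = farkas-⊥ (h + wtᵇ one B) (exchange (λ f → total f + wt f (Link.via L) + wtᵇ f B) (total-link-bridge≤1 L B) new e
        (λ _ → 0) (λ f → trans (ℕₚ.+-identityʳ _) (eq f)) ⊞ Link.long L)
        (trans (cong (λ k → k + wt one (Link.via L) + wtᵇ one B + suc h) len≡) (lemma c (wt one (Link.via L)) (wtᵇ one B) h))
      where
      lemma : ∀ c v b h → c + v + b + (1 + h) ≡ c + 0 + v + (1 + (h + b))
      lemma c v b h = solve (c ∷ v ∷ b ∷ h ∷ [])

    -- `R₀` and `R₁` are the arcs between the segments, including their end vertices in `A`. The
    -- hypotheses list the edges that the new cycle traverses, and the last one says that the named
    -- pieces make up the old cycle.
    module TwoArcs {q₀ p₁ q₁ p₀ : Fin n} (R₀ : Path q₀ p₁) (R₁ : Path q₁ p₀) where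

      both-inner : ∀ {w₁ w₂ w₃ w₄ u h} → p₀ ~ w₁ → w₁ ~ w₂ → w₃ ~ w₄ → w₄ ~ q₀ → w₂ ~ u → w₃ ~ u → Link p₁ q₁ (suc h) →
                   (∀ f → f w₁ + (f w₂ + (f w₃ + f w₄)) + wt f R₀ + f u + wt f R₁ ≡ total f) → ⊥
      both-inner {w₁} {w₂} {w₃} {w₄} {u} e₁ e₂ e₃ e₄ d₂ d₃ L eq = too-long L
          (R₁ ⊕⟨ e₁ ⟩ [ w₁ ] ⊕⟨ e₂ ⟩ [ w₂ ] ⊕⟨ d₂ ⟩ [ u ] ⊕⟨ ~-sym d₃ ⟩ [ w₃ ] ⊕⟨ e₃ ⟩ [ w₄ ] ⊕⟨ e₄ ⟩ R₀ ⊕⟨ Link.py L ⟩ Link.via L) (Link.yq L)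
          λ f → trans (lemma (wt f R₁) (f w₁) (f w₂) (f u) (f w₃) (f w₄) (wt f R₀) (wt f (Link.via L))) (cong (_+ wt f (Link.via L)) (eq f))
        where
        lemma : ∀ s a b u c d r v → s + (a + (b + (u + (c + (d + (r + v)))))) ≡ a + (b + (c + d)) + r + u + s + v
        lemma s a b u c d r v = solve (s ∷ a ∷ b ∷ u ∷ c ∷ d ∷ r ∷ v ∷ [])

      triangle : ∀ {w₁ w₂ w₃ u h} → p₀ ~ w₁ → w₂ ~ w₃ → w₂ ~ u → u ~ p₁ → Link q₀ q₁ (suc h) → (B : Bridge w₁ w₃) →
                 (∀ f → f w₁ + (f w₂ + f w₃) + wt f R₀ + f u + wt f R₁ ≡ total f) → ⊥
      triangle {w₁} {w₂} {w₃} {u} e₁ e₂ d up L B eq = too-long-bridge L B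
          (join (R₁ ⊕⟨ e₁ ⟩ [ w₁ ]) B ([ w₃ ] ⊕⟨ ~-sym e₂ ⟩ [ w₂ ] ⊕⟨ d ⟩ [ u ] ⊕⟨ up ⟩ rv R₀ ⊕⟨ Link.py L ⟩ Link.via L)) (Link.yq L)
          λ f → trans (wt-join f (R₁ ⊕⟨ e₁ ⟩ [ w₁ ]) B _) (trans (lemma (wt f R₁) (f w₁) (wtᵇ f B) (f w₃) (f w₂) (f u) (wt f R₀) (wt f (Link.via L)))
            (cong (λ t → t + wt f (Link.via L) + wtᵇ f B) (eq f)))
        where
        lemma : ∀ s a b c w u r v → s + a + (b + (c + (w + (u + (r + v))))) ≡ a + (w + c) + r + u + s + v + b
        lemma s a b c w u r v = solve (s ∷ a ∷ b ∷ c ∷ w ∷ u ∷ r ∷ v ∷ [])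

    module ThreeArcs {q₀ p₁ q₁ p₂ q₂ p₀ : Fin n} (R₀ : Path q₀ p₁) (R₁ : Path q₁ p₂) (R₂ : Path q₂ p₀) where

      outer-inner : ∀ {w₁ w₂ w₃ w₄ u v h} → p₀ ~ w₁ → w₁ ~ w₂ → w₃ ~ w₄ → w₄ ~ q₀ → u ~ p₁ → v ~ p₂ → w₂ ~ u → w₃ ~ v → Link q₁ q₂ (suc h) →
                    (∀ f → f w₁ + (f w₂ + (f w₃ + f w₄)) + wt f R₀ + f u + wt f R₁ + f v + wt f R₂ ≡ total f) → ⊥
      outer-inner {w₁} {w₂} {w₃} {w₄} {u} {v} e₁ e₂ e₃ e₄ up vp d₂ d₃ L eq = too-long L
          (R₂ ⊕⟨ e₁ ⟩ [ w₁ ] ⊕⟨ e₂ ⟩ [ w₂ ] ⊕⟨ d₂ ⟩ [ u ] ⊕⟨ up ⟩ rv R₀ ⊕⟨ ~-sym e₄ ⟩ [ w₄ ] ⊕⟨ ~-sym e₃ ⟩ [ w₃ ] ⊕⟨ d₃ ⟩ [ v ] ⊕⟨ vp ⟩ rv R₁ ⊕⟨ Link.py L ⟩ Link.via L)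
          (Link.yq L)
          λ f → trans (lemma (wt f R₂) (f w₁) (f w₂) (f u) (wt f R₀) (f w₄) (f w₃) (f v) (wt f R₁) (wt f (Link.via L))) (cong (_+ wt f (Link.via L)) (eq f))
        where
        lemma : ∀ s a b u r d c w t v → s + (a + (b + (u + (r + (d + (c + (w + (t + v)))))))) ≡ a + (b + (c + d)) + r + u + t + w + s + v
        lemma s a b u r d c w t v = solve (s ∷ a ∷ b ∷ u ∷ r ∷ d ∷ c ∷ w ∷ t ∷ v ∷ [])

      inner-outer : ∀ {w₁ w₂ w₃ w₄ u v h} → p₀ ~ w₁ → w₁ ~ w₂ → w₃ ~ w₄ → w₄ ~ q₀ → u ~ q₁ → v ~ p₂ → w₃ ~ u → w₂ ~ v → Link p₁ q₂ (suc h) →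
                    (∀ f → f w₁ + (f w₂ + (f w₃ + f w₄)) + wt f R₀ + f u + wt f R₁ + f v + wt f R₂ ≡ total f) → ⊥
      inner-outer {w₁} {w₂} {w₃} {w₄} {u} {v} e₁ e₂ e₃ e₄ uq vp d₃ d₂ L eq = too-long L
          (R₂ ⊕⟨ e₁ ⟩ [ w₁ ] ⊕⟨ e₂ ⟩ [ w₂ ] ⊕⟨ d₂ ⟩ [ v ] ⊕⟨ vp ⟩ rv R₁ ⊕⟨ ~-sym uq ⟩ [ u ] ⊕⟨ ~-sym d₃ ⟩ [ w₃ ] ⊕⟨ e₃ ⟩ [ w₄ ] ⊕⟨ e₄ ⟩ R₀ ⊕⟨ Link.py L ⟩ Link.via L)
          (Link.yq L)
          λ f → trans (lemma (wt f R₂) (f w₁) (f w₂) (f v) (wt f R₁) (f u) (f w₃) (f w₄) (wt f R₀) (wt f (Link.via L))) (cong (_+ wt f (Link.via L)) (eq f))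
        where
        lemma : ∀ s a b w t u c d r v → s + (a + (b + (w + (t + (u + (c + (d + (r + v)))))))) ≡ a + (b + (c + d)) + r + u + t + w + s + v
        lemma s a b w t u c d r v = solve (s ∷ a ∷ b ∷ w ∷ t ∷ u ∷ c ∷ d ∷ r ∷ v ∷ [])

      pair-then-single : ∀ {w₁ w₂ w₃ z₁ z₂ u h} → p₀ ~ w₁ → w₁ ~ w₂ → w₃ ~ q₀ → z₁ ~ z₂ → z₂ ~ q₁ → u ~ p₂ → w₃ ~ z₁ → w₂ ~ u → Link p₁ q₂ (suc h) →
                         (∀ f → f w₁ + (f w₂ + f w₃) + wt f R₀ + (f z₁ + f z₂) + wt f R₁ + f u + wt f R₂ ≡ total f) → ⊥
      pair-then-single {w₁} {w₂} {w₃} {z₁} {z₂} {u} e₁ e₂ e₃ z zq up d₃ d₂ L eq = too-long L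
          (R₂ ⊕⟨ e₁ ⟩ [ w₁ ] ⊕⟨ e₂ ⟩ [ w₂ ] ⊕⟨ d₂ ⟩ [ u ] ⊕⟨ up ⟩ rv R₁ ⊕⟨ ~-sym zq ⟩ [ z₂ ] ⊕⟨ ~-sym z ⟩ [ z₁ ] ⊕⟨ ~-sym d₃ ⟩ [ w₃ ] ⊕⟨ e₃ ⟩ R₀ ⊕⟨ Link.py L ⟩ Link.via L)
          (Link.yq L)
          λ f → trans (lemma (wt f R₂) (f w₁) (f w₂) (f u) (wt f R₁) (f z₂) (f z₁) (f w₃) (wt f R₀) (wt f (Link.via L))) (cong (_+ wt f (Link.via L)) (eq f))
        where
        lemma : ∀ s a b w t z y c r v → s + (a + (b + (w + (t + (z + (y + (c + (r + v)))))))) ≡ a + (b + c) + r + (y + z) + t + w + s + v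
        lemma s a b w t z y c r v = solve (s ∷ a ∷ b ∷ w ∷ t ∷ z ∷ y ∷ c ∷ r ∷ v ∷ [])

      single-then-pair : ∀ {w₁ w₂ w₃ z₁ z₂ u h} → p₀ ~ w₁ → w₂ ~ w₃ → w₃ ~ q₀ → z₁ ~ z₂ → p₂ ~ z₁ → u ~ q₁ → w₁ ~ z₂ → w₂ ~ u → Link q₂ p₁ (suc h) →
                         (∀ f → f w₁ + (f w₂ + f w₃) + wt f R₀ + f u + wt f R₁ + (f z₁ + f z₂) + wt f R₂ ≡ total f) → ⊥
      single-then-pair {w₁} {w₂} {w₃} {z₁} {z₂} {u} e₁ e₂ e₃ z pz uq d₁ d₂ L eq = too-long L
          (rv R₀ ⊕⟨ ~-sym e₃ ⟩ [ w₃ ] ⊕⟨ ~-sym e₂ ⟩ [ w₂ ] ⊕⟨ d₂ ⟩ [ u ] ⊕⟨ uq ⟩ R₁ ⊕⟨ pz ⟩ [ z₁ ] ⊕⟨ z ⟩ [ z₂ ] ⊕⟨ ~-sym d₁ ⟩ [ w₁ ] ⊕⟨ ~-sym e₁ ⟩ rv R₂ ⊕⟨ Link.py L ⟩ Link.via L)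
          (Link.yq L)
          λ f → trans (lemma (wt f R₀) (f w₃) (f w₂) (f u) (wt f R₁) (f z₁) (f z₂) (f w₁) (wt f R₂) (wt f (Link.via L))) (cong (_+ wt f (Link.via L)) (eq f))
        where
        lemma : ∀ r c b w t y z a s v → r + (c + (b + (w + (t + (y + (z + (a + (s + v)))))))) ≡ a + (b + c) + r + w + t + (y + z) + s + v
        lemma r c b w t y z a s v = solve (r ∷ c ∷ b ∷ w ∷ t ∷ y ∷ z ∷ a ∷ s ∷ v ∷ [])

      first-second : ∀ {w₁ w₂ w₃ w₄ u₁ u₂ t₁ t₂ h} → p₀ ~ w₁ → w₁ ~ w₂ → w₃ ~ w₄ → w₄ ~ q₀ → u₁ ~ u₂ → u₂ ~ q₁ → p₂ ~ t₁ → t₁ ~ t₂ →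
                     w₃ ~ u₁ → w₂ ~ t₂ → Link p₁ q₂ (suc h) →
                     (∀ f → f w₁ + (f w₂ + (f w₃ + f w₄)) + wt f R₀ + (f u₁ + f u₂) + wt f R₁ + (f t₁ + f t₂) + wt f R₂ ≡ total f) → ⊥
      first-second {w₁} {w₂} {w₃} {w₄} {u₁} {u₂} {t₁} {t₂} e₁ e₂ e₃ e₄ u uq pt t d₃ d₂ L eq = too-long L
          (R₂ ⊕⟨ e₁ ⟩ [ w₁ ] ⊕⟨ e₂ ⟩ [ w₂ ] ⊕⟨ d₂ ⟩ [ t₂ ] ⊕⟨ ~-sym t ⟩ [ t₁ ] ⊕⟨ ~-sym pt ⟩ rv R₁ ⊕⟨ ~-sym uq ⟩ [ u₂ ] ⊕⟨ ~-sym u ⟩ [ u₁ ] ⊕⟨ ~-sym d₃ ⟩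
            [ w₃ ] ⊕⟨ e₃ ⟩ [ w₄ ] ⊕⟨ e₄ ⟩ R₀ ⊕⟨ Link.py L ⟩ Link.via L) (Link.yq L)
          λ f → trans (lemma (wt f R₂) (f w₁) (f w₂) (f t₂) (f t₁) (wt f R₁) (f u₂) (f u₁) (f w₃) (f w₄) (wt f R₀) (wt f (Link.via L))) (cong (_+ wt f (Link.via L)) (eq f))
        where
        lemma : ∀ s a b t t′ r u u′ c d q v → s + (a + (b + (t + (t′ + (r + (u + (u′ + (c + (d + (q + v)))))))))) ≡
                                           a + (b + (c + d)) + q + (u′ + u) + r + (t′ + t) + s + v
        lemma s a b t t′ r u u′ c d q v = solve (s ∷ a ∷ b ∷ t ∷ t′ ∷ r ∷ u ∷ u′ ∷ c ∷ d ∷ q ∷ v ∷ [])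

      -- The tour omits `u₁`, which is why the link must have two vertices; it serves the case of
      -- `d` equal to 1.
      second-first : ∀ {w₁ w₂ w₃ w₄ u₁ u₂ t₁ t₂ h} → p₀ ~ w₁ → w₁ ~ w₂ → w₃ ~ w₄ → w₄ ~ q₀ → u₂ ~ q₁ → t₁ ~ t₂ → t₂ ~ q₂ →
                     w₂ ~ u₂ → w₃ ~ t₁ → Link p₂ p₁ (suc (suc h)) →
                     (∀ f → f w₁ + (f w₂ + (f w₃ + f w₄)) + wt f R₀ + (f u₁ + f u₂) + wt f R₁ + (f t₁ + f t₂) + wt f R₂ ≡ total f) → ⊥
      second-first {w₁} {w₂} {w₃} {w₄} {u₁} {u₂} {t₁} {t₂} e₁ e₂ e₃ e₄ uq t tq d₂ d₃ L eq = too-long-but-one u₁ L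
          ([ w₁ ] ⊕⟨ e₂ ⟩ [ w₂ ] ⊕⟨ d₂ ⟩ [ u₂ ] ⊕⟨ uq ⟩ R₁ ⊕⟨ Link.py L ⟩ Link.via L ⊕⟨ Link.yq L ⟩ rv R₀ ⊕⟨ ~-sym e₄ ⟩ [ w₄ ] ⊕⟨ ~-sym e₃ ⟩ [ w₃ ] ⊕⟨ d₃ ⟩
            [ t₁ ] ⊕⟨ t ⟩ [ t₂ ] ⊕⟨ tq ⟩ R₂) e₁
          λ f → trans (lemma (wt f R₂) (f w₁) (f w₂) (f t₂) (f t₁) (wt f R₁) (f u₂) (f u₁) (f w₃) (f w₄) (wt f R₀) (wt f (Link.via L))) (cong (_+ wt f (Link.via L)) (eq f))
        where
        lemma : ∀ s a b t t′ r u u′ c d q v → a + (b + (u + (r + (v + (q + (d + (c + (t′ + (t + s))))))))) + u′ ≡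
                                           a + (b + (c + d)) + q + (u′ + u) + r + (t′ + t) + s + v
        lemma s a b t t′ r u u′ c d q v = solve (s ∷ a ∷ b ∷ t ∷ t′ ∷ r ∷ u ∷ u′ ∷ c ∷ d ∷ q ∷ v ∷ [])

-- Choosing d for the component off the cycle.

argmin : ∀ {n} {P : Fin n → Set} → (∀ z → Dec (P z)) → (f : Fin n → ℕ) → ∃ P → ∃ λ y → P y × (∀ {z} → P z → f y ≤ f z)
argmin {n} {P} P? f (x , px) = y , py , λ {z} pz → best z (∈ₚ.∈-allFin z) pz
  where
  search : ∀ l → ∃ λ y → P y × (∀ z → z ∈ l → P z → f y ≤ f z)
  search [] = x , px , λ _ ()
  search (w ∷ l) with search l
  ... | y , py , best with P? w
  ... | no ¬pw = y , py , λ { z (here refl) pz → contradiction pz ¬pw ; z (there h) pz → best z h pz }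
  ... | yes pw with f y ≤? f w
  ... | yes le = y , py , λ { z (here refl) _ → le ; z (there h) pz → best z h pz }
  ... | no ¬le = w , pw , λ { z (here refl) _ → ℕₚ.≤-refl ; z (there h) pz → ℕₚ.≤-trans (ℕₚ.<⇒≤ (ℕₚ.≰⇒> ¬le)) (best z h pz) }
  y = proj₁ (search (allFin n))
  py = proj₁ (proj₂ (search (allFin n)))
  best = proj₂ (proj₂ (search (allFin n)))

module Frames (S : Setting) (X : OffVertex S) where

  open Setting S
  open OffVertex X
  open Paths G
  open Walks G
  open LongestCycle S
  open Outside X
  open Lobes G

  -- All that the counting needs to know about `H`. The value 0 is reserved for a component that
  -- consists of `x` alone; a larger component gets `d` at least 1.
  record Frame : Set where
    field
      d : ℕ
      links : ∀ {p q} → A p → A q → p ≢ q → Link p q (suc d)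
      δ≤ : δ ≤ a + d
      lone : d ≡ 0 → ∀ {y} → H y → y ≡ x

  private
    somewhere : RootHead (proj₁ A-nonempty)
    somewhere = root-head (proj₂ A-nonempty)

  A-list : ∀ {l} → Unique l → (∀ {z} → z ∈ l → A z) → length l ≤ a
  A-list u sub = count-list somewhere u sub
    where
    count-list : ∀ {p l} → RootHead p → Unique l → (∀ {z} → z ∈ l → A z) → length l ≤ a
    count-list (rootHead g rest w) u sub = ℕₚ.≤-trans (unique-⊆⇒length≤ u (λ h → A⇒head w (sub h)))
      (ℕₚ.≤-reflexive (trans (length-heads (g ∷ˢ rest)) (count≡ w)))

  another : ∀ {p} → A p → ∃ λ q → A q × q ≢ p
  another ap = go (root-head ap)
    where
    go : ∀ {p} → RootHead p → ∃ λ q → A q × q ≢ p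
    go (rootHead g rest w) = _ , Seg.q∈A g , λ eq → ends-≢ g rest w (≡-sym eq)

  outer : Fin n → List (Fin n)
  outer y = filter (λ z → ¬? (H? z)) (nbrs y)

  degH : Fin n → ℕ
  degH = degIn H?

  outer-unique : ∀ y → Unique (outer y)
  outer-unique y = Uniqueₚ.filter⁺ (λ z → ¬? (H? z)) (nbrs-unique y)

  outer-length : ∀ y → δ ≤ degH y + length (outer y)
  outer-length y = ℕₚ.≤-trans (δ≤deg y) (ℕₚ.≤-reflexive (trans (≡-sym (length-nbrs y)) (length-filter-split H? (nbrs y))))

  outer-~ : ∀ {y z} → z ∈ outer y → y ~ z
  outer-~ h = ∈-nbrs⁻ (proj₁ (∈ₚ.∈-filter⁻ (λ z → ¬? (H? z)) h))

  H-grow : ∀ {y z} → H y → y ~ z → ¬ OnC z → H z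
  H-grow hy e ¬o = walk-snoc hy e ¬o

  outer⊆A : ∀ {y z} → H y → z ∈ outer y → A z
  outer⊆A {y} {z} hy h with OnC? z
  ... | yes o = o , y , ~-sym (outer-~ h) , hy
  ... | no ¬o = contradiction (H-grow hy (outer-~ h) ¬o) (proj₂ (∈ₚ.∈-filter⁻ (λ z → ¬? (H? z)) {xs = nbrs y} h))

  singleton-frame : (∀ {y} → H y → y ≡ x) → Frame
  singleton-frame only = record
    { d = 0 ; links = λ ap aq _ → A⇒Link ap aq ; δ≤ = ℕₚ.≤-trans few (ℕₚ.≤-reflexive (≡-sym (ℕₚ.+-identityʳ a))) ; lone = λ _ → only }
    where
    inA : ∀ {z} → x ~ z → A z
    inA {z} e with OnC? z
    ... | yes o = o , x , ~-sym e , stop x∉C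
    ... | no ¬o = contradiction (only (H-grow (stop x∉C) e ¬o)) (λ eq → ~⇒≢ e (≡-sym eq))
    few : δ ≤ a
    few = ℕₚ.≤-trans (δ≤deg x) (ℕₚ.≤-trans (ℕₚ.≤-reflexive (≡-sym (length-nbrs x)))
      (A-list (nbrs-unique x) (λ h → inA (∈-nbrs⁻ h))))

  H-walk : ∀ {y z} → H y → H z → Walk H y z
  H-walk hy hz = walk-trans (walk-sym (walk-confined hy)) (walk-confined hz)

  -- Attachments are classified by whether they see the lobe or the rest of `H`; one vertex may be
  -- of both kinds. Long links are available between different kinds.
  module InLobe {d : ℕ} {r : Fin n} (L : Lobe H d r) where

    open Lobe L

    In Out : Fin n → Set
    In p = A p × ∃ λ y → p ~ y × D y
    Out p = A p × ∃ λ w → p ~ w × H w × ¬ D w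

    In? : ∀ p → Dec (In p)
    In? p = A? p ×-dec Finₚ.any? (λ y → (p ~? y) ×-dec D? y)

    Out? : ∀ p → Dec (Out p)
    Out? p = A? p ×-dec Finₚ.any? (λ w → (p ~? w) ×-dec (H? w ×-dec ¬? (D? w)))

    in-or-out : ∀ {p} → A p → In p ⊎ Out p
    in-or-out ap@(_ , y , e , hy) with D? y
    ... | yes dy = inj₁ (ap , y , e , dy)
    ... | no ¬dy = inj₂ (ap , y , e , hy , ¬dy)

    lobe-link : ∀ {p q} → Out p → In q → p ≢ q → Link p q (suc d)
    lobe-link (_ , w , pw , hw , ¬dw) (_ , y , qy , dy) _ with p , s , on , le ← across ¬dw (H-walk hw b∈K) dy =
      link p s on pw (~-sym qy) le

    -- Otherwise the single vertex `b` would separate the lobe from the cycle.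
    In-nonempty : ∃ In
    In-nonempty with Finₚ.any? In?
    ... | yes h = h
    ... | no none = contradiction (tough⇒cut-large tgh (b ∷ []) (y₀ ∷ s ∷ [])
          ((λ { (here eq) → b∉D (subst D eq Dy₀) }) All.∷ (λ { (here eq) → H∉C b∈K (subst OnC eq (On-src path)) }) All.∷ All.[])
          ((stuck Dy₀ All.∷ All.[]) AllPairs.∷ All.[] AllPairs.∷ AllPairs.[]) (s≤s (s≤s z≤n))) λ { (s≤s ()) }
      where
      stuck : ∀ {y} → D y → ¬ Walk (_∉ b ∷ []) y s
      stuck dy (stop _) = H∉C (D⊆K dy) (On-src path)
      stuck {y} dy (step {w = w} _ e r) with OnC? w
      ... | yes o = none (w , (o , y , ~-sym e , D⊆K dy) , y , ~-sym e , dy)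
      ... | no ¬o with closed dy (H-grow (D⊆K dy) e ¬o) e
      ... | inj₁ dw = stuck dw r
      ... | inj₂ eq = walk-src r (here eq)

    -- A mixed pair of different attachments is wanted. Should the `Out` vertex and the `In` vertex
    -- found coincide, any other attachment is of some kind and pairs with this vertex of both
    -- kinds.
    two-gaps : ∃ Out → 2 * a + 2 * d ≤ c
    two-gaps (p , op) = from-pair In-nonempty
      where
      gap : ∀ {p q} → A p → A q → p ≢ q → Out p → In q → 2 * a + 2 * d ≤ c
      gap = mixed-total {In} {Out} In? Out? d in-or-out lobe-link
      third : In p → (∃ λ t → A t × t ≢ p) → 2 * a + 2 * d ≤ c
      third ip (t , at , t≢p) = [ (λ it → gap (proj₁ op) at (λ eq → t≢p (≡-sym eq)) op it)
                                , (λ ot → gap at (proj₁ op) t≢p ot ip) ]′ (in-or-out at)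
      from-pair : ∃ In → 2 * a + 2 * d ≤ c
      from-pair (q , iq) with p Fin.≟ q
      ... | no ne = gap (proj₁ op) (proj₁ iq) ne op iq
      ... | yes refl = third iq (another (proj₁ op))

    -- From a ≥ 3 and d ≥ δ - 1 the two long gaps would give c ≥ 2a + 2d ≥ 2δ + 4.
    d-small : ∃ Out → ¬ (δ ≤ suc d)
    d-small o le = farkas-⊥ 0 (two-gaps o ⊞ c≤ ⊞ a≥3 ⊞ a≥3 ⊞ le ⊞ le) (lemma a d c δ)
      where
      lemma : ∀ a d c δ → 2 * a + 2 * d + (c + (3 + (3 + (δ + δ)))) ≡ c + (2 * δ + 3 + (a + (a + (1 + d + (1 + d))))) + 1
      lemma a d c δ = solve (a ∷ d ∷ c ∷ δ ∷ [])

    a-small : ∃ Out → ¬ (2 + δ ≤ a + d)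
    a-small o le = farkas-⊥ 0 (two-gaps o ⊞ c≤ ⊞ le ⊞ le) (lemma a d c δ)
      where
      lemma : ∀ a d c δ → 2 * a + 2 * d + (c + (2 + δ + (2 + δ))) ≡ c + (2 * δ + 3 + (a + d + (a + d))) + 1
      lemma a d c δ = solve (a ∷ d ∷ c ∷ δ ∷ [])

    outer⊆In : ∀ {y z} → D y → z ∈ outer y → In z
    outer⊆In {y} dy h = outer⊆A (D⊆K dy) h , y , ~-sym (outer-~ h) , dy

    outer⊆Out : ∀ {w z} → H w → ¬ D w → z ∈ outer w → Out z
    outer⊆Out {w} hw ¬dw h = outer⊆A hw h , w , ~-sym (outer-~ h) , hw , ¬dw

    -- Of at least `δ` neighbours `y` has at most `d` in `H`, hence at least δ - d in `A`. Two
    -- further attachments raise `a` to a value that `a-small` forbids.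
    two-missing : ∀ {y p q} → H y → degH y ≤ d → A p → A q → p ≢ q → p ∉ outer y → q ∉ outer y → 2 + δ ≤ a + d
    two-missing {y} {p} {q} hy le ap aq p≢q p∉ q∉ = farkas 0 (outer-length y ⊞ le ⊞ A-list {p ∷ q ∷ outer y}
        ((p≢q All.∷ Allₚ.¬Any⇒All¬ _ p∉) AllPairs.∷ Allₚ.¬Any⇒All¬ _ q∉ AllPairs.∷ outer-unique y)
        (λ { (here refl) → ap ; (there (here refl)) → aq ; (there (there h)) → outer⊆A hy h }))
        (lemma δ a d (degH y) (length (outer y)))
      where
      lemma : ∀ δ a d e o → a + d + (δ + (e + (2 + o))) ≡ 2 + δ + (e + o + (d + a)) + 0
      lemma δ a d e o = solve (δ ∷ a ∷ d ∷ e ∷ o ∷ [])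

    -- Both `r` outside the lobe and `y` inside it have few neighbours in `H`. So all attachments
    -- but at most one are `Out`, all but at most one are `In`, and any two can be matched as one
    -- `Out` and one `In`.
    balanced-frame : ∀ {y} → 1 ≤ d → ∃ Out → H r → degH r ≤ d → D y → degH y ≤ d → Frame
    balanced-frame {y} 1≤d o hr ler dy ley = record
      { d = d ; links = links ; δ≤ = ℕₚ.≤-trans (outer-length y) (ℕₚ.≤-trans (ley ⊞ A-list (outer-unique y) (outer⊆A (D⊆K dy))) (ℕₚ.≤-reflexive (ℕₚ.+-comm d a)))
      ; lone = λ eq → contradiction (subst (1 ≤_) eq 1≤d) λ () }
      where
      links : ∀ {p q} → A p → A q → p ≢ q → Link p q (suc d)
      links {p} {q} ap aq ne with Out? p | In? q | In? p | Out? q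
      ... | yes op | yes iq | _ | _ = lobe-link op iq ne
      ... | _ | _ | yes ip | yes oq = Link-sym (lobe-link oq ip (λ eq → ne (≡-sym eq)))
      ... | no ¬op | _ | _ | no ¬oq = contradiction (two-missing hr ler ap aq ne (λ h → ¬op (outer⊆Out hr x∉D h)) (λ h → ¬oq (outer⊆Out hr x∉D h))) (a-small o)
      ... | _ | no ¬iq | no ¬ip | _ = contradiction (two-missing (D⊆K dy) ley ap aq ne (λ h → ¬ip (outer⊆In dy h)) (λ h → ¬iq (outer⊆In dy h))) (a-small o)
      ... | no ¬op | _ | no ¬ip | _ = contradiction (in-or-out ap) [ ¬ip , ¬op ]′
      ... | _ | no ¬iq | _ | no ¬oq = contradiction (in-or-out aq) [ ¬iq , ¬oq ]′

  -- If every vertex of the lobe has more than `d` neighbours in `H`, the lobe is refined and `d`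
  -- grows by one. `k` bounds the number of rounds, since `d-small` keeps `d` below `δ`.
  refine-to-frame : ∀ k {d r} (L : Lobe H d r) → δ ≤ k + d → 1 ≤ d → ∃ (InLobe.Out L) → H r → degH r ≤ d → Frame
  refine-to-frame zero L le _ o _ _ = contradiction (ℕₚ.m≤n⇒m≤1+n le) (InLobe.d-small L o)
  refine-to-frame (suc k) {d} L le 1≤d o hr ler with Finₚ.any? (λ y → Lobe.D? L y ×-dec (degH y ≤? d))
  ... | yes (y , dy , ley) = InLobe.balanced-frame L 1≤d o hr ler dy ley
  ... | no none with lobe-refine H? L (λ {y} dy → ℕₚ.≰⇒> (λ le → none (y , dy , le)))
  ... | L′ , sub = refine-to-frame k L′ (ℕₚ.≤-trans le (ℕₚ.≤-reflexive (≡-sym (ℕₚ.+-suc k d)))) (s≤s z≤n) (out′ o) hr (ℕₚ.m≤n⇒m≤1+n ler)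
    where
    out′ : ∃ (InLobe.Out L) → ∃ (InLobe.Out L′)
    out′ (p , ap , w , e , hw , ¬dw) = p , ap , w , e , hw , λ h → ¬dw (sub h)

  module _ (y₁ : Fin n) (hy₁ : H y₁) (y₁≢x : y₁ ≢ x) where

    other-in-H : ∀ w → ∃ λ z → H z × z ≢ w
    other-in-H w with x Fin.≟ w
    ... | no ne = x , stop x∉C , ne
    ... | yes refl = y₁ , hy₁ , y₁≢x

    degH≥1 : ∀ {y} → H y → 1 ≤ degH y
    degH≥1 {y} hy with other-in-H y
    ... | z , hz , z≢y with first-step (H-walk hy hz) z≢y
    ... | w , e , hw = ∈ₚ.∈-length (∈ₚ.∈-filter⁺ H? {xs = nbrs y} (∈-nbrs⁺ e) hw)

    root-lobe : ∀ {d r} → H r → 1 ≤ d → (∀ {y} → H y → d ≤ degH y) → Lobe H d r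
    root-lobe {r = r} hr 1≤d degs = lobe (order H?) H? hr (H-walk hr) 1≤d (λ hy _ → degs hy) (other-in-H r) ℕₚ.≤-refl

    large-frame : Frame
    large-frame = go (argmin H? degH (x , stop x∉C))
      where
      go : (∃ λ y → H y × (∀ {z} → H z → degH y ≤ degH z)) → Frame
      go (r , hr , least) with δ ≤? degH r
      -- Minimum degree `δ` within `H` would give too deep a lobe. Its root is chosen next to an
      -- attachment, which makes that attachment `Out`.
      ... | yes le = contradiction (ℕₚ.m≤n⇒m≤1+n le) (InLobe.d-small L (proj₁ A-nonempty , ap , proj₁ (proj₂ ap) , proj₁ (proj₂ (proj₂ ap)) , hp , Lobe.x∉D L))
        where
        ap = proj₂ A-nonempty
        hp = proj₂ (proj₂ (proj₂ ap))
        L = root-lobe hp (degH≥1 hr) least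
      -- Now `r` has fewer than `δ` neighbours in `H`, so it sees an attachment, and as the root
      -- lies outside the lobe this attachment is `Out`.
      ... | no ¬le = refine-to-frame δ L (ℕₚ.m≤m+n δ _) (degH≥1 hr) (outside (outer r) refl) hr ℕₚ.≤-refl
        where
        L = root-lobe hr (degH≥1 hr) least
        outside : ∀ l → l ≡ outer r → ∃ (InLobe.Out L)
        outside [] eq = contradiction (ℕₚ.≤-trans (outer-length r) (ℕₚ.≤-reflexive (trans (cong (λ l → degH r + length l) (≡-sym eq)) (ℕₚ.+-identityʳ _)))) ¬le
        outside (z ∷ l) eq = z , InLobe.outer⊆Out L hr (Lobe.x∉D L) (subst (z ∈_) eq (here refl))

  frame : Frame
  frame with Finₚ.any? (λ y → H? y ×-dec ¬? (y Fin.≟ x))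
  ... | yes (y , hy , ne) = large-frame y hy ne
  ... | no none = singleton-frame only
    where
    only : ∀ {y} → H y → y ≡ x
    only {y} hy with y Fin.≟ x
    ... | yes eq = eq
    ... | no ne = contradiction (y , hy , ne) none

-- Sums over duplicate-free lists, and paths on at most four vertices.

sumOf : ∀ {X : Set} → (X → ℕ) → List X → ℕ
sumOf φ [] = 0
sumOf φ (x ∷ xs) = φ x + sumOf φ xs

sumOf-mid : ∀ {X : Set} (φ : X → ℕ) xs x ys → sumOf φ (xs ++ x ∷ ys) ≡ φ x + sumOf φ (xs ++ ys)
sumOf-mid φ [] x ys = refl
sumOf-mid φ (y ∷ xs) x ys = trans (cong (φ y +_) (sumOf-mid φ xs x ys)) (lemma (φ y) (φ x) (sumOf φ (xs ++ ys)))
  where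
  lemma : ∀ a b c → a + (b + c) ≡ b + (a + c)
  lemma a b c = solve (a ∷ b ∷ c ∷ [])

∈-drop-mid : ∀ {X : Set} {y z : X} as bs → z ∈ as ++ y ∷ bs → z ≢ y → z ∈ as ++ bs
∈-drop-mid as bs z∈ z≢y with ∈ₚ.∈-++⁻ as z∈
... | inj₁ h = ∈ₚ.∈-++⁺ˡ h
... | inj₂ (here eq) = contradiction eq z≢y
... | inj₂ (there h) = ∈ₚ.∈-++⁺ʳ as h

unique-⊆⇒sum≤ : ∀ {X : Set} (φ : X → ℕ) {xs ys : List X} → Unique xs → (∀ {x} → x ∈ xs → x ∈ ys) → sumOf φ xs ≤ sumOf φ ys
unique-⊆⇒sum≤ φ {[]} _ _ = z≤n
unique-⊆⇒sum≤ φ {x ∷ xs} {ys} (x∉ AllPairs.∷ u) sub with as , bs , refl ← ∈ₚ.∈-∃++ (sub (here refl)) =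
  ℕₚ.≤-trans (ℕₚ.+-monoʳ-≤ (φ x) (unique-⊆⇒sum≤ φ u (λ h → ∈-drop-mid as bs (sub (there h)) (λ eq → All.lookup x∉ h (≡-sym eq)))))
    (ℕₚ.≤-reflexive (≡-sym (sumOf-mid φ as x bs)))

sum≤1⇒unique : ∀ {n} (xs : List (Fin n)) → (∀ z → sumOf (ind z) xs ≤ 1) → Unique xs
sum≤1⇒unique [] _ = AllPairs.[]
sum≤1⇒unique {n} (x ∷ xs) h = All.tabulate (λ { y∈ refl → ℕₚ.<-irrefl refl
    (ℕₚ.≤-trans (s≤s (occurs y∈)) (subst (λ k → k + sumOf (ind x) xs ≤ 1) (ind-refl x) (h x))) })
  AllPairs.∷ sum≤1⇒unique xs (λ z → ℕₚ.≤-trans (ℕₚ.m≤n+m _ (ind z x)) (h z))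
  where
  occurs : ∀ {z : Fin n} {l} → z ∈ l → 1 ≤ sumOf (ind z) l
  occurs {z} {_ ∷ l} (here refl) = ℕₚ.≤-trans (ℕₚ.≤-reflexive (≡-sym (ind-refl z))) (ℕₚ.m≤m+n _ (sumOf (ind z) l))
  occurs {z} {y ∷ l} (there h) = ℕₚ.≤-trans (occurs h) (ℕₚ.m≤n+m _ (ind z y))

unique-mid : ∀ {X : Set} xs {y : X} {ys} → Unique (xs ++ y ∷ ys) → Unique (xs ++ ys) × y ∉ xs ++ ys
unique-mid [] (y∉ AllPairs.∷ u) = u , λ h → All.lookup y∉ h refl
unique-mid (x ∷ xs) {y} {ys} (x∉ AllPairs.∷ u) with unique-mid xs u
... | u′ , y∉ = All.tabulate (λ h → All.lookup x∉ (widen h)) AllPairs.∷ u′ ,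
      λ { (here refl) → All.lookup x∉ (∈ₚ.∈-++⁺ʳ xs (here refl)) refl ; (there h) → y∉ h }
  where
  widen : ∀ {z} → z ∈ xs ++ ys → z ∈ xs ++ y ∷ ys
  widen h with ∈ₚ.∈-++⁻ xs h
  ... | inj₁ h′ = ∈ₚ.∈-++⁺ˡ h′
  ... | inj₂ h′ = ∈ₚ.∈-++⁺ʳ xs (there h′)

module Shapes {n : ℕ} (G : Graph n) where

  open Paths G

  shape₁ : ∀ {a b} (p : Path a b) → len p ≡ 1 → a ≡ b × (∀ f → wt f p ≡ f a)
  shape₁ p eq = go (toL p) (λ f → ≡-sym (wt-toL f p)) (ℕₚ.suc-injective (trans (size-len (toL p)) (trans (wt-toL one p) eq)))
    where
    go : ∀ {a b} {w : (Fin n → ℕ) → ℕ} (q : LPath a b) → (∀ f → w f ≡ wt f (fromL q)) → size q ≡ 0 → a ≡ b × (∀ f → w f ≡ f a)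
    go [ v ]ˡ h _ = refl , h

  shape₂ : ∀ {a b} (p : Path a b) → len p ≡ 2 → a ~ b × (∀ f → wt f p ≡ f a + f b)
  shape₂ p eq = go (toL p) (λ f → ≡-sym (wt-toL f p)) (ℕₚ.suc-injective (trans (size-len (toL p)) (trans (wt-toL one p) eq)))
    where
    go : ∀ {a b} {w : (Fin n → ℕ) → ℕ} (q : LPath a b) → (∀ f → w f ≡ wt f (fromL q)) → size q ≡ 1 → a ~ b × (∀ f → w f ≡ f a + f b)
    go (_ ∷⟨ e ⟩ [ v ]ˡ) h _ = e , h

  shape₃ : ∀ {a b} (p : Path a b) → len p ≡ 3 → ∃ λ w → a ~ w × w ~ b × (∀ f → wt f p ≡ f a + (f w + f b))
  shape₃ p eq = go (toL p) (λ f → ≡-sym (wt-toL f p)) (ℕₚ.suc-injective (trans (size-len (toL p)) (trans (wt-toL one p) eq)))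
    where
    go : ∀ {a b} {w : (Fin n → ℕ) → ℕ} (q : LPath a b) → (∀ f → w f ≡ wt f (fromL q)) → size q ≡ 2 →
         ∃ λ v → a ~ v × v ~ b × (∀ f → w f ≡ f a + (f v + f b))
    go (_ ∷⟨ e ⟩ v ∷⟨ e′ ⟩ [ _ ]ˡ) h _ = v , e , e′ , h

  shape₄ : ∀ {a b} (p : Path a b) → len p ≡ 4 →
           ∃₂ λ v w → a ~ v × v ~ w × w ~ b × (∀ f → wt f p ≡ f a + (f v + (f w + f b)))
  shape₄ p eq = go (toL p) (λ f → ≡-sym (wt-toL f p)) (ℕₚ.suc-injective (trans (size-len (toL p)) (trans (wt-toL one p) eq)))
    where
    go : ∀ {a b} {w : (Fin n → ℕ) → ℕ} (q : LPath a b) → (∀ f → w f ≡ wt f (fromL q)) → size q ≡ 3 →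
         ∃₂ λ u v → a ~ u × u ~ v × v ~ b × (∀ f → w f ≡ f a + (f u + (f v + f b)))
    go (_ ∷⟨ e ⟩ u ∷⟨ e′ ⟩ v ∷⟨ e″ ⟩ [ _ ]ˡ) h _ = u , v , e , e′ , e″ , h

-- Excess of the segments, its budget and its use by cross edges.

module Analysis (S : Setting) (X : OffVertex S) (F : Frames.Frame S X) where

  open Setting S
  open OffVertex X
  open Paths G
  open Walks G
  open LongestCycle S
  open Outside X
  open TwoArcs
  open ThreeArcs
  open Frames S X
  open Frame F
  open Shapes G

  Free : Fin n → Set
  Free z = OnC z × ¬ A z

  lab : Fin n → Fin n
  lab z = proj₁ (info₀ z)

  -- The number of vertices by which the segment of z exceeds the minimum possible order d + 1.
  e : Fin n → ℕ
  e z = proj₂ (info₀ z) ∸ suc d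

  long : ∀ {p q} (g : Seg p q) (rest : Segs q p) → Whole (g ∷ˢ rest) → suc d ≤ len (Seg.body g)
  long g rest w = link-body g rest w (links (Seg.p∈A g) (Seg.q∈A g) (ends-≢ g rest w))

  lab-here : ∀ {p q z} (g : Seg p q) (rest : Segs q p) → Whole (g ∷ˢ rest) → On z (Seg.body g) → lab z ≡ Seg.a g
  lab-here {z = z} g rest w o = cong proj₁ (trans (≡-sym (info≡ w z)) (info-here g rest o))

  len-here : ∀ {p q z} (g : Seg p q) (rest : Segs q p) → Whole (g ∷ˢ rest) → On z (Seg.body g) → len (Seg.body g) ≡ suc d + e z
  len-here {z = z} g rest w o = ≡-sym (trans (cong (λ k → suc d + (k ∸ suc d)) (cong proj₂ (trans (≡-sym (info≡ w z)) (info-here g rest o))))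
    (ℕₚ.m+[n∸m]≡n (long g rest w)))

  on-free : ∀ {p q z} (g : Seg p q) (rest : Segs q p) → Whole (g ∷ˢ rest) → On z (Seg.body g) → Free z
  on-free g rest w o = body⊆C g rest w o , Seg.free g o

  first-on : ∀ {p q} (g : Seg p q) → On (Seg.a g) (Seg.body g)
  first-on g = On-src (Seg.body g)

  disjoint : ∀ {p q p′ q′ z} (g : Seg p q) (ss : Segs q p′) (g′ : Seg p′ q′) (ts : Segs q′ p) → Whole (g ∷ˢ (ss ++ˢ (g′ ∷ˢ ts))) →
             On z (Seg.body g) → ¬ On z (Seg.body g′)
  disjoint {p} {p′ = p′} {z = z} g ss g′ ts w o o′ = farkas-⊥ (f p + wtˢ f ss + f p′ + wtˢ f ts) (le ⊞ occ o ⊞ occ o′)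
      (lemma (f p) (wt f (Seg.body g)) (wtˢ f ss) (f p′) (wt f (Seg.body g′)) (wtˢ f ts))
    where
    f = ind z
    le : f p + wt f (Seg.body g) + (wtˢ f ss + (f p′ + wt f (Seg.body g′) + wtˢ f ts)) ≤ 1
    le = subst (λ k → f p + wt f (Seg.body g) + k ≤ 1) (wtˢ-++ f ss (g′ ∷ˢ ts)) (once w z)
    lemma : ∀ p i s p′ i′ t → p + i + (s + (p′ + i′ + t)) + (1 + 1) ≡ 1 + (i + i′) + suc (p + s + p′ + t)
    lemma p i s p′ i′ t = solve (p ∷ i ∷ s ∷ p′ ∷ i′ ∷ t ∷ [])

  in-rest : ∀ {p q z} (g : Seg p q) (rest : Segs q p) → Whole (g ∷ˢ rest) → Free z → ¬ On z (Seg.body g) → AtSeg z rest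
  in-rest {p} {z = z} g rest w (o , ¬a) ¬on = go (sum≥1 (ind z p + wt (ind z) (Seg.body g)) (occurs w o))
    where
    fin : z ∈ heads rest ⊎ AtSeg z rest → AtSeg z rest
    fin (inj₁ h) = contradiction (heads⊆A rest h) ¬a
    fin (inj₂ s) = s
    go : 1 ≤ ind z p + wt (ind z) (Seg.body g) ⊎ 1 ≤ wtˢ (ind z) rest → AtSeg z rest
    go (inj₂ h) = fin (locate rest h)
    go (inj₁ h) with sum≥1 (ind z p) h
    ... | inj₁ h₁ = contradiction (subst A (≡-sym (ind-≡ h₁)) (Seg.p∈A g)) ¬a
    ... | inj₂ h₂ = contradiction (mkOn h₂) ¬on

  lab-later : ∀ {p q p′ q′ z} (g : Seg p q) (ss : Segs q p′) (g′ : Seg p′ q′) (ts : Segs q′ p) → Whole (g ∷ˢ (ss ++ˢ (g′ ∷ˢ ts))) →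
              On z (Seg.body g′) → lab z ≡ Seg.a g′
  lab-later g ss g′ ts w o = lab-here g′ (ts ++ˢ (g ∷ˢ ss)) (rotate (g ∷ˢ ss) (g′ ∷ˢ ts) w) o

  -- Labels are first vertices and different segments are disjoint, so a label belongs to one
  -- segment only.
  same-seg : ∀ {p q z} (g : Seg p q) (rest : Segs q p) → Whole (g ∷ˢ rest) → Free z → lab z ≡ Seg.a g → On z (Seg.body g)
  same-seg {p} {q} {z} g rest w fz eq with On? z (Seg.body g)
  ... | yes o = o
  ... | no ¬o = go rest w (in-rest g rest w fz ¬o)
    where
    go : ∀ (rest : Segs q p) → Whole (g ∷ˢ rest) → AtSeg z rest → On z (Seg.body g)
    go _ w (atSeg pre g′ post refl on) = contradiction
      (subst (λ t → On t (Seg.body g′)) (trans (≡-sym (lab-later g pre g′ post w on)) eq) (first-on g′))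
      (disjoint g pre g′ post w (first-on g))

  firsts-++ : ∀ {p q r} (ss : Segs p q) (ts : Segs q r) → firsts (ss ++ˢ ts) ≡ firsts ss ++ firsts ts
  firsts-++ []ˢ ts = refl
  firsts-++ (g ∷ˢ ss) ts = cong (Seg.a g ∷_) (firsts-++ ss ts)

  firsts-unique : ∀ {p} (ss : Segs p p) → Whole ss → Unique (firsts ss)
  firsts-unique ss w = sum≤1⇒unique (firsts ss) (λ z → ℕₚ.≤-trans (sum≤ (ind z) ss) (once w z))
    where
    sum≤ : ∀ f {p q} (ss : Segs p q) → sumOf f (firsts ss) ≤ wtˢ f ss
    sum≤ f []ˢ = z≤n
    sum≤ f (_∷ˢ_ {p} g ss) = ℕₚ.≤-trans (wt≥src f (Seg.body g)) (ℕₚ.m≤n+m _ (f p)) ⊞ sum≤ f ss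

  record FirstOf {p : Fin n} (ss : Segs p p) (r : Fin n) : Set where
    constructor firstOf
    field
      {q q′} : Fin n
      g : Seg q q′
      rest : Segs q′ q
      whole : Whole (g ∷ˢ rest)
      first : r ≡ Seg.a g

  first-of : ∀ {p q r} (ss : Segs p q) (ts : Segs q p) → Whole (ss ++ˢ ts) → r ∈ firsts ss → FirstOf (ss ++ˢ ts) r
  first-of (g ∷ˢ ss) ts w (here eq) = firstOf g (ss ++ˢ ts) w eq
  first-of {p} {q} {r} (g ∷ˢ ss) ts w (there h) = shifted (first-of ss (ts ++ˢ (g ∷ˢ []ˢ)) (shift g ss ts w) h)
    where
    shifted : FirstOf (ss ++ˢ (ts ++ˢ (g ∷ˢ []ˢ))) r → FirstOf ((g ∷ˢ ss) ++ˢ ts) r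
    shifted (firstOf g′ rest w′ eq) = firstOf g′ rest w′ eq

  first-props : ∀ {p r} (ss : Segs p p) → Whole ss → r ∈ firsts ss → Free r × lab r ≡ r
  first-props ss w h = go (first-of ss []ˢ (subst Whole (≡-sym ([]ˢ-++ ss)) w) h)
    where
    go : ∀ {r} → FirstOf (ss ++ˢ []ˢ) r → Free r × lab r ≡ r
    go (firstOf g rest w refl) = on-free g rest w (first-on g) , lab-here g rest w (first-on g)

  lab∈firsts : ∀ {p z} (ss : Segs p p) → Whole ss → Free z → lab z ∈ firsts ss
  lab∈firsts {p} {z} ss w (o , ¬a) = go ss w (free⇒seg w o ¬a)
    where
    go : ∀ (ss : Segs p p) → Whole ss → AtSeg z ss → lab z ∈ firsts ss
    go _ w (atSeg pre g post refl on) = subst₂ _∈_ (≡-sym (lab-here g (post ++ˢ pre) (rotate pre (g ∷ˢ post) w) on))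
      (≡-sym (firsts-++ pre (g ∷ˢ post))) (∈ₚ.∈-++⁺ʳ (firsts pre) (here refl))

  e-lab : ∀ {z} → Free z → e (lab z) ≡ e z
  e-lab {z} (o , ¬a) = go (root-at o ¬a)
    where
    go : RootSeg z → e (lab z) ≡ e z
    go (rootSeg g rest on w) = ℕₚ.+-cancelˡ-≡ (suc d) _ _ (trans (≡-sym (len-here g rest w
      (subst (λ t → On t (Seg.body g)) (≡-sym (lab-here g rest w on)) (first-on g)))) (len-here g rest w on))

  -- A segment and the vertex of `A` before it have 1 + (1 + d + e) vertices together.
  excess-sum : ∀ {p q} (ss : Segs p q) (ts : Segs q p) → Whole (ss ++ˢ ts) → sumOf e (firsts ss) + (2 + d) * count ss ≡ wtˢ one ss
  excess-sum []ˢ ts w = ℕₚ.*-zeroʳ (2 + d)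
  excess-sum (g ∷ˢ ss) ts w = trans (lemma (e (Seg.a g)) (sumOf e (firsts ss)) d (count ss))
      (cong₂ (λ i j → 1 + i + j) (≡-sym (len-here g (ss ++ˢ ts) w (first-on g))) (excess-sum ss (ts ++ˢ (g ∷ˢ []ˢ)) (shift g ss ts w)))
    where
    lemma : ∀ a s d m → a + s + (2 + d) * (1 + m) ≡ 1 + (1 + d + a) + (s + (2 + d) * m)
    lemma a s d m = solve (a ∷ s ∷ d ∷ m ∷ [])

  Apart : Fin n → Fin n → Set
  Apart u v = lab u ≢ lab v

  mass : ∀ zs → (∀ {z} → z ∈ zs → Free z) → AllPairs Apart zs → sumOf e zs + (2 + d) * a ≤ c
  mass zs free apart = go (root-head (proj₂ A-nonempty))
    where
    labs-sum : ∀ zs → (∀ {z} → z ∈ zs → Free z) → sumOf e (map lab zs) ≡ sumOf e zs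
    labs-sum [] _ = refl
    labs-sum (z ∷ zs) free = cong₂ _+_ (e-lab (free (here refl))) (labs-sum zs (λ h → free (there h)))
    go : ∀ {p} → RootHead p → sumOf e zs + (2 + d) * a ≤ c
    go (rootHead g rest w) = ℕₚ.≤-trans (ℕₚ.+-monoˡ-≤ ((2 + d) * a) part) (ℕₚ.≤-reflexive whole≡)
      where
      ss = g ∷ˢ rest
      part : sumOf e zs ≤ sumOf e (firsts ss)
      part = ℕₚ.≤-trans (ℕₚ.≤-reflexive (≡-sym (labs-sum zs free))) (unique-⊆⇒sum≤ e (AllPairsₚ.map⁺ apart)
        (λ h → let z , z∈ , eq = ∈ₚ.∈-map⁻ lab h in subst (_∈ firsts ss) (≡-sym eq) (lab∈firsts ss w (free z∈))))
      whole≡ : sumOf e (firsts ss) + (2 + d) * a ≡ c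
      whole≡ = trans (cong (λ k → sumOf e (firsts ss) + (2 + d) * k) (≡-sym (count≡ w)))
        (trans (excess-sum ss []ˢ (subst Whole (≡-sym ([]ˢ-++ ss)) w)) (trans (covers w one) len≡))

  -- The cycle has at least `(2 + d) * a` vertices plus the excesses, and at most 2δ + 3 ≤ 2a + 2d +
  -- 3. With `a * d` on the left subtraction is avoided; as a ≥ 3, at most 3 - d is left for the
  -- excesses.
  budget : ∀ zs → (∀ {z} → z ∈ zs → Free z) → AllPairs Apart zs → sumOf e zs + a * d ≤ 3 + 2 * d
  budget zs free apart = farkas 0 (mass zs free apart ⊞ c≤ ⊞ δ≤ ⊞ δ≤) (lemma (sumOf e zs) a d c δ)
    where
    lemma : ∀ s a d c δ → 3 + 2 * d + (s + (2 + d) * a + (c + (δ + δ))) ≡ s + a * d + (c + (2 * δ + 3 + (a + d + (a + d)))) + 0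
    lemma s a d c δ = solve (s ∷ a ∷ d ∷ c ∷ δ ∷ [])

  record Two (u v : Fin n) : Set where
    constructor mkTwo
    field
      {p q p′ q′} : Fin n
      g : Seg p q
      ss₁ : Segs q p′
      g′ : Seg p′ q′
      ss₂ : Segs q′ p
      whole : Whole (g ∷ˢ (ss₁ ++ˢ (g′ ∷ˢ ss₂)))
      on : On u (Seg.body g)
      on′ : On v (Seg.body g′)

  two : ∀ {u v} → Free u → Free v → Apart u v → Two u v
  two {u} {v} (o , ¬a) fv ne = start (root-at o ¬a)
    where
    go : ∀ {p q} (g : Seg p q) (rest : Segs q p) → Whole (g ∷ˢ rest) → On u (Seg.body g) → AtSeg v rest → Two u v
    go g _ w on (atSeg pre g′ post refl on′) = mkTwo g pre g′ post w on on′
    start : RootSeg u → Two u v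
    start (rootSeg g rest on w) = go g rest w on (in-rest g rest w fv (λ h → ne (trans (lab-here g rest w on) (≡-sym (lab-here g rest w h)))))

  heads-≢ : ∀ {p q} {l r} (g : Seg p l) (ss : Segs l q) (g′ : Seg q r) (ts : Segs r p) → Whole (g ∷ˢ (ss ++ˢ (g′ ∷ˢ ts))) → p ≢ q
  heads-≢ {p} g ss g′ ts w refl = farkas-⊥ (wt f (Seg.body g) + wtˢ f ss + wt f (Seg.body g′) + wtˢ f ts) le
      (lemma (wt f (Seg.body g)) (wtˢ f ss) (wt f (Seg.body g′)) (wtˢ f ts))
    where
    f = ind p
    le : 1 + wt f (Seg.body g) + (wtˢ f ss + (1 + wt f (Seg.body g′) + wtˢ f ts)) ≤ 1
    le = subst (λ i → i + wt f (Seg.body g) + (wtˢ f ss + (i + wt f (Seg.body g′) + wtˢ f ts)) ≤ 1) (ind-refl p)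
      (subst (λ k → f p + wt f (Seg.body g) + k ≤ 1) (wtˢ-++ f ss (g′ ∷ˢ ts)) (once w p))
    lemma : ∀ i s i′ t → 1 + i + (s + (1 + i′ + t)) ≡ 1 + suc (i + s + i′ + t)
    lemma i s i′ t = solve (i ∷ s ∷ i′ ∷ t ∷ [])

  tails-≢ : ∀ {p q p′ q′} (g : Seg p q) (ss : Segs q p′) (g′ : Seg p′ q′) (ts : Segs q′ p) → Whole (g ∷ˢ (ss ++ˢ (g′ ∷ˢ ts))) → q ≢ q′
  tails-≢ {q = q} g []ˢ g′ ts w eq = ends-≢ g′ (ts ++ˢ (g ∷ˢ []ˢ)) (rotate (g ∷ˢ []ˢ) (g′ ∷ˢ ts) w) eq
  tails-≢ g (h ∷ˢ ss) g′ []ˢ w eq = heads-≢ g []ˢ h (ss ++ˢ (g′ ∷ˢ []ˢ)) w (≡-sym eq)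
  tails-≢ g (h ∷ˢ ss) g′ (h′ ∷ˢ ts) w eq = heads-≢ h (ss ++ˢ (g′ ∷ˢ []ˢ)) h′ (ts ++ˢ (g ∷ˢ []ˢ))
    (subst (λ s → Whole (h ∷ˢ s)) (trans (++ˢ-assoc ss (g′ ∷ˢ (h′ ∷ˢ ts)) (g ∷ˢ []ˢ)) (≡-sym (++ˢ-assoc ss (g′ ∷ˢ []ˢ) (h′ ∷ˢ (ts ++ˢ (g ∷ˢ []ˢ))))))
      (rotate (g ∷ˢ []ˢ) ((h ∷ˢ ss) ++ˢ (g′ ∷ˢ (h′ ∷ˢ ts))) w)) eq

  -- `u` is the i-th vertex from the front and the j-th from the back, so i + j exceeds the order of
  -- the body by one.
  record Pos {b₁ b₂ : Fin n} (body : Path b₁ b₂) (u : Fin n) (i j : ℕ) : Set where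
    constructor mkPos
    field
      pre : Path b₁ u
      suf : Path u b₂
      sum : ∀ f → wt f pre + wt f suf ≡ wt f body + f u
      pre-len : len pre ≡ i
      suf-len : len suf ≡ j

  on⇒pos : ∀ {b₁ b₂ u} (body : Path b₁ b₂) → On u body → ∃₂ λ i j → Pos body u i j × i + j ≡ suc (len body)
  on⇒pos body o with pre , suf , eq ← split body o = len pre , len suf , mkPos pre suf eq refl refl , trans (eq one) (ℕₚ.+-comm _ 1)

  pos-bound : ∀ {p q p′ q′ u v i j i′ j′} (g : Seg p q) (ss₁ : Segs q p′) (g′ : Seg p′ q′) (ss₂ : Segs q′ p) →
              Whole (g ∷ˢ (ss₁ ++ˢ (g′ ∷ˢ ss₂))) → (B : Bridge u v) → Pos (Seg.body g) u i j → Pos (Seg.body g′) v i′ j′ →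
              suc d + wtᵇ one B + 2 ≤ i + i′ × suc d + wtᵇ one B + 2 ≤ j + j′
  pos-bound g ss₁ g′ ss₂ w B (mkPos pre suf eq refl refl) (mkPos pre′ suf′ eq′ refl refl) =
    crossing-bound g ss₁ g′ ss₂ w (links (Seg.p∈A g) (Seg.p∈A g′) (heads-≢ g ss₁ g′ ss₂ w)) (links (Seg.q∈A g) (Seg.q∈A g′) (tails-≢ g ss₁ g′ ss₂ w))
      B pre suf pre′ suf′ eq eq′

  -- Adding the two bounds of `crossing-bound` turns positions into orders of segments: with b inner
  -- vertices on the bridge, 2(d + 3 + b) ≤ (d + 2 + e u) + (d + 2 + e v).
  cost : ∀ {u v} → Free u → Free v → Apart u v → (B : Bridge u v) → 2 + 2 * wtᵇ one B ≤ e u + e v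
  cost {u} {v} fu fv ne B = go (two fu fv ne)
    where
    go : Two u v → 2 + 2 * wtᵇ one B ≤ e u + e v
    go (mkTwo g ss₁ g′ ss₂ w on on′) with i , j , ps , eq ← on⇒pos (Seg.body g) on | i′ , j′ , ps′ , eq′ ← on⇒pos (Seg.body g′) on′
      = final (trans eq (cong suc (len-here g _ w on))) (trans eq′ (cong suc (len-here g′ _ (rotate (g ∷ˢ ss₁) (g′ ∷ˢ ss₂) w) on′)))
          (pos-bound g ss₁ g′ ss₂ w B ps ps′)
      where
      final : i + j ≡ suc (suc d + e u) → i′ + j′ ≡ suc (suc d + e v) → suc d + wtᵇ one B + 2 ≤ i + i′ × suc d + wtᵇ one B + 2 ≤ j + j′ →
              2 + 2 * wtᵇ one B ≤ e u + e v
      final eq eq′ (h , h′) = farkas 0 (h ⊞ h′ ⊞ ℕₚ.≤-reflexive eq ⊞ ℕₚ.≤-reflexive eq′) (lemma d (wtᵇ one B) i j i′ j′ (e u) (e v))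
        where
        lemma : ∀ d b i j i′ j′ u v → u + v + (1 + d + b + 2 + (1 + d + b + 2 + (i + j + (i′ + j′)))) ≡
                                      2 + 2 * b + (i + i′ + (j + j′ + (1 + (1 + d + u) + (1 + (1 + d + v))))) + 0
        lemma d b i j i′ j′ u v = solve (d ∷ b ∷ i ∷ j ∷ i′ ∷ j′ ∷ u ∷ v ∷ [])

  3d≤ad : 3 * d ≤ a * d
  3d≤ad = ℕₚ.*-monoˡ-≤ d a≥3

  pair-budget : ∀ {u v} → Free u → Free v → Apart u v → e u + e v + a * d ≤ 3 + 2 * d
  pair-budget {u} {v} fu fv ne = ℕₚ.≤-trans (ℕₚ.≤-reflexive (lemma (e u) (e v) (a * d)))
      (budget (u ∷ v ∷ []) (λ { (here refl) → fu ; (there (here refl)) → fv }) ((ne All.∷ All.[]) AllPairs.∷ All.[] AllPairs.∷ AllPairs.[]))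
    where
    lemma : ∀ u v t → u + v + t ≡ u + (v + 0) + t
    lemma u v t = solve (u ∷ v ∷ t ∷ [])

  -- A bridge with an inner vertex costs at least 4, and the budget is at most 3.
  bridge-edge : ∀ {u v} → Free u → Free v → Apart u v → Bridge u v → u ~ v
  bridge-edge fu fv ne (edge e) = e
  bridge-edge {u} {v} fu fv ne B@(off _ p _ _ _) = ⊥-elim (farkas-⊥ d (cost fu fv ne B ⊞ pair-budget fu fv ne ⊞ 3d≤ad ⊞ len≥1 p ⊞ len≥1 p)
      (lemma (len p) (e u) (e v) (a * d) d))
    where
    lemma : ∀ l u v t d → 2 + 2 * l + (u + v + t + (3 * d + (1 + 1))) ≡ u + v + (3 + 2 * d + (t + (l + l))) + suc d
    lemma l u v t d = solve (l ∷ u ∷ v ∷ t ∷ d ∷ [])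

  record Edge : Set where
    constructor mkEdge
    field
      {u v} : Fin n
      fu : Free u
      fv : Free v
      apart : Apart u v
      adj : u ~ v

  mk-edge : ∀ {u v} → Free u → Free v → Apart u v → Bridge u v → Edge
  mk-edge fu fv ne B = mkEdge fu fv ne (bridge-edge fu fv ne B)

  rest-firsts : ∀ {p q} (g : Seg p q) (rest : Segs q p) → Whole (g ∷ˢ rest) →
                Unique (firsts rest) × (∀ {r} → r ∈ firsts rest → Free r × lab r ≡ r × r ≢ Seg.a g) × suc (length (firsts rest)) ≡ a
  rest-firsts g rest w with firsts-unique (g ∷ˢ rest) w
  ... | a∉ AllPairs.∷ u = u ,
    (λ h → let fr , eq = first-props (g ∷ˢ rest) w (there h) in fr , eq , λ eq′ → All.lookup a∉ h (≡-sym eq′)) ,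
    trans (cong suc (length-firsts rest)) (count≡ w)

  other-firsts : ∀ {p q p′ q′} (g : Seg p q) (ss₁ : Segs q p′) (g′ : Seg p′ q′) (ss₂ : Segs q′ p) (w : Whole (g ∷ˢ (ss₁ ++ˢ (g′ ∷ˢ ss₂)))) →
    Σ[ rs ∈ List (Fin n) ] Unique rs × (∀ {r} → r ∈ rs → Free r × lab r ≡ r × r ≢ Seg.a g × r ≢ Seg.a g′) × suc (suc (length rs)) ≡ a
  other-firsts g ss₁ g′ ss₂ w with rest-firsts g (ss₁ ++ˢ (g′ ∷ˢ ss₂)) w
  ... | u , props , num with unique-mid (firsts ss₁) (subst Unique (firsts-++ ss₁ (g′ ∷ˢ ss₂)) u)
  ... | u′ , a′∉ = firsts ss₁ ++ firsts ss₂ , u′ ,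
    (λ {r} h → let fr , eq , ne = props (subst (r ∈_) (≡-sym (firsts-++ ss₁ (g′ ∷ˢ ss₂))) (wide h)) in fr , eq , ne , λ { refl → a′∉ h }) ,
    trans (cong suc (trans (cong suc (Listₚ.length-++ (firsts ss₁))) (trans (≡-sym (ℕₚ.+-suc (length (firsts ss₁)) _))
      (trans (≡-sym (Listₚ.length-++ (firsts ss₁))) (cong length (≡-sym (firsts-++ ss₁ (g′ ∷ˢ ss₂)))))))) num
    where
    wide : ∀ {r} → r ∈ firsts ss₁ ++ firsts ss₂ → r ∈ firsts ss₁ ++ Seg.a g′ ∷ firsts ss₂
    wide h with ∈ₚ.∈-++⁻ (firsts ss₁) h
    ... | inj₁ h′ = ∈ₚ.∈-++⁺ˡ h′
    ... | inj₂ h′ = ∈ₚ.∈-++⁺ʳ (firsts ss₁) (there h′)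

  free∉heads : ∀ {p z} (ss : Segs p p) → Free z → z ∉ heads ss
  free∉heads ss (_ , ¬a) h = ¬a (heads⊆A ss h)

  record Joined (l : Fin n → Fin n) (avoid : Fin n → Set) : Set where
    constructor mkJoined
    field
      {u v} : Fin n
      fu : Free u
      fv : Free v
      u-ok : ¬ avoid u
      v-ok : ¬ avoid v
      differ : l u ≢ l v
      bridge : Bridge u v

  -- Besides `H`, the cut `A` can leave at most a - 2 separated classes, so a - 1 representatives
  -- force a bridge.
  join-all : ∀ {p} (ss : Segs p p) → Whole ss → (l : Fin n → Fin n) → ∀ rs → Unique rs →
             (∀ {r} → r ∈ rs → Free r × l r ≡ r) → a ≤ suc (length rs) → 1 ≤ length rs → Joined l (λ _ → ⊥)
  join-all ss w l rs u props le one≤ = convert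
      (crossing (heads ss) (A⇒head w) (λ h → proj₁ (heads⊆A ss h)) l rs u
        (λ h → let fr , eq = props h in proj₁ fr , free∉heads ss fr , eq) one≤
        (ℕₚ.≤-trans (ℕₚ.≤-reflexive (trans (length-heads ss) (count≡ w))) le))
    where
    convert : Cross (heads ss) (A⇒head w) l → Joined l (λ _ → ⊥)
    convert (cross uC vC u∉ v∉ ne B) = mkJoined (uC , λ h → u∉ (A⇒head w h)) (vC , λ h → v∉ (A⇒head w h)) id id ne B

  -- With `z` added to the cut one more class is tolerated, hence one more representative is
  -- required.
  join-avoiding : ∀ {p z} (ss : Segs p p) → Whole ss → Free z → (l : Fin n → Fin n) → ∀ rs → Unique rs →
                  (∀ {r} → r ∈ rs → Free r × r ≢ z × l r ≡ r) → a ≤ length rs → 1 ≤ length rs → Joined l (_≡ z)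
  join-avoiding {z = z} ss w fz l rs u props le one≤ = convert
      (crossing (z ∷ heads ss) (λ h → there (A⇒head w h)) l⊆C l rs u reps one≤
        (s≤s (ℕₚ.≤-trans (ℕₚ.≤-reflexive (trans (length-heads ss) (count≡ w))) le)))
    where
    l⊆C : ∀ {y} → y ∈ z ∷ heads ss → OnC y
    l⊆C (here refl) = proj₁ fz
    l⊆C (there h) = proj₁ (heads⊆A ss h)
    reps : ∀ {r} → r ∈ rs → OnC r × r ∉ z ∷ heads ss × l r ≡ r
    reps h with props h
    ... | fr , ne , eq = proj₁ fr , (λ { (here eq′) → ne eq′ ; (there h′) → free∉heads ss fr h′ }) , eq
    convert : Cross (z ∷ heads ss) (λ h → there (A⇒head w h)) l → Joined l (_≡ z)
    convert (cross uC vC u∉ v∉ ne B) = mkJoined (uC , λ h → u∉ (there (A⇒head w h))) (vC , λ h → v∉ (there (A⇒head w h)))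
      (λ eq → u∉ (here eq)) (λ eq → v∉ (here eq)) ne B

  -- Cross edges are not confined to one pair of segments: merge the pair and cut at A.
  edge-outside-pair : ∀ {z z′} → Free z → Free z′ → Apart z z′ → Σ[ E ∈ Edge ] Apart (Edge.v E) z × Apart (Edge.v E) z′
  edge-outside-pair {z} {z′} fz fz′ ne = start (two fz fz′ ne)
    where
    Goal = Σ[ E ∈ Edge ] Apart (Edge.v E) z × Apart (Edge.v E) z′
    merge : Fin n → Fin n
    merge y = choose (y Fin.≟ lab z′) (lab z) y
    orient : Joined (λ y → merge (lab y)) (λ _ → ⊥) → Goal
    orient (mkJoined {u} {v} fu fv _ _ differ B) = pick (lab v Fin.≟ lab z) (lab v Fin.≟ lab z′) (lab u Fin.≟ lab z) (lab u Fin.≟ lab z′)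
      where
      ap : Apart u v
      ap eq = differ (cong merge eq)
      to-z : ∀ {y} → lab y ≡ lab z ⊎ lab y ≡ lab z′ → merge (lab y) ≡ lab z
      to-z (inj₁ eq) = trans (choose-no (lab _ Fin.≟ lab z′) (λ eq′ → ne (trans (≡-sym eq) eq′))) eq
      to-z (inj₂ eq) = choose-yes (lab _ Fin.≟ lab z′) eq
      forward : Apart v z → Apart v z′ → Goal
      forward h h′ = mk-edge fu fv ap B , h , h′
      backward : Apart u z → Apart u z′ → Goal
      backward h h′ = mk-edge fv fu (λ eq → ap (≡-sym eq)) (Bridge-sym B) , h , h′
      both : lab u ≡ lab z ⊎ lab u ≡ lab z′ → lab v ≡ lab z ⊎ lab v ≡ lab z′ → Goal
      both h h′ = contradiction (trans (to-z h) (≡-sym (to-z h′))) differ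
      pick : Dec (lab v ≡ lab z) → Dec (lab v ≡ lab z′) → Dec (lab u ≡ lab z) → Dec (lab u ≡ lab z′) → Goal
      pick (no h) (no h′) _ _ = forward h h′
      pick _ _ (no h) (no h′) = backward h h′
      pick (yes h) _ (yes k) _ = both (inj₁ k) (inj₁ h)
      pick (yes h) _ _ (yes k) = both (inj₂ k) (inj₁ h)
      pick _ (yes h) (yes k) _ = both (inj₁ k) (inj₂ h)
      pick _ (yes h) _ (yes k) = both (inj₂ k) (inj₂ h)
    start : Two z z′ → Goal
    start (mkTwo g ss₁ g′ ss₂ w on on′) = go (other-firsts g ss₁ g′ ss₂ w)
      where
      lz : lab z ≡ Seg.a g
      lz = lab-here g _ w on
      lz′ : lab z′ ≡ Seg.a g′
      lz′ = lab-later g ss₁ g′ ss₂ w on′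
      fg = on-free g _ w (first-on g)
      lg : lab (Seg.a g) ≡ Seg.a g
      lg = lab-here g _ w (first-on g)
      go : (Σ[ rs ∈ List (Fin n) ] Unique rs × (∀ {r} → r ∈ rs → Free r × lab r ≡ r × r ≢ Seg.a g × r ≢ Seg.a g′) × suc (suc (length rs)) ≡ a) → Goal
      -- The two merged segments share the representative `Seg.a g`; with the other a - 2 segments
      -- this is the number that `join-all` asks for.
      go (rs , u , props , num) = orient (join-all _ w _ (Seg.a g ∷ rs)
          (All.tabulate (λ h eq → proj₁ (proj₂ (proj₂ (props h))) (≡-sym eq)) AllPairs.∷ u) reps (ℕₚ.≤-reflexive (≡-sym num)) (s≤s z≤n))
        where
        reps : ∀ {r} → r ∈ Seg.a g ∷ rs → Free r × merge (lab r) ≡ r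
        reps (here refl) = fg , trans (choose-no (lab _ Fin.≟ lab z′) (λ eq → ne (trans lz (trans (≡-sym lg) eq)))) lg
        reps (there h) with props h
        ... | fr , eq , _ , ne′ = fr , trans (choose-no (lab _ Fin.≟ lab z′) (λ eq′ → ne′ (trans (≡-sym eq) (trans eq′ lz′)))) eq

  some-edge : Edge
  some-edge = start (root-head (proj₂ A-nonempty))
    where
    go : ∀ {p q} (g : Seg p q) (rest : Segs q p) → Whole (g ∷ˢ rest) → Edge
    go g []ˢ w = contradiction (ℕₚ.≤-trans a≥3 (ℕₚ.≤-reflexive (≡-sym (count≡ w)))) λ { (s≤s ()) }
    go g (h ∷ˢ rest) w = proj₁ (edge-outside-pair (on-free g _ w (first-on g)) (on-free h _ (rotate (g ∷ˢ []ˢ) (h ∷ˢ rest) w) (first-on h))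
      (λ eq → disjoint g []ˢ h rest w (first-on g) (subst (λ t → On t (Seg.body h))
        (trans (≡-sym (lab-later g []ˢ h rest w (first-on h))) (trans (≡-sym eq) (lab-here g _ w (first-on g)))) (first-on h))))
    start : ∀ {p} → RootHead p → Edge
    start (rootHead g rest w) = go g rest w

  -- Cross edges do not all meet at one vertex of a segment with another vertex w′: cut at A together with that vertex.
  edge-missing : ∀ {w w′} → Free w → Free w′ → lab w′ ≡ lab w → w′ ≢ w → Σ[ E ∈ Edge ] Edge.u E ≢ w × Edge.v E ≢ w
  edge-missing {w} {w′} fw fw′ same ne = start (root-at (proj₁ fw) (proj₂ fw))
    where
    Goal = Σ[ E ∈ Edge ] Edge.u E ≢ w × Edge.v E ≢ w
    name : Fin n → Fin n
    name y = choose (y Fin.≟ lab w) w′ y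
    convert : Joined (λ y → name (lab y)) (_≡ w) → Goal
    convert (mkJoined fu fv u≢ v≢ differ B) = mk-edge fu fv (λ eq → differ (cong name eq)) B , u≢ , v≢
    start : RootSeg w → Goal
    start (rootSeg g rest on whole) = go (rest-firsts g rest whole)
      where
      lw : lab w ≡ Seg.a g
      lw = lab-here g rest whole on
      go : Unique (firsts rest) × (∀ {r} → r ∈ firsts rest → Free r × lab r ≡ r × r ≢ Seg.a g) × suc (length (firsts rest)) ≡ a → Goal
      go (u , props , num) = convert (join-avoiding (g ∷ˢ rest) whole fw _ (w′ ∷ firsts rest) (All.tabulate fresh AllPairs.∷ u) reps
          (ℕₚ.≤-reflexive (≡-sym num)) (s≤s z≤n))
        where
        fresh : ∀ {r} → r ∈ firsts rest → w′ ≢ r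
        fresh h refl = let _ , eq , ne′ = props h in ne′ (trans (≡-sym eq) (trans same lw))
        reps : ∀ {r} → r ∈ w′ ∷ firsts rest → Free r × r ≢ w × name (lab r) ≡ r
        reps (here refl) = fw′ , ne , choose-yes (lab w′ Fin.≟ lab w) same
        reps (there h) with props h
        ... | fr , eq , ne′ = fr , (λ { refl → ne′ (trans (≡-sym eq) lw) }) ,
              trans (choose-no (lab _ Fin.≟ lab w) (λ eq′ → ne′ (trans (≡-sym eq) (trans eq′ lw)))) eq

  split-name : (w s t z′ : Fin n) → Fin n → Fin n
  split-name w s t z′ y = choose (y Fin.≟ s) s (choose (lab y Fin.≟ lab w) t (choose (lab y Fin.≟ lab z′) t (lab y)))

  -- Cut at A and w; only s has to be torn off, the segment of z′ may hang together with t.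
  join-split : ∀ {w s t z′} → Free w → Free s → Free t → Free z′ → lab s ≡ lab w → lab t ≡ lab w → s ≢ w → t ≢ w → s ≢ t → Apart w z′ →
               Joined (split-name w s t z′) (_≡ w)
  join-split {w} {s} {t} {z′} fw fs ft fz′ ls lt s≢w t≢w s≢t ne = start (two fw fz′ ne)
    where
    start : Two w z′ → Joined (split-name w s t z′) (_≡ w)
    start (mkTwo g ss₁ g′ ss₂ whole on on′) = go (other-firsts g ss₁ g′ ss₂ whole)
      where
      lw : lab w ≡ Seg.a g
      lw = lab-here g _ whole on
      lz′ : lab z′ ≡ Seg.a g′
      lz′ = lab-later g ss₁ g′ ss₂ whole on′
      go : (Σ[ rs ∈ List (Fin n) ] Unique rs × (∀ {r} → r ∈ rs → Free r × lab r ≡ r × r ≢ Seg.a g × r ≢ Seg.a g′) × suc (suc (length rs)) ≡ a) →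
           Joined (split-name w s t z′) (_≡ w)
      go (rs , u , props , num) = join-avoiding _ whole fw _ (t ∷ s ∷ rs)
          (((λ eq → s≢t (≡-sym eq)) All.∷ All.tabulate (fresh lt)) AllPairs.∷ All.tabulate (fresh ls) AllPairs.∷ u) reps
          (ℕₚ.≤-reflexive (≡-sym num)) (s≤s z≤n)
        where
        fresh : ∀ {y r} → lab y ≡ lab w → r ∈ rs → y ≢ r
        fresh ly h refl = let _ , eq , ne′ , _ = props h in ne′ (trans (≡-sym eq) (trans ly lw))
        reps : ∀ {r} → r ∈ t ∷ s ∷ rs → Free r × r ≢ w × split-name w s t z′ r ≡ r
        reps (here refl) = ft , t≢w , trans (choose-no (t Fin.≟ s) (λ eq → s≢t (≡-sym eq))) (choose-yes (lab t Fin.≟ lab w) lt)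
        reps (there (here refl)) = fs , s≢w , choose-yes (s Fin.≟ s) refl
        reps (there (there h)) with props h
        ... | fr , eq , ne′ , ne″ = fr , (λ { refl → ne′ (trans (≡-sym eq) lw) }) ,
              trans (choose-no (_ Fin.≟ s) (λ eq′ → fresh ls h (≡-sym eq′)))
              (trans (choose-no (lab _ Fin.≟ lab w) (λ eq′ → ne′ (trans (≡-sym eq) (trans eq′ lw))))
              (trans (choose-no (lab _ Fin.≟ lab z′) (λ eq′ → ne″ (trans (≡-sym eq) (trans eq′ lz′)))) eq))

  record Three (z₀ z₁ z₂ : Fin n) : Set where
    constructor mkThree
    field
      {p₀ q₀ p₁ q₁ p₂ q₂} : Fin n
      g₀ : Seg p₀ q₀
      s₀ : Segs q₀ p₁
      g₁ : Seg p₁ q₁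
      s₁ : Segs q₁ p₂
      g₂ : Seg p₂ q₂
      s₂ : Segs q₂ p₀
      whole : Whole (g₀ ∷ˢ (s₀ ++ˢ (g₁ ∷ˢ (s₁ ++ˢ (g₂ ∷ˢ s₂)))))
      on₀ : On z₀ (Seg.body g₀)
      on₁ : On z₁ (Seg.body g₁)
      on₂ : On z₂ (Seg.body g₂)

  three : ∀ {z₀ z₁ z₂} → Free z₀ → Free z₁ → Free z₂ → Apart z₀ z₁ → Apart z₀ z₂ → Apart z₁ z₂ → Three z₀ z₁ z₂ ⊎ Three z₀ z₂ z₁
  three {z₀} {z₁} {z₂} f₀ f₁ f₂ ne₁ ne₂ ne₁₂ = start (two f₀ f₁ ne₁)
    where
    Goal = Three z₀ z₁ z₂ ⊎ Three z₀ z₂ z₁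
    start : Two z₀ z₁ → Goal
    start (mkTwo {p} {p′ = p′} g ss₁ h ss₂ w on on′) = place (sum≥1 (ind z₂ p + wt (ind z₂) (Seg.body g)) (occurs w (proj₁ f₂)))
      where
      early : ∀ {p q p′ q′} (g : Seg p q) (ss₁ : Segs q p′) (h : Seg p′ q′) (ss₂ : Segs q′ p) → Whole (g ∷ˢ (ss₁ ++ˢ (h ∷ˢ ss₂))) →
              On z₀ (Seg.body g) → On z₁ (Seg.body h) → AtSeg z₂ ss₁ → Goal
      early g _ h ss₂ w on on′ (atSeg pre g₂ post refl on₂) =
        inj₂ (mkThree g pre g₂ post h ss₂ (subst (λ s → Whole (g ∷ˢ s)) (++ˢ-assoc pre (g₂ ∷ˢ post) (h ∷ˢ ss₂)) w) on on₂ on′)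
      late : ∀ {p q p′ q′} (g : Seg p q) (ss₁ : Segs q p′) (h : Seg p′ q′) (ss₂ : Segs q′ p) → Whole (g ∷ˢ (ss₁ ++ˢ (h ∷ˢ ss₂))) →
             On z₀ (Seg.body g) → On z₁ (Seg.body h) → AtSeg z₂ ss₂ → Goal
      late g ss₁ h _ w on on′ (atSeg pre g₂ post refl on₂) = inj₁ (mkThree g ss₁ h pre g₂ post w on on′ on₂)
      at-head : ∀ {q r} {ss : Segs q r} → z₂ ∈ heads ss → Goal
      at-head {ss = ss} hd = contradiction (heads⊆A ss hd) (proj₂ f₂)
      in-g : On z₂ (Seg.body g) → Goal
      in-g o = contradiction (trans (lab-here g _ w on) (≡-sym (lab-here g _ w o))) ne₂
      in-h : On z₂ (Seg.body h) → Goal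
      in-h o = contradiction (trans (lab-later g ss₁ h ss₂ w on′) (≡-sym (lab-later g ss₁ h ss₂ w o))) ne₁₂
      place₁ : 1 ≤ wtˢ (ind z₂) ss₁ ⊎ 1 ≤ wtˢ (ind z₂) (h ∷ˢ ss₂) → Goal
      place₁ (inj₁ o) = [ at-head {ss = ss₁} , early g ss₁ h ss₂ w on on′ ]′ (locate ss₁ o)
      place₁ (inj₂ o) with sum≥1 (ind z₂ (p′) + wt (ind z₂) (Seg.body h)) o
      ... | inj₂ o₂ = [ at-head {ss = ss₂} , late g ss₁ h ss₂ w on on′ ]′ (locate ss₂ o₂)
      ... | inj₁ o₁ with sum≥1 (ind z₂ (p′)) o₁
      ... | inj₁ o₃ = contradiction (subst A (≡-sym (ind-≡ o₃)) (Seg.p∈A h)) (proj₂ f₂)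
      ... | inj₂ o₃ = in-h (mkOn o₃)
      place : 1 ≤ ind z₂ p + wt (ind z₂) (Seg.body g) ⊎ 1 ≤ wtˢ (ind z₂) (ss₁ ++ˢ (h ∷ˢ ss₂)) → Goal
      place (inj₂ o) = place₁ (sum≥1 (wtˢ (ind z₂) ss₁) (subst (1 ≤_) (wtˢ-++ (ind z₂) ss₁ (h ∷ˢ ss₂)) o))
      place (inj₁ o) with sum≥1 (ind z₂ p) o
      ... | inj₁ o₁ = contradiction (subst A (≡-sym (ind-≡ o₁)) (Seg.p∈A g)) (proj₂ f₂)
      ... | inj₂ o₂ = in-g (mkOn o₂)

  -- Exchanges speak of arcs, decompositions of segments with the vertex before them; here each such
  -- vertex moves to the end of the preceding arc. `φ` and `ψ` allow the bodies to be replaced by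
  -- explicit vertices.
  ring₂ : ∀ {p q p′ q′} (g : Seg p q) (ss₁ : Segs q p′) (g′ : Seg p′ q′) (ss₂ : Segs q′ p) → Whole (g ∷ˢ (ss₁ ++ˢ (g′ ∷ˢ ss₂))) →
          ∀ {φ ψ : (Fin n → ℕ) → ℕ} → (∀ f → wt f (Seg.body g) ≡ φ f) → (∀ f → wt f (Seg.body g′) ≡ ψ f) →
          ∀ f → φ f + wt f (arc ss₁) + ψ f + wt f (arc ss₂) ≡ total f
  ring₂ {p} {q} {p′} {q′} g ss₁ g′ ss₂ w {φ} {ψ} eq eq′ f =
      trans (cong₂ (λ i j → i + wt f (arc ss₁) + j + wt f (arc ss₂)) (≡-sym (eq f)) (≡-sym (eq′ f)))
      (trans (cong₂ (λ i j → wt f (Seg.body g) + i + wt f (Seg.body g′) + j) (wt-arc f ss₁) (wt-arc f ss₂))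
      (trans (lemma (wt f (Seg.body g)) (wtˢ f ss₁) (f p′) (wt f (Seg.body g′)) (wtˢ f ss₂) (f p))
      (trans (cong (f p + wt f (Seg.body g) +_) (≡-sym (wtˢ-++ f ss₁ (g′ ∷ˢ ss₂)))) (covers w f))))
    where
    lemma : ∀ i s p′ j t p → i + (s + p′) + j + (t + p) ≡ p + i + (s + (p′ + j + t))
    lemma i s p′ j t p = solve (i ∷ s ∷ p′ ∷ j ∷ t ∷ p ∷ [])

  ring₃ : ∀ {p₀ q₀ p₁ q₁ p₂ q₂} (g₀ : Seg p₀ q₀) (s₀ : Segs q₀ p₁) (g₁ : Seg p₁ q₁) (s₁ : Segs q₁ p₂) (g₂ : Seg p₂ q₂) (s₂ : Segs q₂ p₀) →
          Whole (g₀ ∷ˢ (s₀ ++ˢ (g₁ ∷ˢ (s₁ ++ˢ (g₂ ∷ˢ s₂))))) → ∀ {φ₀ φ₁ φ₂ : (Fin n → ℕ) → ℕ} →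
          (∀ f → wt f (Seg.body g₀) ≡ φ₀ f) → (∀ f → wt f (Seg.body g₁) ≡ φ₁ f) → (∀ f → wt f (Seg.body g₂) ≡ φ₂ f) →
          ∀ f → φ₀ f + wt f (arc s₀) + φ₁ f + wt f (arc s₁) + φ₂ f + wt f (arc s₂) ≡ total f
  ring₃ {p₀} {q₀} {p₁} {q₁} {p₂} g₀ s₀ g₁ s₁ g₂ s₂ w {φ₀} {φ₁} {φ₂} eq₀ eq₁ eq₂ f =
      trans (cong₂ (λ j k → φ₀ f + i₀ + φ₁ f + j + φ₂ f + k) (wt-arc f s₁) (wt-arc f s₂))
      (trans (lemma₁ (φ₀ f) i₀ (φ₁ f) (wtˢ f s₁) (f p₂) (φ₂ f) (wtˢ f s₂) (f p₀))
      (trans (cong (λ k → φ₀ f + i₀ + φ₁ f + (k + f p₀)) tail)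
      (trans (cong (φ₀ f + i₀ + φ₁ f +_) (≡-sym (wt-arc f (s₁ ++ˢ (g₂ ∷ˢ s₂)))))
        (ring₂ g₀ s₀ g₁ (s₁ ++ˢ (g₂ ∷ˢ s₂)) w {φ₀} {φ₁} eq₀ eq₁ f))))
    where
    i₀ = wt f (arc s₀)
    tail : wtˢ f s₁ + (f p₂ + φ₂ f + wtˢ f s₂) ≡ wtˢ f (s₁ ++ˢ (g₂ ∷ˢ s₂))
    tail = trans (cong (λ k → wtˢ f s₁ + (f p₂ + k + wtˢ f s₂)) (≡-sym (eq₂ f))) (≡-sym (wtˢ-++ f s₁ (g₂ ∷ˢ s₂)))
    lemma₁ : ∀ a b c s p d t q → a + b + c + (s + p) + d + (t + q) ≡ a + b + c + (s + (p + d + t) + q)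
    lemma₁ a b c s p d t q = solve (a ∷ b ∷ c ∷ s ∷ p ∷ d ∷ t ∷ q ∷ [])

  pos-first : ∀ {b₁ b₂ k} (p : Path b₁ b₂) → len p ≡ k → Pos p b₁ 1 k
  pos-first p eq = mkPos [ _ ] p (λ f → ℕₚ.+-comm (f _) _) refl eq

  pos-last : ∀ {b₁ b₂ k} (p : Path b₁ b₂) → len p ≡ k → Pos p b₂ k 1
  pos-last p eq = mkPos p [ _ ] (λ f → refl) eq refl

  on₃ : ∀ {b₁ b₂ z w} (p : Path b₁ b₂) → (∀ f → wt f p ≡ f b₁ + (f w + f b₂)) → On z p → z ≡ b₁ ⊎ z ≡ w ⊎ z ≡ b₂
  on₃ {b₁} {b₂} {z} {w} p eq o with sum≥1 (ind z b₁) (subst (1 ≤_) (eq (ind z)) (occ o))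
  ... | inj₁ h = inj₁ (ind-≡ h)
  ... | inj₂ h with sum≥1 (ind z w) h
  ... | inj₁ h′ = inj₂ (inj₁ (ind-≡ h′))
  ... | inj₂ h′ = inj₂ (inj₂ (ind-≡ h′))

  on₂ : ∀ {b₁ b₂ z} (p : Path b₁ b₂) → (∀ f → wt f p ≡ f b₁ + f b₂) → On z p → z ≡ b₁ ⊎ z ≡ b₂
  on₂ {b₁} {b₂} {z} p eq o with sum≥1 (ind z b₁) (subst (1 ≤_) (eq (ind z)) (occ o))
  ... | inj₁ h = inj₁ (ind-≡ h)
  ... | inj₂ h = inj₂ (ind-≡ h)

  pos₃ : ∀ {b₁ b₂ z w} (p : Path b₁ b₂) → b₁ ~ w → w ~ b₂ → (∀ f → wt f p ≡ f b₁ + (f w + f b₂)) → On z p →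
         (z ≡ b₁ × Pos p z 1 3) ⊎ (z ≡ w × Pos p z 2 2) ⊎ (z ≡ b₂ × Pos p z 3 1)
  pos₃ {b₁} {b₂} {z} {w} p e e′ eq o with on₃ p eq o
  ... | inj₁ refl = inj₁ (refl , pos-first p (eq one))
  ... | inj₂ (inj₂ refl) = inj₂ (inj₂ (refl , pos-last p (eq one)))
  ... | inj₂ (inj₁ refl) = inj₂ (inj₁ (refl , mkPos ([ b₁ ] ⊕⟨ e ⟩ [ w ]) ([ w ] ⊕⟨ e′ ⟩ [ b₂ ])
        (λ f → trans (lemma (f b₁) (f w) (f b₂)) (cong (_+ f w) (≡-sym (eq f)))) refl refl))
    where
    lemma : ∀ a w b → a + w + (w + b) ≡ a + (w + b) + w
    lemma a w b = solve (a ∷ w ∷ b ∷ [])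

  pos₄ : ∀ {b₁ b₂ z v w} (p : Path b₁ b₂) → b₁ ~ v → v ~ w → w ~ b₂ → (∀ f → wt f p ≡ f b₁ + (f v + (f w + f b₂))) → On z p →
         (z ≡ b₁ × Pos p z 1 4) ⊎ (z ≡ v × Pos p z 2 3) ⊎ (z ≡ w × Pos p z 3 2) ⊎ (z ≡ b₂ × Pos p z 4 1)
  pos₄ {b₁} {b₂} {z} {v} {w} p e₁ e₂ e₃ eq o with sum≥1 (ind z b₁) (subst (1 ≤_) (eq (ind z)) (occ o))
  ... | inj₁ h with refl ← ind-≡ {z = z} {b₁} h = inj₁ (refl , pos-first p (eq one))
  ... | inj₂ h with sum≥1 (ind z v) h
  ... | inj₁ h′ with refl ← ind-≡ {z = z} {v} h′ = inj₂ (inj₁ (refl , mkPos ([ b₁ ] ⊕⟨ e₁ ⟩ [ v ]) ([ v ] ⊕⟨ e₂ ⟩ [ w ] ⊕⟨ e₃ ⟩ [ b₂ ])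
        (λ f → trans (lemma (f b₁) (f v) (f w) (f b₂)) (cong (_+ f v) (≡-sym (eq f)))) refl refl))
    where
    lemma : ∀ a v w b → a + v + (v + (w + b)) ≡ a + (v + (w + b)) + v
    lemma a v w b = solve (a ∷ v ∷ w ∷ b ∷ [])
  ... | inj₂ h′ with sum≥1 (ind z w) h′
  ... | inj₂ h″ with refl ← ind-≡ {z = z} {b₂} h″ = inj₂ (inj₂ (inj₂ (refl , pos-last p (eq one))))
  ... | inj₁ h″ with refl ← ind-≡ {z = z} {w} h″ = inj₂ (inj₂ (inj₁ (refl , mkPos ([ b₁ ] ⊕⟨ e₁ ⟩ [ v ] ⊕⟨ e₂ ⟩ [ w ]) ([ w ] ⊕⟨ e₃ ⟩ [ b₂ ])
        (λ f → trans (lemma (f b₁) (f v) (f w) (f b₂)) (cong (_+ f w) (≡-sym (eq f)))) refl refl)))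
    where
    lemma : ∀ a v w b → a + (v + w) + (w + b) ≡ a + (v + (w + b)) + w
    lemma a v w b = solve (a ∷ v ∷ w ∷ b ∷ [])

  single : ∀ {p q v} (g : Seg p q) → len (Seg.body g) ≡ 1 → On v (Seg.body g) → p ~ v × v ~ q × (∀ f → wt f (Seg.body g) ≡ f v) × Pos (Seg.body g) v 1 1
  single {v = v} (seg {a₁} body enter leave _ _ _) eq o with shape₁ body eq
  ... | refl , h with refl ← ind-≡ {z = v} {a₁} (subst (1 ≤_) (h (ind v)) (occ o)) = enter , leave , h , pos-first body eq

  -- A second segment, around `v`, seen from the fixed segment `g`. `Before` and `After` add a third
  -- one and tell on which side of `g′` it lies, because the rerouted cycle depends on that.
  record Outer {p q : Fin n} (g : Seg p q) (v : Fin n) : Set where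
    constructor mkOuter
    field
      {p′ q′} : Fin n
      pre : Segs q p′
      g′ : Seg p′ q′
      post : Segs q′ p
      whole : Whole (g ∷ˢ (pre ++ˢ (g′ ∷ˢ post)))
      on : On v (Seg.body g′)
    len-g′ : len (Seg.body g′) ≡ suc d + e v
    len-g′ = len-here g′ (post ++ˢ (g ∷ˢ pre)) (rotate (g ∷ˢ pre) (g′ ∷ˢ post) whole) on

    record Before (z : Fin n) : Set where
      constructor mkBefore
      field
        {p₁ q₁} : Fin n
        s₀ : Segs q p₁
        h : Seg p₁ q₁
        s₁ : Segs q₁ p′
        whole₃ : Whole (g ∷ˢ (s₀ ++ˢ (h ∷ˢ (s₁ ++ˢ (g′ ∷ˢ post)))))
        onʰ : On z (Seg.body h)
      len-h : len (Seg.body h) ≡ suc d + e z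
      len-h = len-here h _ (rotate (g ∷ˢ s₀) (h ∷ˢ (s₁ ++ˢ (g′ ∷ˢ post))) whole₃) onʰ

    record After (z : Fin n) : Set where
      constructor mkAfter
      field
        {p₂ q₂} : Fin n
        s₁ : Segs q′ p₂
        h : Seg p₂ q₂
        s₂ : Segs q₂ p
        whole₃ : Whole (g ∷ˢ (pre ++ˢ (g′ ∷ˢ (s₁ ++ˢ (h ∷ˢ s₂)))))
        onʰ : On z (Seg.body h)
      len-h : len (Seg.body h) ≡ suc d + e z
      len-h = len-here h (s₂ ++ˢ (g ∷ˢ (pre ++ˢ (g′ ∷ˢ s₁)))) (rotate (g ∷ˢ (pre ++ˢ (g′ ∷ˢ s₁))) (h ∷ˢ s₂)
        (subst (λ s → Whole (g ∷ˢ s)) (≡-sym (++ˢ-assoc pre (g′ ∷ˢ s₁) (h ∷ˢ s₂))) whole₃)) onʰ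

    third : ∀ {z} → Free z → ¬ On z (Seg.body g) → ¬ On z (Seg.body g′) → Before z ⊎ After z
    third {z} fz ¬g ¬g′ = place (sum≥1 (ind z p + wt (ind z) (Seg.body g)) (occurs whole (proj₁ fz)))
      where
      not-A : ∀ {y} → A y → ¬ 1 ≤ ind z y
      not-A ay h = proj₂ fz (subst A (≡-sym (ind-≡ h)) ay)
      from-seg : ∀ {y y′} (k : Seg y y′) → ¬ On z (Seg.body k) → ¬ 1 ≤ ind z y + wt (ind z) (Seg.body k)
      from-seg {y} k ¬k h = [ not-A (Seg.p∈A k) , (λ h′ → ¬k (mkOn h′)) ]′ (sum≥1 (ind z y) h)
      before : ∀ {pre : Segs q p′} → Whole (g ∷ˢ (pre ++ˢ (g′ ∷ˢ post))) → AtSeg z pre → Before z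
      before w (atSeg s₀ h s₁ refl o) = mkBefore s₀ h s₁ (subst (λ s → Whole (g ∷ˢ s)) (++ˢ-assoc s₀ (h ∷ˢ s₁) (g′ ∷ˢ post)) w) o
      after : ∀ {post : Segs q′ p} → Whole (g ∷ˢ (pre ++ˢ (g′ ∷ˢ post))) → AtSeg z post → After z
      after w (atSeg s₁ h s₂ refl o) = mkAfter s₁ h s₂ w o
      place₂ : 1 ≤ ind z p′ + wt (ind z) (Seg.body g′) ⊎ 1 ≤ wtˢ (ind z) post → Before z ⊎ After z
      place₂ (inj₁ h) = contradiction h (from-seg g′ ¬g′)
      place₂ (inj₂ h) = [ (λ hd → contradiction (heads⊆A post hd) (proj₂ fz)) , (λ s → inj₂ (after whole s)) ]′ (locate post h)
      place₁ : 1 ≤ wtˢ (ind z) pre ⊎ 1 ≤ wtˢ (ind z) (g′ ∷ˢ post) → Before z ⊎ After z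
      place₁ (inj₁ h) = [ (λ hd → contradiction (heads⊆A pre hd) (proj₂ fz)) , (λ s → inj₁ (before whole s)) ]′ (locate pre h)
      place₁ (inj₂ h) = place₂ (sum≥1 (ind z p′ + wt (ind z) (Seg.body g′)) h)
      place : 1 ≤ ind z p + wt (ind z) (Seg.body g) ⊎ 1 ≤ wtˢ (ind z) (pre ++ˢ (g′ ∷ˢ post)) → Before z ⊎ After z
      place (inj₁ h) = contradiction h (from-seg g ¬g)
      place (inj₂ h) = place₁ (sum≥1 (wtˢ (ind z) pre) (subst (1 ≤_) (wtˢ-++ (ind z) pre (g′ ∷ˢ post)) h))

  -- A segment of excess at least two leads to a contradiction.

  module Center {p q : Fin n} (g : Seg p q) (rest : Segs q p) (W : Whole (g ∷ˢ rest)) where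

    body : Path (Seg.a g) (Seg.b g)
    body = Seg.body g

    z₀ : Fin n
    z₀ = Seg.a g

    f₀ : Free z₀
    f₀ = on-free g rest W (first-on g)

    lab₀ : lab z₀ ≡ z₀
    lab₀ = lab-here g rest W (first-on g)

    len-body : len body ≡ suc d + e z₀
    len-body = len-here g rest W (first-on g)

    outside : ∀ {v} → Free v → ¬ On v body → Apart z₀ v
    outside fv ¬o eq = ¬o (same-seg g rest W fv (trans (≡-sym eq) lab₀))

    apart⇒¬on : ∀ {v} → Apart v z₀ → ¬ On v body
    apart⇒¬on ap o = ap (trans (lab-here g rest W o) (≡-sym lab₀))

    outer-at : ∀ {v} → Free v → ¬ On v body → Outer g v
    outer-at {v} fv ¬o = go rest W (in-rest g rest W fv ¬o)
      where
      go : ∀ (rest : Segs q p) → Whole (g ∷ˢ rest) → AtSeg v rest → Outer g v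
      go _ w (atSeg pre g′ post refl on) = mkOuter pre g′ post w on

    apart-outer : ∀ {v v′} (O : Outer g v) → Free v′ → Apart v′ v → ¬ On v′ (Seg.body (Outer.g′ O))
    apart-outer (mkOuter pre g′ post w on) fv′ ap o = ap (trans (lab-later g pre g′ post w o) (≡-sym (lab-later g pre g′ post w on)))

    same-outer : ∀ {v v′} (O : Outer g v) → Free v′ → lab v′ ≡ lab v → On v′ (Seg.body (Outer.g′ O))
    same-outer (mkOuter pre g′ post w on) fv′ eq = same-seg g′ (post ++ˢ (g ∷ˢ pre)) (rotate (g ∷ˢ pre) (g′ ∷ˢ post) w) fv′ (trans eq (lab-later g pre g′ post w on))

    -- An edge between two other segments would cost another 2, which makes 4 in total.
    center-edge : 2 ≤ e z₀ → ∀ {u v} → Free u → Free v → Apart u v → u ~ v → (On u body × ¬ On v body) ⊎ (On v body × ¬ On u body)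
    center-edge 2≤ {u} {v} fu fv ap uv with On? u body | On? v body
    ... | yes o | yes o′ = contradiction (trans (lab-here g rest W o) (≡-sym (lab-here g rest W o′))) ap
    ... | yes o | no ¬o′ = inj₁ (o , ¬o′)
    ... | no ¬o | yes o′ = inj₂ (o′ , ¬o)
    ... | no ¬o | no ¬o′ = ⊥-elim (farkas-⊥ d (2≤ ⊞ cost fu fv ap (edge uv) ⊞ budget (z₀ ∷ u ∷ v ∷ [])
          (λ { (here refl) → f₀ ; (there (here refl)) → fu ; (there (there (here refl))) → fv })
          ((outside fu ¬o All.∷ outside fv ¬o′ All.∷ All.[]) AllPairs.∷ (ap All.∷ All.[]) AllPairs.∷ All.[] AllPairs.∷ AllPairs.[]) ⊞ 3d≤ad)
          (lemma (e z₀) (e u) (e v) d (a * d)))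
      where
      lemma : ∀ z u v d t → 2 + (2 + 0 + (z + (u + (v + 0)) + t + 3 * d)) ≡ z + (u + v + (3 + 2 * d + t)) + suc d
      lemma z u v d t = solve (z ∷ u ∷ v ∷ d ∷ t ∷ [])

    bound₁ : ∀ {k u v i j} → d ≡ k → u ~ v → Pos body u i j → (O : Outer g v) → len (Seg.body (Outer.g′ O)) ≡ 1 → suc k + 0 + 2 ≤ i + 1 × suc k + 0 + 2 ≤ j + 1
    bound₁ refl uv ps (mkOuter pre g′ post w on) eq = pos-bound g pre g′ post w (edge uv) ps (proj₂ (proj₂ (proj₂ (single g′ eq on))))

    bound₂ : ∀ {k u v i j} → d ≡ k → u ~ v → Pos body u i j → (O : Outer g v) → len (Seg.body (Outer.g′ O)) ≡ 2 →
             (v ≡ Seg.a (Outer.g′ O) × suc k + 0 + 2 ≤ i + 1 × suc k + 0 + 2 ≤ j + 2) ⊎ (v ≡ Seg.b (Outer.g′ O) × suc k + 0 + 2 ≤ i + 2 × suc k + 0 + 2 ≤ j + 1)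
    bound₂ refl uv ps (mkOuter pre g′ post w on) eq with shape₂ (Seg.body g′) eq
    ... | ab , sum with on₂ (Seg.body g′) sum on
    ... | inj₁ refl = inj₁ (refl , pos-bound g pre g′ post w (edge uv) ps (pos-first (Seg.body g′) eq))
    ... | inj₂ refl = inj₂ (refl , pos-bound g pre g′ post w (edge uv) ps (pos-last (Seg.body g′) eq))

    pair-bound : ∀ {v} → Free v → ¬ On v body → e z₀ + e v + a * d ≤ 3 + 2 * d
    pair-bound fv ¬o = pair-budget f₀ fv (outside fv ¬o)

  zero-excess : ∀ {d ez ev t} → d ≡ 0 → ez ≡ 3 → ez + ev + t ≤ 3 + 2 * d → ev ≡ 0
  zero-excess {ev = ev} refl refl (s≤s (s≤s (s≤s h))) = ℕₚ.m+n≡0⇒m≡0 ev (ℕₚ.n≤0⇒n≡0 h)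

  unit-excess : ∀ {d ez ev t} → d ≡ 0 → ez ≡ 2 → ez + ev + t ≤ 3 + 2 * d → ev ≡ 0 ⊎ ev ≡ 1
  unit-excess {ev = zero} refl refl _ = inj₁ refl
  unit-excess {ev = suc zero} refl refl _ = inj₂ refl
  unit-excess {ev = suc (suc _)} refl refl (s≤s (s≤s (s≤s ())))

  third-excess : ∀ {d ez ev ew t} → d ≡ 0 → ez ≡ 2 → ev ≡ 1 → ez + (ev + (ew + 0)) + t ≤ 3 + 2 * d → ew ≡ 0
  third-excess {ew = ew} {t} refl refl refl (s≤s (s≤s (s≤s h))) = ℕₚ.m+n≡0⇒m≡0 ew (ℕₚ.m+n≡0⇒m≡0 (ew + 0) (ℕₚ.n≤0⇒n≡0 h))

  no-excess : ∀ {d ez ev t} → d ≡ 1 → ez ≡ 2 → 3 * d ≤ t → ez + ev + t ≤ 3 + 2 * d → ev ≡ 0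
  no-excess {ev = ev} {t} refl refl h h′ = ℕₚ.n≤0⇒n≡0 (farkas 0 (h ⊞ h′) (lemma ev t))
    where
    lemma : ∀ v t → 0 + (3 + (2 + v + t)) ≡ v + (t + 5) + 0
    lemma v t = solve (v ∷ t ∷ [])

  on-member : ∀ {b₁ b₂ z} (p : Path b₁ b₂) r s → wt (ind z) p ≡ r + (ind z z + s) → On z p
  on-member {z = z} p r s eq = mkOn (ℕₚ.≤-trans (ℕₚ.≤-reflexive (≡-sym (ind-refl z)))
    (ℕₚ.≤-trans (ℕₚ.m≤m+n _ s) (ℕₚ.≤-trans (ℕₚ.m≤n+m _ r) (ℕₚ.≤-reflexive (≡-sym eq)))))

  module _ {p q : Fin n} (g : Seg p q) (rest : Segs q p) (W : Whole (g ∷ˢ rest)) where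

    open Center g rest W

    Target : Fin n → Set
    Target u = ∃ λ v → Free v × ¬ On v body × u ~ v

    -- The center has four vertices and exhausts the budget, so all other segments have one vertex,
    -- and by position only `w₂` and `w₃` carry cross edges. Deleting either of them still leaves an
    -- edge at the other, and the two edges lengthen the cycle however their ends are placed.
    case-four : d ≡ 0 → e z₀ ≡ 3 → ⊥
    case-four d≡0 e≡3 = go (shape₄ body (trans len-body (cong₂ (λ i j → suc i + j) d≡0 e≡3)))
      where
      go : (∃₂ λ w₂ w₃ → Seg.a g ~ w₂ × w₂ ~ w₃ × w₃ ~ Seg.b g × (∀ f → wt f body ≡ f (Seg.a g) + (f w₂ + (f w₃ + f (Seg.b g))))) → ⊥
      go (w₂ , w₃ , e₁ , e₂ , e₃ , sum) = finish upper lower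
        where
        none : ∀ {v} → Free v → ¬ On v body → e v ≡ 0
        none fv ¬o = zero-excess d≡0 e≡3 (pair-bound fv ¬o)
        one-long : ∀ {v} (O : Outer g v) → Free v → ¬ On v body → len (Seg.body (Outer.g′ O)) ≡ 1
        one-long O fv ¬o = trans (Outer.len-g′ O) (cong₂ (λ i j → suc i + j) d≡0 (none fv ¬o))
        resolve : ∀ {u v} → On u body → Free v → ¬ On v body → u ~ v → u ≡ w₂ ⊎ u ≡ w₃
        resolve {u} {v} o fv ¬o uv = pick (pos₄ body e₁ e₂ e₃ sum o)
          where
          O = outer-at fv ¬o
          bd : ∀ {i j} → Pos body u i j → 3 ≤ i + 1 × 3 ≤ j + 1
          bd ps = bound₁ d≡0 uv ps O (one-long O fv ¬o)
          pick : (u ≡ Seg.a g × Pos body u 1 4) ⊎ (u ≡ w₂ × Pos body u 2 3) ⊎ (u ≡ w₃ × Pos body u 3 2) ⊎ (u ≡ Seg.b g × Pos body u 4 1) → u ≡ w₂ ⊎ u ≡ w₃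
          pick (inj₁ (_ , ps)) = case proj₁ (bd ps) of λ { (s≤s (s≤s ())) }
          pick (inj₂ (inj₁ (eq , _))) = inj₁ eq
          pick (inj₂ (inj₂ (inj₁ (eq , _)))) = inj₂ eq
          pick (inj₂ (inj₂ (inj₂ (_ , ps)))) = case proj₂ (bd ps) of λ { (s≤s (s≤s ())) }
        on₂′ : On w₂ body
        on₂′ = on-member body (ind w₂ (Seg.a g)) _ (sum (ind w₂))
        on₃′ : On w₃ body
        on₃′ = on-member body (ind w₃ (Seg.a g) + ind w₃ w₂) _ (trans (sum (ind w₃)) (≡-sym (ℕₚ.+-assoc (ind w₃ (Seg.a g)) _ _)))
        edge-at : ∀ w w′ → On w body → Seg.a g ≢ w → (∀ {u} → u ≡ w₂ ⊎ u ≡ w₃ → u ≢ w → u ≡ w′) → Target w′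
        edge-at w w′ ow a≢w other = from (edge-missing (on-free g rest W ow) f₀ (trans lab₀ (≡-sym (lab-here g rest W ow))) a≢w)
          where
          target : ∀ {u v} → On u body → Free v → ¬ On v body → u ~ v → u ≢ w → Target w′
          target {v = v} o fv ¬o uv u≢ = v , fv , ¬o , subst (_~ v) (other (resolve o fv ¬o uv) u≢) uv
          from : Σ[ E ∈ Edge ] Edge.u E ≢ w × Edge.v E ≢ w → Target w′
          from (mkEdge fu fv ap uv , u≢ , v≢) =
            [ (λ (o , ¬o) → target o fv ¬o uv u≢) , (λ (o , ¬o) → target o fu ¬o (~-sym uv) v≢) ]′
            (center-edge (ℕₚ.≤-trans (s≤s (s≤s z≤n)) (ℕₚ.≤-reflexive (≡-sym e≡3))) fu fv ap uv)
        a≢w₃ : Seg.a g ≢ w₃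
        a≢w₃ refl = farkas-⊥ (ind w₃ w₂ + ind w₃ (Seg.b g)) (ℕₚ.≤-trans (ℕₚ.≤-reflexive (≡-sym (sum (ind w₃)))) (ℕₚ.≤-trans (ℕₚ.≤-trans (ℕₚ.m≤n+m _ (ind w₃ p)) (ℕₚ.m≤m+n _ _)) (once W w₃)))
          (trans (cong (λ k → k + (ind w₃ w₂ + (k + ind w₃ (Seg.b g)))) (ind-refl w₃)) (lemma (ind w₃ w₂) (ind w₃ (Seg.b g))))
          where
          lemma : ∀ i j → 1 + (i + (1 + j)) ≡ 1 + (1 + (i + j))
          lemma i j = solve (i ∷ j ∷ [])
        upper : Target w₃
        upper = edge-at w₂ w₃ on₂′ (~⇒≢ e₁) (λ h ne → [ (λ eq → contradiction eq ne) , id ]′ h)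
        lower : Target w₂
        lower = edge-at w₃ w₂ on₃′ a≢w₃ (λ h ne → [ id , (λ eq → contradiction eq ne) ]′ h)
        finish : Target w₃ → Target w₂ → ⊥
        finish (v , fv , ¬ov , w₃v) (v′ , fv′ , ¬ov′ , w₂v′) = compare (lab v′ Fin.≟ lab v)
          where
          O = outer-at fv ¬ov
          open Outer O
          sv = single g′ (one-long O fv ¬ov) on
          compare : Dec (lab v′ ≡ lab v) → ⊥
          compare (yes eq) = both-inner (arc pre) (arc post) (Seg.enter g) e₁ e₃ (Seg.leave g) (subst (w₂ ~_) v′≡v w₂v′) w₃v
              (A⇒Link (Seg.p∈A g′) (Seg.q∈A g′)) (ring₂ g pre g′ post whole sum (proj₁ (proj₂ (proj₂ sv))))
            where
            v′≡v : v′ ≡ v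
            v′≡v = ind-≡ (subst (1 ≤_) (proj₁ (proj₂ (proj₂ sv)) (ind v′)) (occ (same-outer O fv′ eq)))
          compare (no ne) = [ before , after ]′ (third fv′ ¬ov′ (apart-outer O fv′ ne))
            where
            before : Before v′ → ⊥
            before B@(mkBefore s₀ h s₁ w₃′ onʰ) = outer-inner (arc s₀) (arc s₁) (arc post) (Seg.enter g) e₁ e₃ (Seg.leave g)
                (~-sym (proj₁ sh)) (~-sym (proj₁ sv)) w₂v′ w₃v (A⇒Link (Seg.q∈A h) (Seg.q∈A g′))
                (ring₃ g s₀ h s₁ g′ post w₃′ sum (proj₁ (proj₂ (proj₂ sh))) (proj₁ (proj₂ (proj₂ sv))))
              where
              sh = single h (trans (Before.len-h B) (cong₂ (λ i j → suc i + j) d≡0 (none fv′ ¬ov′))) onʰ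
            after : After v′ → ⊥
            after B@(mkAfter s₁ h s₂ w₃′ onʰ) = inner-outer (arc pre) (arc s₁) (arc s₂) (Seg.enter g) e₁ e₃ (Seg.leave g)
                (proj₁ (proj₂ sv)) (~-sym (proj₁ sh)) w₃v w₂v′ (A⇒Link (Seg.p∈A g′) (Seg.q∈A h))
                (ring₃ g pre g′ s₁ h s₂ w₃′ sum (proj₁ (proj₂ (proj₂ sv))) (proj₁ (proj₂ (proj₂ sh))))
              where
              sh = single h (trans (After.len-h B) (cong₂ (λ i j → suc i + j) d≡0 (none fv′ ¬ov′))) onʰ

    -- Edges to one-vertex segments all start at the middle vertex `w`. Some cross edge avoids `w`,
    -- so it leads to a segment on two vertices, the only other one with positive excess; the module
    -- `Special` refutes this.
    case-three : d ≡ 0 → e z₀ ≡ 2 → ⊥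
    case-three d≡0 e≡2 = go (shape₃ body (trans len-body (cong₂ (λ i j → suc i + j) d≡0 e≡2)))
      where
      go : (∃ λ w → Seg.a g ~ w × w ~ Seg.b g × (∀ f → wt f body ≡ f (Seg.a g) + (f w + f (Seg.b g)))) → ⊥
      go (w , e₁ , e₂ , sum) = start (edge-missing fw f₀ (trans lab₀ (≡-sym (lab-here g rest W ow))) (~⇒≢ e₁))
        where
        w₁ = Seg.a g
        w₃ = Seg.b g
        ow : On w body
        ow = on-member body (ind w w₁) _ (sum (ind w))
        fw : Free w
        fw = on-free g rest W ow
        lw : ∀ {y} → On y body → lab y ≡ lab w
        lw o = trans (lab-here g rest W o) (≡-sym (lab-here g rest W ow))
        o₃ : On w₃ body
        o₃ = On-tgt body
        2≤e : 2 ≤ e z₀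
        2≤e = ℕₚ.≤-reflexive (≡-sym e≡2)
        w₁≢w₃ : w₁ ≢ w₃
        w₁≢w₃ eq = farkas-⊥ (ind w₃ w) (ℕₚ.≤-trans (ℕₚ.≤-reflexive (≡-sym (sum (ind w₃)))) (ℕₚ.≤-trans (ℕₚ.≤-trans (ℕₚ.m≤n+m _ (ind w₃ p)) (ℕₚ.m≤m+n _ _)) (once W w₃)))
          (trans (cong (λ t → ind w₃ t + (ind w₃ w + ind w₃ w₃)) eq) (trans (cong (λ k → k + (ind w₃ w + k)) (ind-refl w₃)) (lemma (ind w₃ w))))
          where
          lemma : ∀ i → 1 + (i + 1) ≡ 1 + (1 + i)
          lemma i = solve (i ∷ [])
        resolve₁ : ∀ {u v} → On u body → Free v → ¬ On v body → u ~ v → e v ≡ 0 → u ≡ w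
        resolve₁ {u} {v} o fv ¬o uv ev = pick (pos₃ body e₁ e₂ sum o)
          where
          O = outer-at fv ¬o
          bd : ∀ {i j} → Pos body u i j → 3 ≤ i + 1 × 3 ≤ j + 1
          bd ps = bound₁ d≡0 uv ps O (trans (Outer.len-g′ O) (cong₂ (λ i j → suc i + j) d≡0 ev))
          pick : (u ≡ w₁ × Pos body u 1 3) ⊎ (u ≡ w × Pos body u 2 2) ⊎ (u ≡ w₃ × Pos body u 3 1) → u ≡ w
          pick (inj₁ (_ , ps)) = case proj₁ (bd ps) of λ { (s≤s (s≤s ())) }
          pick (inj₂ (inj₁ (eq , _))) = eq
          pick (inj₂ (inj₂ (_ , ps))) = case proj₂ (bd ps) of λ { (s≤s (s≤s ())) }
        module Special {v : Fin n} (fv : Free v) (¬ov : ¬ On v body) (ev : e v ≡ 1) (O : Outer g v) (lg : len (Seg.body (Outer.g′ O)) ≡ 2)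
                       (z₁~z₂ : Seg.a (Outer.g′ O) ~ Seg.b (Outer.g′ O))
                       (sum′ : ∀ f → wt f (Seg.body (Outer.g′ O)) ≡ f (Seg.a (Outer.g′ O)) + f (Seg.b (Outer.g′ O))) where
          open Outer O
          z₁ = Seg.a g′
          z₂ = Seg.b g′
          resolve₂ : ∀ {u y} → On u body → On y (Seg.body g′) → u ~ y → u ≢ w → (u ≡ w₁ × y ≡ z₂) ⊎ (u ≡ w₃ × y ≡ z₁)
          resolve₂ {u} {y} o oy uy u≢w = pick (pos₃ body e₁ e₂ sum o)
            where
            bd : ∀ {i j} → Pos body u i j → (y ≡ z₁ × 3 ≤ i + 1 × 3 ≤ j + 2) ⊎ (y ≡ z₂ × 3 ≤ i + 2 × 3 ≤ j + 1)
            bd ps = bound₂ d≡0 uy ps (mkOuter pre g′ post whole oy) lg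
            pick : (u ≡ w₁ × Pos body u 1 3) ⊎ (u ≡ w × Pos body u 2 2) ⊎ (u ≡ w₃ × Pos body u 3 1) → (u ≡ w₁ × y ≡ z₂) ⊎ (u ≡ w₃ × y ≡ z₁)
            pick (inj₂ (inj₁ (eq , _))) = contradiction eq u≢w
            pick (inj₁ (eq , ps)) with bd ps
            ... | inj₁ (_ , s≤s (s≤s ()) , _)
            ... | inj₂ (eq′ , _) = inj₁ (eq , eq′)
            pick (inj₂ (inj₂ (eq , ps))) with bd ps
            ... | inj₁ (eq′ , _) = inj₂ (eq , eq′)
            ... | inj₂ (_ , _ , s≤s (s≤s ()))
          none : ∀ {y} → Free y → ¬ On y body → Apart y v → e y ≡ 0
          none {y} fy ¬oy ap = third-excess d≡0 e≡2 ev (budget (z₀ ∷ v ∷ y ∷ [])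
            (λ { (here refl) → f₀ ; (there (here refl)) → fv ; (there (there (here refl))) → fy })
            ((outside fv ¬ov All.∷ outside fy ¬oy All.∷ All.[]) AllPairs.∷ ((λ eq → ap (≡-sym eq)) All.∷ All.[]) AllPairs.∷ All.[] AllPairs.∷ AllPairs.[]))
          -- The edge beyond the center and the segment of `v` starts at `w` and ends in a third
          -- segment, which has the single vertex `v′`.
          module Lone {v′ : Fin n} (fv′ : Free v′) (¬ov′ : ¬ On v′ body) (ap : Apart v′ v) (wv′ : w ~ v′) where
            ev′ : e v′ ≡ 0
            ev′ = none fv′ ¬ov′ ap
            no-triangle : Bridge w₁ w₃ → ⊥
            no-triangle B = triangle (arc (Outer.pre O′)) (arc (Outer.post O′)) (Seg.enter g) e₂ wv′ (~-sym (proj₁ s′))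
                (A⇒Link (Seg.q∈A g) (Seg.q∈A (Outer.g′ O′))) B
                (ring₂ g (Outer.pre O′) (Outer.g′ O′) (Outer.post O′) (Outer.whole O′) sum (proj₁ (proj₂ (proj₂ s′))))
              where
              O′ = outer-at fv′ ¬ov′
              s′ = single (Outer.g′ O′) (trans (Outer.len-g′ O′) (cong₂ (λ i j → suc i + j) d≡0 ev′)) (Outer.on O′)
            -- Without `A` and `w`, the vertex `s` must still be linked to something. A link to `t`
            -- is excluded by `no-triangle`, one to the segment of `v` by the last hypothesis, and
            -- one-vertex segments see only `w`. Links between `t` and the segment of `v` do not
            -- count, as both are named `t`.
            split-⊥ : ∀ s t → (s ≡ w₁ × t ≡ w₃) ⊎ (s ≡ w₃ × t ≡ w₁) → (∀ {y} → On y (Seg.body g′) → ¬ s ~ y) → ⊥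
            split-⊥ s t st no-s = analyse (join-split fw (on-free g rest W os) (on-free g rest W ot) fv (lw os) (lw ot) s≢w t≢w s≢t
                (λ eq → outside fv ¬ov (trans (lw (first-on g)) eq)))
              where
              name = split-name w s t v
              os : On s body
              os = [ (λ (eq , _) → subst (λ y → On y body) (≡-sym eq) (first-on g)) , (λ (eq , _) → subst (λ y → On y body) (≡-sym eq) o₃) ]′ st
              ot : On t body
              ot = [ (λ (_ , eq) → subst (λ y → On y body) (≡-sym eq) o₃) , (λ (_ , eq) → subst (λ y → On y body) (≡-sym eq) (first-on g)) ]′ st
              s≢w : s ≢ w
              s≢w eq = [ (λ (eq′ , _) → ~⇒≢ e₁ (trans (≡-sym eq′) eq)) , (λ (eq′ , _) → ~⇒≢ e₂ (trans (≡-sym eq) eq′)) ]′ st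
              t≢w : t ≢ w
              t≢w eq = [ (λ (_ , eq′) → ~⇒≢ e₂ (trans (≡-sym eq) eq′)) , (λ (_ , eq′) → ~⇒≢ e₁ (trans (≡-sym eq′) eq)) ]′ st
              s≢t : s ≢ t
              s≢t eq = [ (λ (eq₁ , eq₂) → w₁≢w₃ (trans (≡-sym eq₁) (trans eq eq₂))) , (λ (eq₁ , eq₂) → w₁≢w₃ (trans (≡-sym eq₂) (trans (≡-sym eq) eq₁))) ]′ st
              no-bridge : Bridge s t → ⊥
              no-bridge B = [ (λ { (refl , refl) → no-triangle B }) , (λ { (refl , refl) → no-triangle (Bridge-sym B) }) ]′ st
              s-or-t : ∀ {y} → On y body → y ≢ w → y ≡ s ⊎ y ≡ t
              s-or-t {y} o ne = pick (on₃ body sum o) st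
                where
                pick : y ≡ w₁ ⊎ y ≡ w ⊎ y ≡ w₃ → (s ≡ w₁ × t ≡ w₃) ⊎ (s ≡ w₃ × t ≡ w₁) → y ≡ s ⊎ y ≡ t
                pick (inj₁ eq) (inj₁ (eq₁ , eq₂)) = inj₁ (trans eq (≡-sym eq₁))
                pick (inj₁ eq) (inj₂ (eq₁ , eq₂)) = inj₂ (trans eq (≡-sym eq₂))
                pick (inj₂ (inj₁ eq)) _ = contradiction eq ne
                pick (inj₂ (inj₂ eq)) (inj₁ (eq₁ , eq₂)) = inj₂ (trans eq (≡-sym eq₂))
                pick (inj₂ (inj₂ eq)) (inj₂ (eq₁ , eq₂)) = inj₁ (trans eq (≡-sym eq₁))
              inner : ∀ {y y′} → On y body → On y′ body → y ≢ w → y′ ≢ w → name y ≢ name y′ → Bridge y y′ → ⊥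
              inner o o′ ne ne′ differ B with s-or-t o ne | s-or-t o′ ne′
              ... | inj₁ refl | inj₁ refl = differ refl
              ... | inj₁ refl | inj₂ refl = no-bridge B
              ... | inj₂ refl | inj₁ refl = no-bridge (Bridge-sym B)
              ... | inj₂ refl | inj₂ refl = differ refl
              name-t : name t ≡ t
              name-t = trans (choose-no (t Fin.≟ s) (λ eq → s≢t (≡-sym eq))) (choose-yes (lab t Fin.≟ lab w) (lw ot))
              off-s : ∀ {y} → ¬ On y body → y ≢ s
              off-s ¬o refl = ¬o os
              off-lab : ∀ {y} → Free y → ¬ On y body → lab y ≢ lab w
              off-lab fy ¬o eq = outside fy ¬o (trans (lw (first-on g)) (≡-sym eq))
              name-off : ∀ {y} → Free y → ¬ On y body → name y ≡ choose (lab y Fin.≟ lab v) t (lab y)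
              name-off fy ¬o = trans (choose-no (_ Fin.≟ s) (off-s ¬o)) (choose-no (lab _ Fin.≟ lab w) (off-lab fy ¬o))
              key : ∀ {y y′} → On y body → y ≢ w → Free y′ → ¬ On y′ body → y ~ y′ → name y ≢ name y′ → ⊥
              key {y} {y′} o ne fy′ ¬o′ yy′ differ = settle (lab y′ Fin.≟ lab v) (s-or-t o ne)
                where
                settle : Dec (lab y′ ≡ lab v) → y ≡ s ⊎ y ≡ t → ⊥
                settle (no ap′) _ = ne (resolve₁ o fy′ ¬o′ yy′ (none fy′ ¬o′ ap′))
                settle (yes eq) (inj₁ y≡s) = no-s (same-outer O fy′ eq) (subst (_~ y′) y≡s yy′)
                settle (yes eq) (inj₂ y≡t) = differ (trans (cong name y≡t) (trans name-t
                  (≡-sym (trans (name-off fy′ ¬o′) (choose-yes (lab y′ Fin.≟ lab v) eq)))))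
              analyse : Joined name (_≡ w) → ⊥
              analyse (mkJoined {y} {y′} fy fy′ y≢ y′≢ differ B) = decide (lab y Fin.≟ lab y′)
                where
                same : lab y ≡ lab y′ → Dec (On y body) → Dec (On y′ body) → ⊥
                same eq (yes o) (yes o′) = inner o o′ y≢ y′≢ differ B
                same eq (yes o) (no ¬o′) = off-lab fy′ ¬o′ (trans (≡-sym eq) (lw o))
                same eq (no ¬o) (yes o′) = off-lab fy ¬o (trans eq (lw o′))
                same eq (no ¬o) (no ¬o′) = differ (trans (name-off fy ¬o) (trans (cong (λ r → choose (r Fin.≟ lab v) t r) eq) (≡-sym (name-off fy′ ¬o′))))
                decide : Dec (lab y ≡ lab y′) → ⊥
                decide (yes eq) = same eq (On? y body) (On? y′ body)
                decide (no ap′) = [ (λ (o , ¬o) → key o y≢ fy′ ¬o yy′ differ) , (λ (o , ¬o) → key o y′≢ fy ¬o (~-sym yy′) (λ eq → differ (≡-sym eq))) ]′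
                    (center-edge 2≤e fy fy′ ap′ yy′)
                  where
                  yy′ = bridge-edge fy fy′ ap′ B
            conclude : ∀ {u} → On u body → u ≢ w → u ~ v → ⊥
            conclude {u} ou u≢w uv = [ before , after ]′ (third fv′ ¬ov′ (apart-outer O fv′ ap))
              where
              before : Before v′ → ⊥
              -- Which end is torn off depends on the cyclic order: if `v′` precedes the segment of
              -- `v`, a chord from there to `w₁` lengthens the cycle, otherwise one to `w₃` does.
              before B@(mkBefore s₀ h s₁ w₃′ onʰ) = split-⊥ w₁ w₃ (inj₁ (refl , refl)) no₁
                where
                sh = single h (trans (Before.len-h B) (cong₂ (λ i j → suc i + j) d≡0 ev′)) onʰ
                bad : w₁ ~ z₂ → ⊥
                bad d₁ = single-then-pair (arc s₀) (arc s₁) (arc post) (Seg.enter g) e₂ (Seg.leave g) z₁~z₂ (Seg.enter g′) (proj₁ (proj₂ sh)) d₁ wv′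
                  (A⇒Link (Seg.q∈A g′) (Seg.p∈A h)) (ring₃ g s₀ h s₁ g′ post w₃′ sum (proj₁ (proj₂ (proj₂ sh))) sum′)
                no₁ : ∀ {y} → On y (Seg.body g′) → ¬ w₁ ~ y
                no₁ oy e with resolve₂ (first-on g) oy e (~⇒≢ e₁)
                ... | inj₁ (_ , refl) = bad e
                ... | inj₂ (eq , _) = w₁≢w₃ eq
              after : After v′ → ⊥
              after B@(mkAfter s₁ h s₂ w₃′ onʰ) = split-⊥ w₃ w₁ (inj₂ (refl , refl)) no₃
                where
                sh = single h (trans (After.len-h B) (cong₂ (λ i j → suc i + j) d≡0 ev′)) onʰ
                bad : w₃ ~ z₁ → ⊥
                bad d₃ = pair-then-single (arc pre) (arc s₁) (arc s₂) (Seg.enter g) e₁ (Seg.leave g) z₁~z₂ (Seg.leave g′) (~-sym (proj₁ sh)) d₃ wv′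
                  (A⇒Link (Seg.p∈A g′) (Seg.q∈A h)) (ring₃ g pre g′ s₁ h s₂ w₃′ sum sum′ (proj₁ (proj₂ (proj₂ sh))))
                no₃ : ∀ {y} → On y (Seg.body g′) → ¬ w₃ ~ y
                no₃ oy e with resolve₂ o₃ oy e (λ eq → ~⇒≢ e₂ (≡-sym eq))
                ... | inj₁ (eq , _) = w₁≢w₃ (≡-sym eq)
                ... | inj₂ (_ , refl) = bad e
          find-lone : ∀ {u} → On u body → u ≢ w → u ~ v → ⊥
          find-lone ou u≢w uv = from (edge-outside-pair f₀ fv (outside fv ¬ov))
            where
            from : Σ[ E ∈ Edge ] Apart (Edge.v E) z₀ × Apart (Edge.v E) v → ⊥
            from (mkEdge {u′} {v′} fu′ fv′ ap′ uv′ , apz , apv) = [ good , bad ]′ (center-edge 2≤e fu′ fv′ ap′ uv′)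
              where
              good : On u′ body × ¬ On v′ body → ⊥
              good (o , ¬o) = Lone.conclude fv′ ¬o apv (subst (_~ v′) (resolve₁ o fv′ ¬o uv′ (none fv′ ¬o apv)) uv′) ou u≢w uv
              bad : On v′ body × ¬ On u′ body → ⊥
              bad (o , _) = apart⇒¬on apz o
        start : Σ[ E ∈ Edge ] Edge.u E ≢ w × Edge.v E ≢ w → ⊥
        start (mkEdge fu fv ap uv , u≢ , v≢) =
            [ (λ (o , ¬o) → from o fv ¬o uv u≢) , (λ (o , ¬o) → from o fu ¬o (~-sym uv) v≢) ]′ (center-edge 2≤e fu fv ap uv)
          where
          special : ∀ {u v} → Free v → ¬ On v body → e v ≡ 1 → On u body → u ≢ w → u ~ v → Outer g v → ⊥
          special fv ¬o ev o u≢w uv O = Special.find-lone fv ¬o ev O lg (proj₁ pair) (proj₂ pair) o u≢w uv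
            where
            lg = trans (Outer.len-g′ O) (cong₂ (λ i j → suc i + j) d≡0 ev)
            pair = shape₂ (Seg.body (Outer.g′ O)) lg
          from : ∀ {u v} → On u body → Free v → ¬ On v body → u ~ v → u ≢ w → ⊥
          from o fv ¬o uv u≢w = [ (λ ev → u≢w (resolve₁ o fv ¬o uv ev)) , (λ ev → special fv ¬o ev o u≢w uv (outer-at fv ¬o)) ]′
            (unit-excess d≡0 e≡2 (pair-bound fv ¬o))

  module _ {p q : Fin n} (g : Seg p q) (rest : Segs q p) (W : Whole (g ∷ˢ rest)) where

    open Center g rest W

    -- The center has four vertices, the other segments two each. By position, chords run only from
    -- `w₂` to a last vertex or from `w₃` to a first one; both kinds occur, and `clash` refutes them
    -- if they lead to different segments. If they lead to the same one, an edge beyond this pair of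
    -- segments supplies a third segment.
    case-one : d ≡ 1 → e z₀ ≡ 2 → ⊥
    case-one d≡1 e≡2 = start (shape₄ body (trans len-body (cong₂ (λ i j → suc i + j) d≡1 e≡2)))
      where
      start : (∃₂ λ w₂ w₃ → Seg.a g ~ w₂ × w₂ ~ w₃ × w₃ ~ Seg.b g × (∀ f → wt f body ≡ f (Seg.a g) + (f w₂ + (f w₃ + f (Seg.b g))))) → ⊥
      start (w₂ , w₃ , e₁ , e₂ , e₃ , sum) = finish upper lower
        where
        two-long : ∀ {v} (O : Outer g v) → Free v → ¬ On v body → len (Seg.body (Outer.g′ O)) ≡ 2
        two-long O fv ¬o = trans (Outer.len-g′ O) (cong₂ (λ i j → suc i + j) d≡1 (no-excess d≡1 e≡2 3d≤ad (pair-bound fv ¬o)))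
        First Second : ∀ {v} → Outer g v → Set
        First {v} O = v ≡ Seg.a (Outer.g′ O)
        Second {v} O = v ≡ Seg.b (Outer.g′ O)
        resolve : ∀ {u v} → On u body → Free v → ¬ On v body → u ~ v → (O : Outer g v) → (u ≡ w₂ × Second O) ⊎ (u ≡ w₃ × First O)
        resolve {u} {v} o fv ¬o uv O = pick (pos₄ body e₁ e₂ e₃ sum o)
          where
          bd : ∀ {i j} → Pos body u i j → (First O × 4 ≤ i + 1 × 4 ≤ j + 2) ⊎ (Second O × 4 ≤ i + 2 × 4 ≤ j + 1)
          bd ps = bound₂ d≡1 uv ps O (two-long O fv ¬o)
          Res = (u ≡ w₂ × Second O) ⊎ (u ≡ w₃ × First O)
          at₁ : (First O × 4 ≤ 1 + 1 × 4 ≤ 4 + 2) ⊎ (Second O × 4 ≤ 1 + 2 × 4 ≤ 4 + 1) → Res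
          at₁ (inj₁ (_ , s≤s (s≤s ()) , _))
          at₁ (inj₂ (_ , s≤s (s≤s (s≤s ())) , _))
          at₂ : u ≡ w₂ → (First O × 4 ≤ 2 + 1 × 4 ≤ 3 + 2) ⊎ (Second O × 4 ≤ 2 + 2 × 4 ≤ 3 + 1) → Res
          at₂ eq (inj₁ (_ , s≤s (s≤s (s≤s ())) , _))
          at₂ eq (inj₂ (sec , _)) = inj₁ (eq , sec)
          at₃ : u ≡ w₃ → (First O × 4 ≤ 3 + 1 × 4 ≤ 2 + 2) ⊎ (Second O × 4 ≤ 3 + 2 × 4 ≤ 2 + 1) → Res
          at₃ eq (inj₁ (fst , _)) = inj₂ (eq , fst)
          at₃ eq (inj₂ (_ , _ , s≤s (s≤s (s≤s ()))))
          at₄ : (First O × 4 ≤ 4 + 1 × 4 ≤ 1 + 2) ⊎ (Second O × 4 ≤ 4 + 2 × 4 ≤ 1 + 1) → Res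
          at₄ (inj₁ (_ , _ , s≤s (s≤s (s≤s ()))))
          at₄ (inj₂ (_ , _ , s≤s (s≤s ())))
          pick : (u ≡ Seg.a g × Pos body u 1 4) ⊎ (u ≡ w₂ × Pos body u 2 3) ⊎ (u ≡ w₃ × Pos body u 3 2) ⊎ (u ≡ Seg.b g × Pos body u 4 1) → Res
          pick (inj₁ (_ , ps)) = at₁ (bd ps)
          pick (inj₂ (inj₁ (eq , ps))) = at₂ eq (bd ps)
          pick (inj₂ (inj₂ (inj₁ (eq , ps)))) = at₃ eq (bd ps)
          pick (inj₂ (inj₂ (inj₂ (_ , ps)))) = at₄ (bd ps)
        w₂≢w₃ : w₂ ≢ w₃
        w₂≢w₃ = ~⇒≢ e₂
        on₂′ : On w₂ body
        on₂′ = on-member body (ind w₂ (Seg.a g)) _ (sum (ind w₂))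
        on₃′ : On w₃ body
        on₃′ = on-member body (ind w₃ (Seg.a g) + ind w₃ w₂) _ (trans (sum (ind w₃)) (≡-sym (ℕₚ.+-assoc (ind w₃ (Seg.a g)) _ _)))
        edge-at : ∀ w w′ → On w body → Seg.a g ≢ w → (∀ {u} → u ≡ w₂ ⊎ u ≡ w₃ → u ≢ w → u ≡ w′) → Target g rest W w′
        edge-at w w′ ow a≢w other = from (edge-missing (on-free g rest W ow) f₀ (trans lab₀ (≡-sym (lab-here g rest W ow))) a≢w)
          where
          target : ∀ {u v} → On u body → Free v → ¬ On v body → u ~ v → u ≢ w → Target g rest W w′
          target {v = v} o fv ¬o uv u≢ = v , fv , ¬o , subst (_~ v) (other ([ (λ h → inj₁ (proj₁ h)) , (λ h → inj₂ (proj₁ h)) ]′ (resolve o fv ¬o uv (outer-at fv ¬o))) u≢) uv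
          from : Σ[ E ∈ Edge ] Edge.u E ≢ w × Edge.v E ≢ w → Target g rest W w′
          from (mkEdge fu fv ap uv , u≢ , v≢) =
            [ (λ (o , ¬o) → target o fv ¬o uv u≢) , (λ (o , ¬o) → target o fu ¬o (~-sym uv) v≢) ]′
            (center-edge (ℕₚ.≤-reflexive (≡-sym e≡2)) fu fv ap uv)
        a≢w₃ : Seg.a g ≢ w₃
        a≢w₃ refl = farkas-⊥ (ind w₃ w₂ + ind w₃ (Seg.b g)) (ℕₚ.≤-trans (ℕₚ.≤-reflexive (≡-sym (sum (ind w₃)))) (ℕₚ.≤-trans (ℕₚ.≤-trans (ℕₚ.m≤n+m _ (ind w₃ p)) (ℕₚ.m≤m+n _ _)) (once W w₃)))
          (trans (cong (λ k → k + (ind w₃ w₂ + (k + ind w₃ (Seg.b g)))) (ind-refl w₃)) (lemma (ind w₃ w₂) (ind w₃ (Seg.b g))))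
          where
          lemma : ∀ i j → 1 + (i + (1 + j)) ≡ 1 + (1 + (i + j))
          lemma i j = solve (i ∷ j ∷ [])
        upper : Target g rest W w₃
        upper = edge-at w₂ w₃ on₂′ (~⇒≢ e₁) (λ h ne → [ (λ eq → contradiction eq ne) , id ]′ h)
        lower : Target g rest W w₂
        lower = edge-at w₃ w₂ on₃′ a≢w₃ (λ h ne → [ id , (λ eq → contradiction eq ne) ]′ h)
        second-of : ∀ {v} → Free v → ¬ On v body → w₂ ~ v → (O : Outer g v) → Second O
        second-of fv ¬o wv O = [ proj₂ , (λ (eq , _) → contradiction eq w₂≢w₃) ]′ (resolve on₂′ fv ¬o wv O)
        first-of′ : ∀ {v} → Free v → ¬ On v body → w₃ ~ v → (O : Outer g v) → First O
        first-of′ fv ¬o wv O = [ (λ (eq , _) → contradiction (≡-sym eq) w₂≢w₃) , proj₂ ]′ (resolve on₃′ fv ¬o wv O)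
        clash : ∀ {v v′} → Free v → ¬ On v body → w₃ ~ v → Free v′ → ¬ On v′ body → w₂ ~ v′ → Apart v′ v → Outer g v → ⊥
        clash {v} {v′} fv ¬ov w₃v fv′ ¬ov′ w₂v′ ap O = [ before , after ]′ (third fv′ ¬ov′ (apart-outer O fv′ ap))
          where
          open Outer O
          pair = shape₂ (Seg.body g′) (two-long O fv ¬ov)
          w₃z₁ : w₃ ~ Seg.a g′
          w₃z₁ = subst (w₃ ~_) (first-of′ fv ¬ov w₃v O) w₃v
          before : Before v′ → ⊥
          before (mkBefore s₀ h s₁ w₃′ onʰ) = second-first (arc s₀) (arc s₁) (arc post) (Seg.enter g) e₁ e₃ (Seg.leave g) (Seg.leave h) (proj₁ pair) (Seg.leave g′)
              (subst (w₂ ~_) (second-of fv′ ¬ov′ w₂v′ O′) w₂v′) w₃z₁ (subst (λ k → Link _ _ (suc k)) d≡1 (links (Seg.p∈A g′) (Seg.p∈A h) (λ eq → p≢ (≡-sym eq))))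
              (ring₃ g s₀ h s₁ g′ post w₃′ sum (proj₂ pairʰ) (proj₂ pair))
            where
            O′ : Outer g v′
            O′ = mkOuter s₀ h (s₁ ++ˢ (g′ ∷ˢ post)) w₃′ onʰ
            pairʰ = shape₂ (Seg.body h) (two-long O′ fv′ ¬ov′)
            p≢ = heads-≢ h s₁ g′ (post ++ˢ (g ∷ˢ s₀)) (subst (λ s → Whole (h ∷ˢ s)) (++ˢ-assoc s₁ (g′ ∷ˢ post) (g ∷ˢ s₀))
              (rotate (g ∷ˢ s₀) (h ∷ˢ (s₁ ++ˢ (g′ ∷ˢ post))) w₃′))
          after : After v′ → ⊥
          after (mkAfter s₁ h s₂ w₃′ onʰ) = first-second (arc pre) (arc s₁) (arc s₂) (Seg.enter g) e₁ e₃ (Seg.leave g) (proj₁ pair) (Seg.leave g′)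
              (Seg.enter h) (proj₁ pairʰ) w₃z₁ (subst (w₂ ~_) (second-of fv′ ¬ov′ w₂v′ O′) w₂v′) (A⇒Link (Seg.p∈A g′) (Seg.q∈A h))
              (ring₃ g pre g′ s₁ h s₂ w₃′ sum (proj₂ pair) (proj₂ pairʰ))
            where
            O′ : Outer g v′
            O′ = mkOuter (pre ++ˢ (g′ ∷ˢ s₁)) h s₂ (subst (λ s → Whole (g ∷ˢ s)) (≡-sym (++ˢ-assoc pre (g′ ∷ˢ s₁) (h ∷ˢ s₂))) w₃′) onʰ
            pairʰ = shape₂ (Seg.body h) (two-long O′ fv′ ¬ov′)
        finish : Target g rest W w₃ → Target g rest W w₂ → ⊥
        finish (v , fv , ¬ov , w₃v) (v′ , fv′ , ¬ov′ , w₂v′) = compare (lab v′ Fin.≟ lab v)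
          where
          beyond : lab v′ ≡ lab v → Σ[ E ∈ Edge ] Apart (Edge.v E) z₀ × Apart (Edge.v E) v → ⊥
          beyond eq (mkEdge {u″} {v″} fu″ fv″ ap″ uv″ , apz , apv) = [ good , bad ]′ (center-edge (ℕₚ.≤-reflexive (≡-sym e≡2)) fu″ fv″ ap″ uv″)
            where
            good : On u″ body × ¬ On v″ body → ⊥
            good (o , ¬o) = [ (λ (eq″ , _) → clash fv ¬ov w₃v fv″ ¬o (subst (_~ v″) eq″ uv″) apv (outer-at fv ¬ov))
                            , (λ (eq″ , _) → clash fv″ ¬o (subst (_~ v″) eq″ uv″) fv′ ¬ov′ w₂v′ (λ eq‴ → apv (trans (≡-sym eq‴) eq)) (outer-at fv″ ¬o)) ]′
                            (resolve o fv″ ¬o uv″ (outer-at fv″ ¬o))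
            bad : On v″ body × ¬ On u″ body → ⊥
            bad (o , _) = apart⇒¬on apz o
          compare : Dec (lab v′ ≡ lab v) → ⊥
          compare (no ne) = clash fv ¬ov w₃v fv′ ¬ov′ w₂v′ ne (outer-at fv ¬ov)
          compare (yes eq) = beyond eq (edge-outside-pair f₀ fv (outside fv ¬ov))

  -- The only pattern that survives the exchanges.
  record Special : Set where
    constructor mkSpecial
    field
      d≡0 : d ≡ 0
      {z₀ z₁ z₂} : Fin n
      f₀ : Free z₀
      f₁ : Free z₁
      f₂ : Free z₂
      ap₀₁ : Apart z₀ z₁
      ap₀₂ : Apart z₀ z₂
      ap₁₂ : Apart z₁ z₂
      e₀ : e z₀ ≡ 1
      e₁ : e z₁ ≡ 1
      e₂ : e z₂ ≡ 1

  -- Distribution of the excess over three segments.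

  -- `i` is the excess of the segment where two cross edges meet, `j` and `k` are those at their
  -- other ends. The total is at most 3 - d, which rules out d ≥ 2 and for d = 1 puts everything on
  -- `i`.
  excess-cases : ∀ d i j k {t} → 3 * d ≤ t → 2 ≤ i + j → 2 ≤ i + k → i + (j + (k + 0)) + t ≤ 3 + 2 * d →
                 (d ≡ 1 × i ≡ 2) ⊎ (d ≡ 0 × i ≡ 3) ⊎ (d ≡ 0 × i ≡ 2) ⊎ (d ≡ 0 × i ≡ 1 × j ≡ 1 × k ≡ 1)
  excess-cases zero 2 j k _ _ _ _ = inj₂ (inj₂ (inj₁ (refl , refl)))
  excess-cases zero 3 j k _ _ _ _ = inj₂ (inj₁ (refl , refl))
  excess-cases zero 1 1 1 _ _ _ _ = inj₂ (inj₂ (inj₂ (refl , refl , refl , refl)))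
  excess-cases zero 0 (suc (suc j)) (suc (suc k)) {t} _ _ _ h = ⊥-elim (farkas-⊥ (j + k + t) h (lemma j k t))
    where
    lemma : ∀ j k t → suc (suc j) + (suc (suc k) + 0) + t ≡ 3 + suc (j + k + t)
    lemma j k t = solve (j ∷ k ∷ t ∷ [])
  excess-cases zero 0 (suc (suc j)) 1 _ _ (s≤s ()) _
  excess-cases zero 0 1 k _ (s≤s ()) _ _
  excess-cases zero 1 (suc (suc j)) (suc k) {t} _ _ _ h = ⊥-elim (farkas-⊥ (j + k + t) h (lemma j k t))
    where
    lemma : ∀ j k t → 1 + (suc (suc j) + (suc k + 0)) + t ≡ 3 + suc (j + k + t)
    lemma j k t = solve (j ∷ k ∷ t ∷ [])
  excess-cases zero 1 1 (suc (suc k)) {t} _ _ _ h = ⊥-elim (farkas-⊥ (k + t) h (lemma k t))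
    where
    lemma : ∀ k t → 1 + (1 + (suc (suc k) + 0)) + t ≡ 3 + suc (k + t)
    lemma k t = solve (k ∷ t ∷ [])
  excess-cases zero 1 1 0 _ _ (s≤s ()) _
  excess-cases zero 1 0 k _ (s≤s ()) _ _
  excess-cases zero 1 (suc (suc j)) 0 _ _ (s≤s ()) _
  excess-cases zero (suc (suc (suc (suc i)))) j k {t} _ _ _ h = ⊥-elim (farkas-⊥ (i + j + k + t) h (lemma i j k t))
    where
    lemma : ∀ i j k t → suc (suc (suc (suc i))) + (j + (k + 0)) + t ≡ 3 + suc (i + j + k + t)
    lemma i j k t = solve (i ∷ j ∷ k ∷ t ∷ [])
  excess-cases 1 i j k {t} h h₁ h₂ h′ = inj₁ (refl , ℕₚ.≤-antisym upper lower)
    where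
    upper : i ≤ 2
    upper = farkas (j + k) (h ⊞ h′) (lemma i j k t)
      where
      lemma : ∀ i j k t → 2 + (3 + (i + (j + (k + 0)) + t)) ≡ i + (t + 5) + (j + k)
      lemma i j k t = solve (i ∷ j ∷ k ∷ t ∷ [])
    lower : 2 ≤ i
    lower = farkas 0 (h ⊞ h′ ⊞ h₁ ⊞ h₂) (lemma i j k t)
      where
      lemma : ∀ i j k t → i + (3 + (i + (j + (k + 0)) + t + (2 + 2))) ≡ 2 + (t + (5 + (i + j + (i + k)))) + 0
      lemma i j k t = solve (i ∷ j ∷ k ∷ t ∷ [])
  excess-cases (suc (suc d)) i j k {t} h h₁ h₂ h′ = ⊥-elim (farkas-⊥ (d + k) (h ⊞ h′ ⊞ h₁) (lemma d i j k t))
    where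
    lemma : ∀ d i j k t → 3 * (2 + d) + (i + (j + (k + 0)) + t + 2) ≡ t + (3 + 2 * (2 + d) + (i + j)) + suc (d + k)
    lemma d i j k t = solve (d ∷ i ∷ j ∷ k ∷ t ∷ [])

  from-star : ∀ {z u v y} → Free z → Free u → Free v → lab u ≡ lab z → Free y → Apart z y → Apart u v → Apart y v → z ~ y → u ~ v → Special
  from-star {z} {u} {v} {y} fz fu fv uz fy zy uv yv zy~ uv~ = decide (excess-cases d (e z) (e y) (e v) 3d≤ad
      (cost fz fy zy (edge zy~)) (subst (λ i → 2 ≤ i + e v) eu≡ez (cost fu fv uv (edge uv~)))
      (budget (z ∷ y ∷ v ∷ []) (λ { (here refl) → fz ; (there (here refl)) → fy ; (there (there (here refl))) → fv })
        ((zy All.∷ zv All.∷ All.[]) AllPairs.∷ (yv All.∷ All.[]) AllPairs.∷ All.[] AllPairs.∷ AllPairs.[])))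
    where
    zv : Apart z v
    zv eq = uv (trans uz eq)
    eu≡ez : e u ≡ e z
    eu≡ez = trans (≡-sym (e-lab fu)) (trans (cong e uz) (e-lab fz))
    at-center : (∀ {p q} (g : Seg p q) (rest : Segs q p) (W : Whole (g ∷ˢ rest)) → e (Seg.a g) ≡ e z → ⊥) → RootSeg z → ⊥
    at-center k (rootSeg g rest on W) = k g rest W (trans (≡-sym (cong e (lab-here g rest W on))) (e-lab fz))
    decide : (d ≡ 1 × e z ≡ 2) ⊎ (d ≡ 0 × e z ≡ 3) ⊎ (d ≡ 0 × e z ≡ 2) ⊎ (d ≡ 0 × e z ≡ 1 × e y ≡ 1 × e v ≡ 1) → Special
    decide (inj₁ (d≡1 , eq)) = ⊥-elim (at-center (λ g rest W eq′ → case-one g rest W d≡1 (trans eq′ eq)) (root-at (proj₁ fz) (proj₂ fz)))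
    decide (inj₂ (inj₁ (d≡0 , eq))) = ⊥-elim (at-center (λ g rest W eq′ → case-four g rest W d≡0 (trans eq′ eq)) (root-at (proj₁ fz) (proj₂ fz)))
    decide (inj₂ (inj₂ (inj₁ (d≡0 , eq)))) = ⊥-elim (at-center (λ g rest W eq′ → case-three g rest W d≡0 (trans eq′ eq)) (root-at (proj₁ fz) (proj₂ fz)))
    decide (inj₂ (inj₂ (inj₂ (d≡0 , i , j , k)))) = mkSpecial d≡0 fz fy fv zy zv yv i j k

  -- An edge beyond the two segments of a first edge cannot lie on two further segments, since both
  -- edges together would cost 4. So the two edges share a segment and form a star.
  special : Special
  special = first some-edge
    where
    first : Edge → Special
    first (mkEdge {u} {v} fu fv uv e₁) = second (edge-outside-pair fu fv uv)
      where
      second : Σ[ E ∈ Edge ] Apart (Edge.v E) u × Apart (Edge.v E) v → Special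
      second (mkEdge {u′} {v′} fu′ fv′ uv′ e₂ , v′u , v′v) = compare (lab u′ Fin.≟ lab u) (lab u′ Fin.≟ lab v)
        where
        compare : Dec (lab u′ ≡ lab u) → Dec (lab u′ ≡ lab v) → Special
        compare (yes eq) _ = from-star fu fu′ fv′ eq fv uv uv′ (λ eq′ → v′v (≡-sym eq′)) e₁ e₂
        compare _ (yes eq) = from-star fv fu′ fv′ eq fu (λ eq′ → uv (≡-sym eq′)) uv′ (λ eq′ → v′u (≡-sym eq′)) (~-sym e₁) e₂
        compare (no ne) (no ne′) = ⊥-elim (farkas-⊥ d (cost fu fv uv (edge e₁) ⊞ cost fu′ fv′ uv′ (edge e₂) ⊞ budget (u ∷ v ∷ u′ ∷ v′ ∷ [])
            (λ { (here refl) → fu ; (there (here refl)) → fv ; (there (there (here refl))) → fu′ ; (there (there (there (here refl)))) → fv′ })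
            ((uv All.∷ (λ eq → ne (≡-sym eq)) All.∷ (λ eq → v′u (≡-sym eq)) All.∷ All.[]) AllPairs.∷
             ((λ eq → ne′ (≡-sym eq)) All.∷ (λ eq → v′v (≡-sym eq)) All.∷ All.[]) AllPairs.∷
             (uv′ All.∷ All.[]) AllPairs.∷ All.[] AllPairs.∷ AllPairs.[]) ⊞ 3d≤ad)
            (lemma (e u) (e v) (e u′) (e v′) d (a * d)))
          where
          lemma : ∀ i j k l d t → 2 + 0 + (2 + 0 + (i + (j + (k + (l + 0))) + t + 3 * d)) ≡ i + j + (k + l + (3 + 2 * d + t)) + suc d
          lemma i j k l d t = solve (i ∷ j ∷ k ∷ l ∷ d ∷ t ∷ [])

-- Spanning paths in the Petersen graph, by computation.

module PetersenPaths where

  open import Data.Maybe using (Maybe; just; nothing; is-just; to-witness-T; _<∣>_)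

  petersen-sym : ∀ u v → petersenAdj u v ≡ petersenAdj v u
  petersen-sym = from-yes (Finₚ.all? (λ u → Finₚ.all? (λ v → petersenAdj u v Bool.≟ petersenAdj v u)))

  petersen-irrefl : ∀ v → petersenAdj v v ≡ false
  petersen-irrefl = from-yes (Finₚ.all? (λ v → petersenAdj v v Bool.≟ false))

  petersen : Graph 10
  petersen = record { adj = petersenAdj ; sym = petersen-sym ; irrefl = petersen-irrefl }

  open Paths petersen

  -- Two nonadjacent vertices are joined by a Hamiltonian path; for adjacent ones nine vertices is the best possible.
  order : Fin 10 → Fin 10 → ℕ
  order i j = if petersenAdj i j then 9 else 10

  Spanning : Fin 10 → Fin 10 → Set
  Spanning i j = Σ[ p ∈ LPath i j ] (∀ z → wt (ind z) (fromL p) ≤ 1) × order i j ≤ len (fromL p)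

  mem : Fin 10 → List (Fin 10) → Bool
  mem i [] = false
  mem i (j ∷ l) = does (i Fin.≟ j) Bool.∨ mem i l

  -- Depth-first search for a path with a prescribed number of edges. `validate` checks the result
  -- afterwards, so correctness rests on that check alone.
  search : ℕ → List (Fin 10) → ∀ i j → Maybe (LPath i j)
  try : ℕ → List (Fin 10) → ∀ i j → List (Fin 10) → Maybe (LPath i j)
  search zero seen i j with i Fin.≟ j
  ... | yes refl = just [ i ]ˡ
  ... | no _ = nothing
  search (suc k) seen i j = if does (i Fin.≟ j) then nothing else try k (i ∷ seen) i j (allFin 10)
  try k seen i j [] = nothing
  try k seen i j (w ∷ l) with i ~? w
  ... | no _ = try k seen i j l
  ... | yes e = (if mem w seen then nothing else Data.Maybe.map (i ∷⟨ e ⟩_) (search k seen w j)) <∣> try k seen i j l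

  validate : ∀ i j → Maybe (LPath i j) → Maybe (Spanning i j)
  validate i j nothing = nothing
  validate i j (just p) with Finₚ.all? (λ z → wt (ind z) (fromL p) ≤? 1) | order i j ≤? len (fromL p)
  ... | yes s | yes l = just (p , s , l)
  ... | _ | _ = nothing

  candidate : ∀ i j → Maybe (Spanning i j)
  candidate i j = validate i j (search (order i j ∸ 1) [] i j)

  found : ∀ i j → i ≡ j ⊎ Bool.T (is-just (candidate i j))
  found = from-yes (Finₚ.all? (λ i → Finₚ.all? (λ j → (i Fin.≟ j) ⊎-dec Bool.T? (is-just (candidate i j)))))

  abstract
    spanning : ∀ i j → i ≢ j → Spanning i j
    spanning i j ne = [ (λ eq → contradiction eq ne) , to-witness-T (candidate i j) ]′ (found i j)

  edge-list : List (Fin 10 × Fin 10)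
  edge-list = (# 0 , # 1) ∷ (# 1 , # 2) ∷ (# 2 , # 3) ∷ (# 3 , # 4) ∷ (# 4 , # 0) ∷
              (# 5 , # 7) ∷ (# 7 , # 9) ∷ (# 9 , # 6) ∷ (# 6 , # 8) ∷ (# 8 , # 5) ∷
              (# 0 , # 5) ∷ (# 1 , # 6) ∷ (# 2 , # 7) ∷ (# 3 , # 8) ∷ (# 4 , # 9) ∷ []

  -- Reduces the preservation of adjacency by a map into `G` to fifteen edges.
  listed : ∀ i j → petersenAdj i j ≡ true →
           Any.Any (λ (k , l) → (i ≡ k × j ≡ l) ⊎ (j ≡ k × i ≡ l)) edge-list
  listed = from-yes (Finₚ.all? (λ i → Finₚ.all? (λ j → (petersenAdj i j Bool.≟ true) →-dec
    Any.any? (λ (k , l) → ((i Fin.≟ k) ×-dec (j Fin.≟ l)) ⊎-dec ((j Fin.≟ k) ×-dec (i Fin.≟ l))) edge-list)))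

  vertices : ∀ {i j} → LPath i j → List (Fin 10)
  vertices [ i ]ˡ = i ∷ []
  vertices (i ∷⟨ _ ⟩ p) = i ∷ vertices p

  sum-vertices : ∀ f {i j} (p : LPath i j) → sumOf f (vertices p) ≡ wt f (fromL p)
  sum-vertices f [ i ]ˡ = ℕₚ.+-identityʳ (f i)
  sum-vertices f (i ∷⟨ _ ⟩ p) = cong (f i +_) (sum-vertices f p)

  simple⇒wt≤ : ∀ f {i j} (p : LPath i j) → (∀ z → wt (ind z) (fromL p) ≤ 1) → wt f (fromL p) ≤ sumOf f (allFin 10)
  simple⇒wt≤ f p s = ℕₚ.≤-trans (ℕₚ.≤-reflexive (≡-sym (sum-vertices f p)))
    (unique-⊆⇒sum≤ f (sum≤1⇒unique (vertices p) (λ z → ℕₚ.≤-trans (ℕₚ.≤-reflexive (sum-vertices (ind z) p)) (s z))) (λ _ → ∈ₚ.∈-allFin _))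

-- Chords between three segments on two vertices each.

-- `nbr-on` ranges over all longest cycles and all vertices off them, because it will be applied to
-- a cycle obtained by exchange and to vertices off `C` other than `x`.
module Core (S : Setting) (X : OffVertex S) (F : Frames.Frame S X) (d≡0 : Frames.Frame.d F ≡ 0)
        (nbr-on : ∀ (O′ : OffVertex S) {v} → Adj (Setting.G S) (OffVertex.x O′) v → Paths.On (Setting.G S) v (Paths.Closed.path (OffVertex.C O′))) where

  open Setting S
  open OffVertex X
  open Paths G
  open Walks G
  open LongestCycle S
  open Outside X
  open Frames S X
  open Frame F
  open Analysis S X F
  open Shapes G

  A-x : ∀ {p} → A p → p ~ x
  A-x {p} (_ , y , e , hy) = subst (p ~_) (lone d≡0 hy) e

  x-A : ∀ {y} → x ~ y → A y
  x-A e = nbr-on X e , x , ~-sym e , stop x∉C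

  -- The arcs `s₀`, `s₁`, `s₂` hold whatever other segments there are. They turn out to be empty,
  -- but the exchanges that lead there must allow for them.
  record Tri : Set where
    field
      {p₀ q₀ p₁ q₁ p₂ q₂} : Fin n
      g₀ : Seg p₀ q₀
      s₀ : Segs q₀ p₁
      g₁ : Seg p₁ q₁
      s₁ : Segs q₁ p₂
      g₂ : Seg p₂ q₂
      s₂ : Segs q₂ p₀
      whole : Whole (g₀ ∷ˢ (s₀ ++ˢ (g₁ ∷ˢ (s₁ ++ˢ (g₂ ∷ˢ s₂)))))
      two₀ : len (Seg.body g₀) ≡ 2
      two₁ : len (Seg.body g₁) ≡ 2
      two₂ : len (Seg.body g₂) ≡ 2
    a₀ = Seg.a g₀
    b₀ = Seg.b g₀
    a₁ = Seg.a g₁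
    b₁ = Seg.b g₁
    a₂ = Seg.a g₂
    b₂ = Seg.b g₂

  open Tri

  rot : Tri → Tri
  rot T = record
    { g₀ = g₁ T ; s₀ = s₁ T ; g₁ = g₂ T ; s₁ = s₂ T ; g₂ = g₀ T ; s₂ = s₀ T
    ; whole = subst (λ s → Whole (g₁ T ∷ˢ s)) (++ˢ-assoc (s₁ T) (g₂ T ∷ˢ s₂ T) (g₀ T ∷ˢ s₀ T))
        (rotate (g₀ T ∷ˢ s₀ T) (g₁ T ∷ˢ (s₁ T ++ˢ (g₂ T ∷ˢ s₂ T))) (whole T))
    ; two₀ = two₁ T ; two₁ = two₂ T ; two₂ = two₀ T }

  -- By `cross-shape` these are the only possible edges between the first two segments; `rot` covers
  -- the other pairs.
  Fwd Bwd : Tri → Set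
  Fwd T = a₀ T ~ b₁ T
  Bwd T = b₀ T ~ a₁ T

  module Facts (T : Tri) where

    pr₀ = shape₂ (Seg.body (g₀ T)) (two₀ T)
    pr₁ = shape₂ (Seg.body (g₁ T)) (two₁ T)
    pr₂ = shape₂ (Seg.body (g₂ T)) (two₂ T)

    tail : Segs (q₁ T) (p₀ T)
    tail = s₁ T ++ˢ (g₂ T ∷ˢ s₂ T)

    free₀ : ∀ {z} → On z (Seg.body (g₀ T)) → Free z
    free₀ = on-free (g₀ T) _ (whole T)

    lab₀ : ∀ {z} → On z (Seg.body (g₀ T)) → lab z ≡ a₀ T
    lab₀ = lab-here (g₀ T) _ (whole T)

    on-b₀ : On (b₀ T) (Seg.body (g₀ T))
    on-b₀ = On-tgt (Seg.body (g₀ T))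

    e₀ : e (a₀ T) ≡ 1
    e₀ = ℕₚ.suc-injective (trans (≡-sym (trans (len-here (g₀ T) _ (whole T) (first-on (g₀ T))) (cong (λ k → suc k + e (a₀ T)) d≡0))) (two₀ T))

    apart₀₁ : Apart (a₀ T) (a₁ T)
    apart₀₁ eq = disjoint (g₀ T) (s₀ T) (g₁ T) tail (whole T) (first-on (g₀ T)) (subst (λ t → On t (Seg.body (g₁ T)))
      (trans (≡-sym (lab-later (g₀ T) (s₀ T) (g₁ T) tail (whole T) (first-on (g₁ T)))) (trans (≡-sym eq) (lab₀ (first-on (g₀ T))))) (first-on (g₁ T)))

    not-both : Fwd T → Bwd T → ⊥
    not-both f b = too-long L (arc tail ⊕⟨ Seg.enter (g₀ T) ⟩ [ a₀ T ] ⊕⟨ f ⟩ [ b₁ T ] ⊕⟨ ~-sym (proj₁ pr₁) ⟩ [ a₁ T ] ⊕⟨ ~-sym b ⟩ [ b₀ T ]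
        ⊕⟨ Seg.leave (g₀ T) ⟩ arc (s₀ T) ⊕⟨ Link.py L ⟩ Link.via L) (Link.yq L)
        λ f → trans (lemma (wt f (arc tail)) (f (a₀ T)) (f (b₁ T)) (f (a₁ T)) (f (b₀ T)) (wt f (arc (s₀ T))) (wt f (Link.via L)))
          (cong (_+ wt f (Link.via L)) (ring₂ (g₀ T) (s₀ T) (g₁ T) tail (whole T) (proj₂ pr₀) (proj₂ pr₁) f))
      where
      L = A⇒Link (Seg.p∈A (g₁ T)) (Seg.q∈A (g₁ T))
      lemma : ∀ t a b a′ b′ r v → t + (a + (b + (a′ + (b′ + (r + v))))) ≡ a + b′ + r + (a′ + b) + t + v
      lemma t a b a′ b′ r v = solve (t ∷ a ∷ b ∷ a′ ∷ b′ ∷ r ∷ v ∷ [])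

    not-bwd-twice : Bwd T → Bwd (rot (rot T)) → ⊥
    not-bwd-twice b b′ = too-long L (arc (s₂ T) ⊕⟨ Seg.enter (g₀ T) ⟩ [ a₀ T ] ⊕⟨ ~-sym b′ ⟩ [ b₂ T ] ⊕⟨ ~-sym (proj₁ pr₂) ⟩ [ a₂ T ] ⊕⟨ ~-sym (Seg.enter (g₂ T)) ⟩
        rv (arc (s₁ T)) ⊕⟨ ~-sym (Seg.leave (g₁ T)) ⟩ [ b₁ T ] ⊕⟨ ~-sym (proj₁ pr₁) ⟩ [ a₁ T ] ⊕⟨ ~-sym b ⟩ [ b₀ T ] ⊕⟨ Seg.leave (g₀ T) ⟩ arc (s₀ T)
        ⊕⟨ Link.py L ⟩ Link.via L) (Link.yq L)
        λ f → trans (lemma (wt f (arc (s₂ T))) (f (a₀ T)) (f (b₂ T)) (f (a₂ T)) (wt f (arc (s₁ T))) (f (b₁ T)) (f (a₁ T)) (f (b₀ T)) (wt f (arc (s₀ T))) (wt f (Link.via L)))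
          (cong (_+ wt f (Link.via L)) (ring₃ (g₀ T) (s₀ T) (g₁ T) (s₁ T) (g₂ T) (s₂ T) (whole T) (proj₂ pr₀) (proj₂ pr₁) (proj₂ pr₂) f))
      where
      L = A⇒Link (Seg.p∈A (g₁ T)) (Seg.q∈A (g₂ T))
      lemma : ∀ t a b″ a″ s b′ a′ b r v → t + (a + (b″ + (a″ + (s + (b′ + (a′ + (b + (r + v)))))))) ≡ a + b + r + (a′ + b′) + s + (a″ + b″) + t + v
      lemma t a b″ a″ s b′ a′ b r v = solve (t ∷ a ∷ b″ ∷ a″ ∷ s ∷ b′ ∷ a′ ∷ b ∷ r ∷ v ∷ [])

    cross-shape : ∀ {u v} → On u (Seg.body (g₀ T)) → On v (Seg.body (g₁ T)) → u ~ v → (u ≡ a₀ T × v ≡ b₁ T) ⊎ (u ≡ b₀ T × v ≡ a₁ T)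
    cross-shape {u} {v} o o′ uv = pick (on₂ (Seg.body (g₀ T)) (proj₂ pr₀) o) (on₂ (Seg.body (g₁ T)) (proj₂ pr₁) o′)
      where
      pos : ∀ {i j i′ j′} → Pos (Seg.body (g₀ T)) u i j → Pos (Seg.body (g₁ T)) v i′ j′ → 3 ≤ i + i′ × 3 ≤ j + j′
      pos {i} {j} {i′} {j′} ps ps′ = subst (λ k → suc k + 0 + 2 ≤ i + i′ × suc k + 0 + 2 ≤ j + j′) d≡0 (pos-bound (g₀ T) (s₀ T) (g₁ T) tail (whole T) (edge uv) ps ps′)
      pick : u ≡ a₀ T ⊎ u ≡ b₀ T → v ≡ a₁ T ⊎ v ≡ b₁ T → (u ≡ a₀ T × v ≡ b₁ T) ⊎ (u ≡ b₀ T × v ≡ a₁ T)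
      pick (inj₁ eq) (inj₂ eq′) = inj₁ (eq , eq′)
      pick (inj₂ eq) (inj₁ eq′) = inj₂ (eq , eq′)
      pick (inj₁ refl) (inj₁ refl) = case proj₁ (pos (pos-first (Seg.body (g₀ T)) (two₀ T)) (pos-first (Seg.body (g₁ T)) (two₁ T))) of λ { (s≤s (s≤s ())) }
      pick (inj₂ refl) (inj₂ refl) = case proj₂ (pos (pos-last (Seg.body (g₀ T)) (two₀ T)) (pos-last (Seg.body (g₁ T)) (two₁ T))) of λ { (s≤s (s≤s ())) }

  data Located (T : Tri) (z : Fin n) : Set where
    in₀ : On z (Seg.body (g₀ T)) → Located T z
    in₁ : On z (Seg.body (g₁ T)) → Located T z
    in₂ : On z (Seg.body (g₂ T)) → Located T z
    lonely : ¬ On z (Seg.body (g₀ T)) → ¬ On z (Seg.body (g₁ T)) → ¬ On z (Seg.body (g₂ T)) → e z ≡ 0 → Located T z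

  -- Three segments of excess 1 exhaust the budget of 3, so a vertex elsewhere lies in a segment of
  -- excess 0.
  locate₃ : ∀ T {z} → Free z → Located T z
  locate₃ T {z} fz = pick (On? z (Seg.body (g₀ T))) (On? z (Seg.body (g₁ T))) (On? z (Seg.body (g₂ T)))
    where
    T₁ = rot T
    T₂ = rot T₁
    module F₀ = Facts T
    module F₁ = Facts T₁
    module F₂ = Facts T₂
    ap : ∀ (U : Tri) → ¬ On z (Seg.body (g₀ U)) → Apart (a₀ U) z
    ap U ¬o eq = ¬o (same-seg (g₀ U) _ (whole U) fz (trans (≡-sym eq) (Facts.lab₀ U (first-on (g₀ U)))))
    fourth-excess : ∀ {i j k l t} → i ≡ 1 → j ≡ 1 → k ≡ 1 → d ≡ 0 → i + (j + (k + (l + 0))) + t ≤ 3 + 2 * d → l ≡ 0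
    fourth-excess {l = l} {t} refl refl refl d0 h with subst (λ k → suc (suc (suc (l + 0 + t))) ≤ 3 + 2 * k) d0 h
    ... | s≤s (s≤s (s≤s h′)) = ℕₚ.m+n≡0⇒m≡0 l (ℕₚ.m+n≡0⇒m≡0 (l + 0) (ℕₚ.n≤0⇒n≡0 h′))
    pick : Dec (On z (Seg.body (g₀ T))) → Dec (On z (Seg.body (g₁ T))) → Dec (On z (Seg.body (g₂ T))) → Located T z
    pick (yes o) _ _ = in₀ o
    pick _ (yes o) _ = in₁ o
    pick _ _ (yes o) = in₂ o
    pick (no ¬0) (no ¬1) (no ¬2) = lonely ¬0 ¬1 ¬2 (fourth-excess F₀.e₀ F₁.e₀ F₂.e₀ d≡0 (budget (a₀ T ∷ a₁ T ∷ a₂ T ∷ z ∷ [])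
      (λ { (here refl) → F₀.free₀ (first-on (g₀ T)) ; (there (here refl)) → F₁.free₀ (first-on (g₁ T)) ; (there (there (here refl))) → F₂.free₀ (first-on (g₂ T))
         ; (there (there (there (here refl)))) → fz })
      ((F₀.apart₀₁ All.∷ (λ eq → F₂.apart₀₁ (≡-sym eq)) All.∷ ap T ¬0 All.∷ All.[]) AllPairs.∷ (F₁.apart₀₁ All.∷ ap T₁ ¬1 All.∷ All.[]) AllPairs.∷
       (ap T₂ ¬2 All.∷ All.[]) AllPairs.∷ All.[] AllPairs.∷ AllPairs.[])))

  excess≤1 : Tri → ∀ {z} → Free z → e z ≤ 1
  excess≤1 T {z} fz = go (locate₃ T fz)
    where
    from : ∀ U → On z (Seg.body (g₀ U)) → e z ≤ 1
    from U o = ℕₚ.≤-reflexive (trans (≡-sym (e-lab fz)) (trans (cong e (Facts.lab₀ U o)) (Facts.e₀ U)))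
    go : Located T z → e z ≤ 1
    go (in₀ o) = from T o
    go (in₁ o) = from (rot T) o
    go (in₂ o) = from (rot (rot T)) o
    go (lonely _ _ _ eq) = ℕₚ.≤-trans (ℕₚ.≤-reflexive eq) z≤n

  data Kind (T : Tri) : Fin n → Fin n → Set where
    f₀₁ : Fwd T → Kind T (a₀ T) (b₁ T)
    f₁₂ : Fwd (rot T) → Kind T (a₁ T) (b₂ T)
    f₂₀ : Fwd (rot (rot T)) → Kind T (a₂ T) (b₀ T)
    r₀₁ : Bwd T → Kind T (b₀ T) (a₁ T)
    r₁₂ : Bwd (rot T) → Kind T (b₁ T) (a₂ T)
    r₂₀ : Bwd (rot (rot T)) → Kind T (b₂ T) (a₀ T)

  kind : ∀ T {u v} → Free u → Free v → Apart u v → u ~ v → Kind T u v ⊎ Kind T v u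
  kind T {u} {v} fu fv ap uv = go (locate₃ T fu) (locate₃ T fv)
    where
    T₁ = rot T
    T₂ = rot T₁
    same : ∀ U → On u (Seg.body (g₀ U)) → On v (Seg.body (g₀ U)) → ⊥
    same U o o′ = ap (trans (Facts.lab₀ U o) (≡-sym (Facts.lab₀ U o′)))
    low : ∀ {y z} → Free y → Free z → Apart y z → y ~ z → e y ≡ 0 → ⊥
    low {y} {z} fy fz ap′ yz eq = contradiction (ℕₚ.≤-trans (cost fy fz ap′ (edge yz)) (ℕₚ.+-mono-≤ (ℕₚ.≤-reflexive eq) (excess≤1 T fz))) λ { (s≤s ()) }
    k₀₁ : ∀ {y z} → y ~ z → (y ≡ a₀ T × z ≡ b₁ T) ⊎ (y ≡ b₀ T × z ≡ a₁ T) → Kind T y z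
    k₀₁ e (inj₁ (refl , refl)) = f₀₁ e
    k₀₁ e (inj₂ (refl , refl)) = r₀₁ e
    k₁₂ : ∀ {y z} → y ~ z → (y ≡ a₁ T × z ≡ b₂ T) ⊎ (y ≡ b₁ T × z ≡ a₂ T) → Kind T y z
    k₁₂ e (inj₁ (refl , refl)) = f₁₂ e
    k₁₂ e (inj₂ (refl , refl)) = r₁₂ e
    k₂₀ : ∀ {y z} → y ~ z → (y ≡ a₂ T × z ≡ b₀ T) ⊎ (y ≡ b₂ T × z ≡ a₀ T) → Kind T y z
    k₂₀ e (inj₁ (refl , refl)) = f₂₀ e
    k₂₀ e (inj₂ (refl , refl)) = r₂₀ e
    go : Located T u → Located T v → Kind T u v ⊎ Kind T v u
    go (lonely _ _ _ eq) _ = ⊥-elim (low fu fv ap uv eq)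
    go _ (lonely _ _ _ eq) = ⊥-elim (low fv fu (λ eq′ → ap (≡-sym eq′)) (~-sym uv) eq)
    go (in₀ o) (in₀ o′) = ⊥-elim (same T o o′)
    go (in₁ o) (in₁ o′) = ⊥-elim (same T₁ o o′)
    go (in₂ o) (in₂ o′) = ⊥-elim (same T₂ o o′)
    go (in₀ o) (in₁ o′) = inj₁ (k₀₁ uv (Facts.cross-shape T o o′ uv))
    go (in₁ o) (in₂ o′) = inj₁ (k₁₂ uv (Facts.cross-shape T₁ o o′ uv))
    go (in₂ o) (in₀ o′) = inj₁ (k₂₀ uv (Facts.cross-shape T₂ o o′ uv))
    go (in₁ o) (in₀ o′) = inj₂ (k₀₁ (~-sym uv) (Facts.cross-shape T o′ o (~-sym uv)))
    go (in₂ o) (in₁ o′) = inj₂ (k₁₂ (~-sym uv) (Facts.cross-shape T₁ o′ o (~-sym uv)))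
    go (in₀ o) (in₂ o′) = inj₂ (k₂₀ (~-sym uv) (Facts.cross-shape T₂ o′ o (~-sym uv)))

  module Chords (T : Tri) where

    T₁ = rot T
    T₂ = rot T₁

    outside-pair : Fwd T₁ ⊎ Bwd T₁ ⊎ Fwd T₂ ⊎ Bwd T₂
    outside-pair = go (edge-outside-pair (Facts.free₀ T (first-on (g₀ T))) (Facts.free₀ T₁ (first-on (g₁ T))) (Facts.apart₀₁ T))
      where
      Goal = Fwd T₁ ⊎ Bwd T₁ ⊎ Fwd T₂ ⊎ Bwd T₂
      from : ∀ {u v z} → z ≡ u ⊎ z ≡ v → Apart z (a₀ T) → Apart z (a₁ T) → Kind T u v → Goal
      from z∈ ap₀ ap₁ (f₁₂ h) = inj₁ h
      from z∈ ap₀ ap₁ (r₁₂ h) = inj₂ (inj₁ h)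
      from z∈ ap₀ ap₁ (f₂₀ h) = inj₂ (inj₂ (inj₁ h))
      from z∈ ap₀ ap₁ (r₂₀ h) = inj₂ (inj₂ (inj₂ h))
      from (inj₁ refl) ap₀ ap₁ (f₀₁ h) = contradiction refl ap₀
      from (inj₂ refl) ap₀ ap₁ (f₀₁ h) = contradiction (trans (Facts.lab₀ T₁ (Facts.on-b₀ T₁)) (≡-sym (Facts.lab₀ T₁ (first-on (g₁ T))))) ap₁
      from (inj₁ refl) ap₀ ap₁ (r₀₁ h) = contradiction (trans (Facts.lab₀ T (Facts.on-b₀ T)) (≡-sym (Facts.lab₀ T (first-on (g₀ T))))) ap₀
      from (inj₂ refl) ap₀ ap₁ (r₀₁ h) = contradiction refl ap₁
      go : Σ[ E ∈ Edge ] Apart (Edge.v E) (a₀ T) × Apart (Edge.v E) (a₁ T) → Goal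
      go (mkEdge fu fv ap uv , ap₀ , ap₁) = [ from (inj₂ refl) ap₀ ap₁ , from (inj₁ refl) ap₀ ap₁ ]′ (kind T fu fv ap uv)

    missing-a₀ : Fwd T₁ ⊎ Fwd T₂ ⊎ Bwd T ⊎ Bwd T₁
    missing-a₀ = go (edge-missing (Facts.free₀ T (first-on (g₀ T))) (Facts.free₀ T (Facts.on-b₀ T))
        (trans (Facts.lab₀ T (Facts.on-b₀ T)) (≡-sym (Facts.lab₀ T (first-on (g₀ T))))) (λ eq → ~⇒≢ (proj₁ (Facts.pr₀ T)) (≡-sym eq)))
      where
      Goal = Fwd T₁ ⊎ Fwd T₂ ⊎ Bwd T ⊎ Bwd T₁
      from : ∀ {u v} → u ≢ a₀ T → v ≢ a₀ T → Kind T u v → Goal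
      from nu nv (f₁₂ h) = inj₁ h
      from nu nv (f₂₀ h) = inj₂ (inj₁ h)
      from nu nv (r₀₁ h) = inj₂ (inj₂ (inj₁ h))
      from nu nv (r₁₂ h) = inj₂ (inj₂ (inj₂ h))
      from nu nv (f₀₁ h) = contradiction refl nu
      from nu nv (r₂₀ h) = contradiction refl nv
      go : Σ[ E ∈ Edge ] Edge.u E ≢ a₀ T × Edge.v E ≢ a₀ T → Goal
      go (mkEdge fu fv ap uv , nu , nv) = [ from nu nv , from nv nu ]′ (kind T fu fv ap uv)

    missing-b₁ : Fwd T₁ ⊎ Fwd T₂ ⊎ Bwd T ⊎ Bwd T₂
    missing-b₁ = go (edge-missing (Facts.free₀ T₁ (Facts.on-b₀ T₁)) (Facts.free₀ T₁ (first-on (g₁ T)))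
        (trans (Facts.lab₀ T₁ (first-on (g₁ T))) (≡-sym (Facts.lab₀ T₁ (Facts.on-b₀ T₁)))) (~⇒≢ (proj₁ (Facts.pr₀ T₁))))
      where
      Goal = Fwd T₁ ⊎ Fwd T₂ ⊎ Bwd T ⊎ Bwd T₂
      from : ∀ {u v} → u ≢ b₁ T → v ≢ b₁ T → Kind T u v → Goal
      from nu nv (f₁₂ h) = inj₁ h
      from nu nv (f₂₀ h) = inj₂ (inj₁ h)
      from nu nv (r₀₁ h) = inj₂ (inj₂ (inj₁ h))
      from nu nv (r₂₀ h) = inj₂ (inj₂ (inj₂ h))
      from nu nv (f₀₁ h) = contradiction refl nv
      from nu nv (r₁₂ h) = contradiction refl nu
      go : Σ[ E ∈ Edge ] Edge.u E ≢ b₁ T × Edge.v E ≢ b₁ T → Goal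
      go (mkEdge fu fv ap uv , nu , nv) = [ from nu nv , from nv nu ]′ (kind T fu fv ap uv)

    -- The edge beyond the first two segments would be a backward chord that meets the forward one
    -- in `b₁` or in `a₀`. An edge avoiding this common vertex is again a chord, excluded by
    -- `not-both` or `not-bwd-twice`.
    not-alone : Fwd T → ¬ Fwd T₁ → ¬ Fwd T₂ → ⊥
    not-alone f ¬f₁ ¬f₂ = [ ¬f₁ , [ at-b₁ , [ ¬f₂ , at-a₀ ]′ ]′ ]′ outside-pair
      where
      at-b₁ : Bwd T₁ → ⊥
      at-b₁ b = [ ¬f₁ , [ ¬f₂ , [ Facts.not-both T f , (λ b′ → Facts.not-bwd-twice T₂ b′ b) ]′ ]′ ]′ missing-b₁
      at-a₀ : Bwd T₂ → ⊥
      at-a₀ b = [ ¬f₁ , [ ¬f₂ , [ Facts.not-both T f , (λ b′ → Facts.not-bwd-twice T₂ b b′) ]′ ]′ ]′ missing-a₀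

    -- Two backward chords exclude each other, yet an edge that avoids an end of one would have to
    -- be another.
    some-fwd : ¬ Fwd T → ¬ Fwd T₁ → ¬ Fwd T₂ → ⊥
    some-fwd ¬f ¬f₁ ¬f₂ = [ ¬f₁ , [ with₁ , [ ¬f₂ , with₂ ]′ ]′ ]′ outside-pair
      where
      with₁ : Bwd T₁ → ⊥
      with₁ b = [ ¬f₁ , [ ¬f₂ , [ (λ b′ → Facts.not-bwd-twice T₁ b b′) , (λ b′ → Facts.not-bwd-twice T₂ b′ b) ]′ ]′ ]′ missing-b₁
      with₂ : Bwd T₂ → ⊥
      with₂ b = [ ¬f₁ , [ ¬f₂ , [ (λ b′ → Facts.not-bwd-twice T b′ b) , (λ b′ → Facts.not-bwd-twice T₂ b b′) ]′ ]′ ]′ missing-a₀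

  two-fwd : Tri → Σ[ T ∈ Tri ] Fwd T × Fwd (rot (rot T))
  two-fwd T = go (a₀ T ~? b₁ T) (a₁ T ~? b₂ T) (a₂ T ~? b₀ T)
    where
    T₁ = rot T
    T₂ = rot T₁
    go : Dec (Fwd T) → Dec (Fwd T₁) → Dec (Fwd T₂) → Σ[ T ∈ Tri ] Fwd T × Fwd (rot (rot T))
    go (yes f) _ (yes f₂) = T , f , f₂
    go (yes f) (yes f₁) _ = T₁ , f₁ , f
    go _ (yes f₁) (yes f₂) = T₂ , f₂ , f₁
    go (yes f) (no ¬f₁) (no ¬f₂) = ⊥-elim (Chords.not-alone T f ¬f₁ ¬f₂)
    go (no ¬f) (yes f₁) (no ¬f₂) = ⊥-elim (Chords.not-alone T₁ f₁ ¬f₂ ¬f)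
    go (no ¬f) (no ¬f₁) (yes f₂) = ⊥-elim (Chords.not-alone T₂ f₂ ¬f ¬f₁)
    go (no ¬f) (no ¬f₁) (no ¬f₂) = ⊥-elim (Chords.some-fwd T ¬f ¬f₁ ¬f₂)

  -- No room for further segments.

  module Tightening (T₀ : Tri) where

    -- With d = 0 and the full excess of 3, the count reads 2a + 3 ≤ c ≤ 2δ + 3.
    a≤δ : a ≤ δ
    a≤δ = bound (mass (Tri.a₀ T₀ ∷ Tri.a₁ T₀ ∷ Tri.a₂ T₀ ∷ [])
        (λ { (here refl) → Facts.free₀ T₀ (first-on (Tri.g₀ T₀)) ; (there (here refl)) → Facts.free₀ T₁ (first-on (Tri.g₁ T₀))
           ; (there (there (here refl))) → Facts.free₀ T₂ (first-on (Tri.g₂ T₀)) })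
        ((Facts.apart₀₁ T₀ All.∷ (λ eq → Facts.apart₀₁ T₂ (≡-sym eq)) All.∷ All.[]) AllPairs.∷ (Facts.apart₀₁ T₁ All.∷ All.[]) AllPairs.∷ All.[] AllPairs.∷ AllPairs.[]))
        (Facts.e₀ T₀) (Facts.e₀ T₁) (Facts.e₀ T₂) d≡0
      where
      T₁ = rot T₀
      T₂ = rot T₁
      bound : ∀ {i j k d} → i + (j + (k + 0)) + (2 + d) * a ≤ c → i ≡ 1 → j ≡ 1 → k ≡ 1 → d ≡ 0 → a ≤ δ
      bound h refl refl refl refl = ℕₚ.*-cancelˡ-≤ 2 (farkas 0 (h ⊞ c≤) (lemma a c δ))
        where
        lemma : ∀ a c δ → 2 * δ + (3 + 2 * a + c) ≡ 2 * a + (c + (2 * δ + 3)) + 0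
        lemma a c δ = solve (a ∷ c ∷ δ ∷ [])

    -- Exchanging the lonely vertex u with x gives another longest cycle, and u has all its neighbours on that one.
    full : ∀ {u p} → Free u → e u ≡ 0 → A p → u ~ p
    full {u} {p} fu eu ap = at-root (root-at (proj₁ fu) (proj₂ fu))
      where
      at-root : RootSeg u → u ~ p
      at-root (rootSeg {p′} {q′} k rest on w) = conclude (p ∈? nbrs u)
        where
        sg = single k (trans (len-here k rest w on) (cong₂ (λ i j → suc i + j) d≡0 eu)) on
        eq : ∀ f → wt f (arc rest) + f u ≡ total f
        eq f = trans (cong₂ _+_ (wt-arc f rest) (≡-sym (proj₁ (proj₂ (proj₂ sg)) f))) (trans (lemma (wtˢ f rest) (f p′) (wt f (Seg.body k))) (covers w f))
          where
          lemma : ∀ r p k → r + p + k ≡ p + k + r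
          lemma r p k = solve (r ∷ p ∷ k ∷ [])
        mul : ∀ z → wt (ind z) (arc rest) + ind z x ≤ 1
        mul z with z Fin.≟ x
        ... | yes refl = ℕₚ.≤-reflexive (cong (_+ 1) (ℕₚ.n≤0⇒n≡0 (ℕₚ.≤-trans (ℕₚ.m≤m+n _ (ind x u)) (ℕₚ.≤-reflexive (trans (eq (ind x)) (¬On⇒0 x∉C))))))
        ... | no _ = ℕₚ.≤-trans (ℕₚ.≤-reflexive (ℕₚ.+-identityʳ _)) (ℕₚ.≤-trans (ℕₚ.m≤m+n _ (ind z u)) (ℕₚ.≤-trans (ℕₚ.≤-reflexive (eq (ind z))) (total≤1 z)))
        C′ : Closed c
        C′ = record { path = arc rest ⊕⟨ A-x (Seg.p∈A k) ⟩ [ x ] ; close = ~-sym (A-x (Seg.q∈A k)) ; simple = mkSimple mul ; len≡ = trans (eq one) len≡ }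
        off-arc : ¬ On u (arc rest)
        off-arc o = ℕₚ.<-irrefl refl (ℕₚ.≤-trans (ℕₚ.≤-trans (s≤s (occ o)) (ℕₚ.≤-reflexive (ℕₚ.+-comm 1 _)))
          (ℕₚ.≤-trans (ℕₚ.≤-reflexive (trans (cong (wt (ind u) (arc rest) +_) (≡-sym (ind-refl u))) (eq (ind u)))) (total≤1 u)))
        u∉C′ : ¬ On u (Closed.path C′)
        u∉C′ o = [ off-arc , (λ o′ → x∉C (subst OnC (On-[] o′) (proj₁ fu))) ]′ (On-⊕ o)
        no-A : ¬ A u
        no-A = proj₂ fu
        inA : ∀ {v} → u ~ v → A v
        inA {v} uv = [ on-arc , at-x ]′ (On-⊕ (nbr-on (record { C = C′ ; x = u ; x∉C = u∉C′ }) uv))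
          where
          at-x : On v [ x ] → A v
          at-x o = contradiction (x-A (~-sym (subst (u ~_) (On-[] o) uv))) no-A
          free-⊥ : Free v → Dec (lab v ≡ lab u) → A v
          free-⊥ fv (yes eq′) = contradiction (ind-≡ {z = v} {u} (subst (1 ≤_) (proj₁ (proj₂ (proj₂ sg)) (ind v))
            (occ (same-seg k rest w fv (trans eq′ (lab-here k rest w on)))))) (λ eq″ → ~⇒≢ uv (≡-sym eq″))
          free-⊥ fv (no ne) = contradiction (ℕₚ.≤-trans (cost fu fv (λ eq′ → ne (≡-sym eq′)) (edge uv))
            (ℕₚ.+-mono-≤ (ℕₚ.≤-reflexive eu) (excess≤1 T₀ fv))) λ { (s≤s ()) }
          check : OnC v → Dec (A v) → A v
          check _ (yes av) = av
          check o (no ¬av) = free-⊥ (o , ¬av) (lab v Fin.≟ lab u)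
          on-arc : On v (arc rest) → A v
          on-arc o = check (mkOn (ℕₚ.≤-trans (occ o) (ℕₚ.≤-trans (ℕₚ.m≤m+n _ (ind v u)) (ℕₚ.≤-reflexive (eq (ind v)))))) (A? v)
        conclude : Dec (p ∈ nbrs u) → u ~ p
        conclude (yes h) = ∈-nbrs⁻ h
        -- All neighbours of `u` lie in `A`; if `p` were not among them, there would be fewer than
        -- `a`, hence fewer than `δ`.
        conclude (no h) = contradiction (ℕₚ.≤-trans (s≤s (ℕₚ.≤-trans a≤δ (ℕₚ.≤-trans (δ≤deg u) (ℕₚ.≤-reflexive (≡-sym (length-nbrs u))))))
          (A-list {p ∷ nbrs u} (Allₚ.¬Any⇒All¬ _ h AllPairs.∷ nbrs-unique u) (λ { (here refl) → ap ; (there h′) → inA (∈-nbrs⁻ h′) }))) (ℕₚ.<-irrefl refl)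

    -- A segment within an arc is none of the three large ones, so it is a single vertex, to which
    -- `full` applies.
    between : ∀ {p₀ q₀ p₁ q₁ r s p₂ q₂} (g₀ : Seg p₀ q₀) (s₀ : Segs q₀ p₁) (g₁ : Seg p₁ q₁) (sx : Segs q₁ r) (k : Seg r s) (sy : Segs s p₂) (g₂ : Seg p₂ q₂) (s₂ : Segs q₂ p₀) →
              Whole (g₀ ∷ˢ (s₀ ++ˢ (g₁ ∷ˢ ((sx ++ˢ (k ∷ˢ sy)) ++ˢ (g₂ ∷ˢ s₂))))) →
              len (Seg.body g₀) ≡ 2 → len (Seg.body g₁) ≡ 2 → len (Seg.body g₂) ≡ 2 →
              Free (Seg.a k) × e (Seg.a k) ≡ 0 × r ~ Seg.a k × Seg.a k ~ s × (∀ f → wt f (Seg.body k) ≡ f (Seg.a k))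
    between {p₀} g₀ s₀ g₁ sx k sy g₂ s₂ w l₀ l₁ l₂ = fu , eu , proj₁ sg , proj₁ (proj₂ sg) , proj₁ (proj₂ (proj₂ sg))
      where
      T : Tri
      T = record { g₀ = g₀ ; s₀ = s₀ ; g₁ = g₁ ; s₁ = sx ++ˢ (k ∷ˢ sy) ; g₂ = g₂ ; s₂ = s₂ ; whole = w ; two₀ = l₀ ; two₁ = l₁ ; two₂ = l₂ }
      W₀ : Whole (g₀ ∷ˢ ((s₀ ++ˢ (g₁ ∷ˢ sx)) ++ˢ (k ∷ˢ (sy ++ˢ (g₂ ∷ˢ s₂)))))
      W₀ = subst (λ s → Whole (g₀ ∷ˢ s)) (trans (cong (λ s → s₀ ++ˢ (g₁ ∷ˢ s)) (++ˢ-assoc sx (k ∷ˢ sy) (g₂ ∷ˢ s₂))) (≡-sym (++ˢ-assoc s₀ (g₁ ∷ˢ sx) (k ∷ˢ (sy ++ˢ (g₂ ∷ˢ s₂)))))) w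
      W₁ : Whole (g₁ ∷ˢ (sx ++ˢ (k ∷ˢ (sy ++ˢ (g₂ ∷ˢ (s₂ ++ˢ (g₀ ∷ˢ s₀)))))))
      W₁ = subst (λ s → Whole (g₁ ∷ˢ s)) (++ˢ-assoc sx (k ∷ˢ sy) (g₂ ∷ˢ (s₂ ++ˢ (g₀ ∷ˢ s₀)))) (Tri.whole (rot T))
      Wᵏ : Whole (k ∷ˢ ((sy ++ˢ (g₂ ∷ˢ s₂)) ++ˢ (g₀ ∷ˢ (s₀ ++ˢ (g₁ ∷ˢ sx)))))
      Wᵏ = rotate (g₀ ∷ˢ (s₀ ++ˢ (g₁ ∷ˢ sx))) (k ∷ˢ (sy ++ˢ (g₂ ∷ˢ s₂))) W₀
      Wᵏ′ : Whole (k ∷ˢ (sy ++ˢ (g₂ ∷ˢ (s₂ ++ˢ (g₀ ∷ˢ (s₀ ++ˢ (g₁ ∷ˢ sx)))))))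
      Wᵏ′ = subst (λ s → Whole (k ∷ˢ s)) (++ˢ-assoc sy (g₂ ∷ˢ s₂) (g₀ ∷ˢ (s₀ ++ˢ (g₁ ∷ˢ sx)))) Wᵏ
      fu : Free (Seg.a k)
      fu = on-free k _ Wᵏ (first-on k)
      alone : Located T (Seg.a k) → e (Seg.a k) ≡ 0
      alone (lonely _ _ _ eq) = eq
      alone (in₀ o) = contradiction (first-on k) (disjoint g₀ (s₀ ++ˢ (g₁ ∷ˢ sx)) k (sy ++ˢ (g₂ ∷ˢ s₂)) W₀ o)
      alone (in₁ o) = contradiction (first-on k) (disjoint g₁ sx k (sy ++ˢ (g₂ ∷ˢ (s₂ ++ˢ (g₀ ∷ˢ s₀)))) W₁ o)
      alone (in₂ o) = contradiction o (disjoint k sy g₂ (s₂ ++ˢ (g₀ ∷ˢ (s₀ ++ˢ (g₁ ∷ˢ sx)))) Wᵏ′ (first-on k))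
      eu : e (Seg.a k) ≡ 0
      eu = alone (locate₃ T fu)
      sg = single k (trans (len-here k _ Wᵏ (first-on k)) (cong₂ (λ i j → suc i + j) d≡0 eu)) (first-on k)

    -- A one-vertex segment right after `g₀` is adjacent to `p₀` by `full`. Together with the chord
    -- this gives a tour through the whole cycle and a link between the right ends of `g₀` and `g₁`.
    no-arc : ∀ {p₀ q₀ r p₁ q₁ p₂ q₂} (g₀ : Seg p₀ q₀) (k : Seg q₀ r) (sy : Segs r p₁) (g₁ : Seg p₁ q₁) (s₁ : Segs q₁ p₂) (g₂ : Seg p₂ q₂) (s₂ : Segs q₂ p₀) →
             Whole (g₀ ∷ˢ ((k ∷ˢ sy) ++ˢ (g₁ ∷ˢ (s₁ ++ˢ (g₂ ∷ˢ s₂))))) → len (Seg.body g₀) ≡ 2 → len (Seg.body g₁) ≡ 2 → len (Seg.body g₂) ≡ 2 →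
             ¬ Seg.a g₀ ~ Seg.b g₁
    no-arc {p₀} {q₀} {r} {p₁} {q₁} g₀ k sy g₁ s₁ g₂ s₂ w l₀ l₁ l₂ f = too-long L
        (arc sy ⊕⟨ Seg.enter g₁ ⟩ [ Seg.a g₁ ] ⊕⟨ proj₁ sh₁ ⟩ [ Seg.b g₁ ] ⊕⟨ ~-sym f ⟩ [ Seg.a g₀ ] ⊕⟨ proj₁ sh₀ ⟩ [ Seg.b g₀ ] ⊕⟨ Seg.leave g₀ ⟩ [ q₀ ]
          ⊕⟨ Link.py L ⟩ Link.via L ⊕⟨ Link.yq L ⟩ arc tail ⊕⟨ ~-sym (full (proj₁ bt) (proj₁ (proj₂ bt)) (Seg.p∈A g₀)) ⟩ [ Seg.a k ])
        (proj₁ (proj₂ (proj₂ (proj₂ bt))))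
        λ h → trans (lemma (wt h (arc sy)) (h (Seg.a g₁)) (h (Seg.b g₁)) (h (Seg.a g₀)) (h (Seg.b g₀)) (h q₀) (wt h (Link.via L)) (wt h (arc tail)) (h (Seg.a k)))
          (cong (_+ wt h (Link.via L)) (trans (cong (λ i → h (Seg.a g₀) + h (Seg.b g₀) + (h q₀ + (i + wt h (arc sy))) + (h (Seg.a g₁) + h (Seg.b g₁)) + wt h (arc tail))
            (≡-sym (proj₂ (proj₂ (proj₂ (proj₂ bt))) h))) (ring₂ g₀ (k ∷ˢ sy) g₁ tail w (proj₂ sh₀) (proj₂ sh₁) h)))
      where
      tail = s₁ ++ˢ (g₂ ∷ˢ s₂)
      T : Tri
      T = record { g₀ = g₀ ; s₀ = k ∷ˢ sy ; g₁ = g₁ ; s₁ = s₁ ; g₂ = g₂ ; s₂ = s₂ ; whole = w ; two₀ = l₀ ; two₁ = l₁ ; two₂ = l₂ }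
      bt = between g₂ s₂ g₀ []ˢ k sy g₁ s₁ (Tri.whole (rot (rot T))) l₂ l₀ l₁
      sh₀ = shape₂ (Seg.body g₀) l₀
      sh₁ = shape₂ (Seg.body g₁) l₁
      L = A⇒Link (Seg.q∈A g₀) (Seg.q∈A g₁)
      lemma : ∀ y a₁ b₁ a₀ b₀ q v t u → y + (a₁ + (b₁ + (a₀ + (b₀ + (q + (v + (t + u))))))) ≡ a₀ + b₀ + (q + (u + y)) + (a₁ + b₁) + t + v
      lemma y a₁ b₁ a₀ b₀ q v t u = solve (y ∷ a₁ ∷ b₁ ∷ a₀ ∷ b₀ ∷ q ∷ v ∷ t ∷ u ∷ [])

    preceded : ∀ {q p r t} (ss : Segs q p) (g : Seg p r) → t ∈ heads (ss ++ˢ (g ∷ˢ []ˢ)) →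
               t ≡ q ⊎ ∃ λ s → Σ[ sx ∈ Segs q s ] Σ[ k ∈ Seg s t ] Σ[ sy ∈ Segs t p ] ss ≡ sx ++ˢ (k ∷ˢ sy)
    preceded []ˢ g (here eq) = inj₁ eq
    preceded (k ∷ˢ ss) g (here eq) = inj₁ eq
    preceded {q} (k ∷ˢ ss) g (there h) with preceded ss g h
    ... | inj₁ refl = inj₂ (q , []ˢ , k , ss , refl)
    ... | inj₂ (s , sx , k′ , sy , eq) = inj₂ (s , k ∷ˢ sx , k′ , sy , cong (k ∷ˢ_) eq)

    pick-third : ∀ {l : List (Fin n)} → Unique l → 3 ≤ length l → ∀ r s → ∃ λ y → y ∈ l × y ≢ r × y ≢ s
    pick-third {l} u 3≤ r s with Any.any? (λ y → ¬? (y Fin.≟ r) ×-dec ¬? (y Fin.≟ s)) l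
    ... | yes h = let y , y∈ , ne = find h in y , y∈ , ne
    ... | no none = contradiction (ℕₚ.≤-trans 3≤ (unique-⊆⇒length≤ {ys = r ∷ s ∷ []} u sub)) λ { (s≤s (s≤s ())) }
      where
      sub : ∀ {y} → y ∈ l → y ∈ r ∷ s ∷ []
      sub {y} h with y Fin.≟ r | y Fin.≟ s
      ... | yes eq | _ = here eq
      ... | _ | yes eq = there (here eq)
      ... | no ne | no ne′ = contradiction (lose h (ne , ne′)) none

    nbrs≥3 : ∀ v → 3 ≤ length (nbrs v)
    nbrs≥3 v = ℕₚ.≤-trans a≥3 (ℕₚ.≤-trans a≤δ (ℕₚ.≤-trans (δ≤deg v) (ℕₚ.≤-reflexive (≡-sym (length-nbrs v)))))

    H-x : ∀ {z} → H z → z ≡ x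
    H-x = lone d≡0

    off-bridge : ∀ {s y t} → ¬ OnC y → y ≢ x → s ~ y → y ~ t → Bridge s t
    off-bridge {y = y} ¬o y≢x sy yt = off sy [ y ] yt (mkSimple (λ z → ind≤1 z y)) (λ o → subst (λ z → ¬ OnC z × ¬ H z) (≡-sym (On-[] o)) (¬o , λ h → y≢x (H-x h)))

    off-apart-⊥ : ∀ {s y t} → ¬ OnC y → y ≢ x → s ~ y → y ~ t → Free s → Free t → ¬ Apart s t
    off-apart-⊥ ¬o y≢x sy yt fs ft ap = contradiction (ℕₚ.≤-trans (cost fs ft ap (off-bridge ¬o y≢x sy yt)) (ℕₚ.+-mono-≤ (excess≤1 T₀ fs) (excess≤1 T₀ ft))) λ { (s≤s (s≤s ())) }

    -- Only the arc from `g₁` to `g₂` may still contain segments. One chord is given; the aim is the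
    -- chord over this arc.
    module Tight {p₀ p₁ q₁ p₂ : Fin n} (g₀ : Seg p₀ p₁) (g₁ : Seg p₁ q₁) (s₁ : Segs q₁ p₂) (g₂ : Seg p₂ p₀)
                 (w : Whole (g₀ ∷ˢ (g₁ ∷ˢ (s₁ ++ˢ (g₂ ∷ˢ []ˢ))))) (l₀ : len (Seg.body g₀) ≡ 2) (l₁ : len (Seg.body g₁) ≡ 2) (l₂ : len (Seg.body g₂) ≡ 2)
                 (f : Seg.a g₀ ~ Seg.b g₁) where

      T : Tri
      T = record { g₀ = g₀ ; s₀ = []ˢ ; g₁ = g₁ ; s₁ = s₁ ; g₂ = g₂ ; s₂ = []ˢ ; whole = w ; two₀ = l₀ ; two₁ = l₁ ; two₂ = l₂ }

      A₀ = Seg.a g₀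
      B₀ = Seg.b g₀
      A₁ = Seg.a g₁
      B₁ = Seg.b g₁
      A₂ = Seg.a g₂
      B₂ = Seg.b g₂

      sh₀ = shape₂ (Seg.body g₀) l₀
      sh₁ = shape₂ (Seg.body g₁) l₁
      sh₂ = shape₂ (Seg.body g₂) l₂

      ring : ∀ h → h A₀ + h B₀ + h p₁ + (h A₁ + h B₁) + wt h (arc s₁) + (h A₂ + h B₂) + h p₀ ≡ total h
      ring h = ring₃ g₀ []ˢ g₁ s₁ g₂ []ˢ w (proj₂ sh₀) (proj₂ sh₁) (proj₂ sh₂) h

      bridge-p₀ : ¬ Bridge p₀ A₁
      bridge-p₀ B = too-long-bridge L B
          (join [ p₀ ] B ([ A₁ ] ⊕⟨ proj₁ sh₁ ⟩ [ B₁ ] ⊕⟨ ~-sym f ⟩ [ A₀ ] ⊕⟨ proj₁ sh₀ ⟩ [ B₀ ] ⊕⟨ Seg.leave g₀ ⟩ [ p₁ ] ⊕⟨ Link.py L ⟩ Link.via L ⊕⟨ Link.yq L ⟩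
            arc s₁ ⊕⟨ Seg.enter g₂ ⟩ [ A₂ ] ⊕⟨ proj₁ sh₂ ⟩ [ B₂ ])) (Seg.leave g₂)
          λ h → trans (wt-join h [ p₀ ] B _) (trans (lemma (h p₀) (wtᵇ h B) (h A₁) (h B₁) (h A₀) (h B₀) (h p₁) (wt h (Link.via L)) (wt h (arc s₁)) (h A₂) (h B₂))
            (cong (λ k → k + wt h (Link.via L) + wtᵇ h B) (ring h)))
        where
        L = A⇒Link (Seg.p∈A g₁) (Seg.q∈A g₁)
        lemma : ∀ p b a₁ b₁ a₀ b₀ q v r a₂ b₂ → p + (b + (a₁ + (b₁ + (a₀ + (b₀ + (q + (v + (r + (a₂ + b₂))))))))) ≡
                                              a₀ + b₀ + q + (a₁ + b₁) + r + (a₂ + b₂) + p + v + b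
        lemma p b a₁ b₁ a₀ b₀ q v r a₂ b₂ = solve (p ∷ b ∷ a₁ ∷ b₁ ∷ a₀ ∷ b₀ ∷ q ∷ v ∷ r ∷ a₂ ∷ b₂ ∷ [])

      bridge-q₁ : ¬ Bridge A₁ q₁
      bridge-q₁ B = too-long-bridge L B
          (join [ A₁ ] B (arc s₁ ⊕⟨ Seg.enter g₂ ⟩ [ A₂ ] ⊕⟨ proj₁ sh₂ ⟩ [ B₂ ] ⊕⟨ Seg.leave g₂ ⟩ [ p₀ ] ⊕⟨ Link.py L ⟩ Link.via L ⊕⟨ Link.yq L ⟩ [ p₁ ]
            ⊕⟨ ~-sym (Seg.leave g₀) ⟩ [ B₀ ] ⊕⟨ ~-sym (proj₁ sh₀) ⟩ [ A₀ ] ⊕⟨ f ⟩ [ B₁ ])) (~-sym (proj₁ sh₁))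
          λ h → trans (wt-join h [ A₁ ] B _) (trans (lemma (h p₀) (wtᵇ h B) (h A₁) (h B₁) (h A₀) (h B₀) (h p₁) (wt h (Link.via L)) (wt h (arc s₁)) (h A₂) (h B₂))
            (cong (λ k → k + wt h (Link.via L) + wtᵇ h B) (ring h)))
        where
        L = A⇒Link (Seg.p∈A g₀) (Seg.p∈A g₁)
        lemma : ∀ p b a₁ b₁ a₀ b₀ q v r a₂ b₂ → a₁ + (b + (r + (a₂ + (b₂ + (p + (v + (q + (b₀ + (a₀ + b₁))))))))) ≡
                                              a₀ + b₀ + q + (a₁ + b₁) + r + (a₂ + b₂) + p + v + b
        lemma p b a₁ b₁ a₀ b₀ q v r a₂ b₂ = solve (p ∷ b ∷ a₁ ∷ b₁ ∷ a₀ ∷ b₀ ∷ q ∷ v ∷ r ∷ a₂ ∷ b₂ ∷ [])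

      -- The one-vertex segment before `t` is adjacent to `p₀` by `full`, which lets the tour return
      -- along the earlier part of the arc.
      bridge-later : ∀ {s t} (sx : Segs q₁ s) (k : Seg s t) (sy : Segs t p₂) → s₁ ≡ sx ++ˢ (k ∷ˢ sy) → ¬ Bridge A₁ t
      bridge-later {s} sx k sy eq B = too-long-bridge L B
          (join [ A₁ ] B (arc sy ⊕⟨ Seg.enter g₂ ⟩ [ A₂ ] ⊕⟨ proj₁ sh₂ ⟩ [ B₂ ] ⊕⟨ Seg.leave g₂ ⟩ [ p₀ ] ⊕⟨ ~-sym (full (proj₁ bt) (proj₁ (proj₂ bt)) (Seg.p∈A g₀)) ⟩ [ u ]
            ⊕⟨ ~-sym (proj₁ (proj₂ (proj₂ bt))) ⟩ rv (arc sx) ⊕⟨ Link.py L ⟩ Link.via L ⊕⟨ Link.yq L ⟩ [ p₁ ]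
            ⊕⟨ ~-sym (Seg.leave g₀) ⟩ [ B₀ ] ⊕⟨ ~-sym (proj₁ sh₀) ⟩ [ A₀ ] ⊕⟨ f ⟩ [ B₁ ])) (~-sym (proj₁ sh₁))
          λ h → trans (wt-join h [ A₁ ] B _) (trans (lemma (h p₀) (wtᵇ h B) (h A₁) (h B₁) (h A₀) (h B₀) (h p₁) (wt h (Link.via L)) (wt h (arc sy)) (h u) (wt h (arc sx)) (h A₂) (h B₂))
            (trans (cong (λ r → h A₀ + h B₀ + h p₁ + (h A₁ + h B₁) + r + (h A₂ + h B₂) + h p₀ + wt h (Link.via L) + wtᵇ h B) (arcs h))
              (cong (λ k → k + wt h (Link.via L) + wtᵇ h B) (ring h))))
        where
        u = Seg.a k
        L = A⇒Link (Seg.q∈A g₁) (Seg.p∈A g₁)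
        bt = between g₀ []ˢ g₁ sx k sy g₂ []ˢ (subst (λ z → Whole (g₀ ∷ˢ (g₁ ∷ˢ (z ++ˢ (g₂ ∷ˢ []ˢ))))) eq w) l₀ l₁ l₂
        arcs : ∀ h → wt h (arc sy) + h u + wt h (arc sx) ≡ wt h (arc s₁)
        arcs h = trans (cong₂ (λ i j → i + h u + j) (wt-arc h sy) (wt-arc h sx)) (trans (cong (λ i → wtˢ h sy + h p₂ + i + (wtˢ h sx + h s)) (≡-sym (proj₂ (proj₂ (proj₂ (proj₂ bt))) h)))
          (trans (l (wtˢ h sy) (h p₂) (wt h (Seg.body k)) (wtˢ h sx) (h s)) (trans (cong (_+ h p₂) (≡-sym (wtˢ-++ h sx (k ∷ˢ sy)))) (trans (cong (λ z → wtˢ h z + h p₂) (≡-sym eq)) (≡-sym (wt-arc h s₁))))))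
          where
          l : ∀ y p k x s → y + p + k + (x + s) ≡ x + (s + k + y) + p
          l y p k x s = solve (y ∷ p ∷ k ∷ x ∷ s ∷ [])
        lemma : ∀ p b a₁ b₁ a₀ b₀ q v y u r a₂ b₂ → a₁ + (b + (y + (a₂ + (b₂ + (p + (u + (r + (v + (q + (b₀ + (a₀ + b₁))))))))))) ≡
                                              a₀ + b₀ + q + (a₁ + b₁) + (y + u + r) + (a₂ + b₂) + p + v + b
        lemma p b a₁ b₁ a₀ b₀ q v y u r a₂ b₂ = solve (p ∷ b ∷ a₁ ∷ b₁ ∷ a₀ ∷ b₀ ∷ q ∷ v ∷ y ∷ u ∷ r ∷ a₂ ∷ b₂ ∷ [])

      bridge-A : ∀ {t} → A t → t ≢ p₁ → ¬ Bridge A₁ t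
      bridge-A {t} at t≢p₁ B = at-head (A⇒head w at)
        where
        later : t ≡ q₁ ⊎ (∃ λ s → Σ[ sx ∈ Segs q₁ s ] Σ[ k ∈ Seg s t ] Σ[ sy ∈ Segs t p₂ ] s₁ ≡ sx ++ˢ (k ∷ˢ sy)) → ⊥
        later (inj₁ eq) = bridge-q₁ (subst (Bridge A₁) eq B)
        later (inj₂ (_ , sx , k , sy , eq)) = bridge-later sx k sy eq B
        at-head : t ∈ p₀ ∷ p₁ ∷ heads (s₁ ++ˢ (g₂ ∷ˢ []ˢ)) → ⊥
        at-head (here eq) = bridge-p₀ (Bridge-sym (subst (Bridge A₁) eq B))
        at-head (there (here eq)) = t≢p₁ eq
        at-head (there (there h)) = later (preceded s₁ g₂ h)

      not-inserted : ∀ {y} → ¬ OnC y → A₁ ~ y → ¬ y ~ B₁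
      not-inserted {y} ¬o e e′ = farkas-⊥ 0 (exchange (λ h → total h + h y) T≤1
          ([ A₁ ] ⊕⟨ e ⟩ [ y ] ⊕⟨ e′ ⟩ [ B₁ ] ⊕⟨ Seg.leave g₁ ⟩ arc s₁ ⊕⟨ Seg.enter g₂ ⟩ [ A₂ ] ⊕⟨ proj₁ sh₂ ⟩ [ B₂ ] ⊕⟨ Seg.leave g₂ ⟩ [ p₀ ] ⊕⟨ Seg.enter g₀ ⟩ [ A₀ ]
            ⊕⟨ proj₁ sh₀ ⟩ [ B₀ ] ⊕⟨ Seg.leave g₀ ⟩ [ p₁ ]) (Seg.enter g₁) (λ _ → 0)
          (λ h → trans (lemma (h A₁) (h y) (h B₁) (wt h (arc s₁)) (h A₂) (h B₂) (h p₀) (h A₀) (h B₀) (h p₁)) (cong (_+ h y) (ring h))))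
          (trans (cong (_+ 1) len≡) (trans (ℕₚ.+-comm c 1) (trans (cong suc (≡-sym (ℕₚ.+-identityʳ c))) (ℕₚ.+-comm 1 (c + 0)))))
        where
        T≤1 : ∀ z → total (ind z) + ind z y ≤ 1
        T≤1 z with z Fin.≟ y
        ... | yes refl = ℕₚ.≤-reflexive (cong (_+ 1) (¬On⇒0 ¬o))
        ... | no _ = ℕₚ.≤-trans (ℕₚ.≤-reflexive (ℕₚ.+-identityʳ _)) (total≤1 z)
        lemma : ∀ a₁ y b₁ r a₂ b₂ p a₀ b₀ q → a₁ + (y + (b₁ + (r + (a₂ + (b₂ + (p + (a₀ + (b₀ + q)))))))) + 0 ≡ a₀ + b₀ + q + (a₁ + b₁) + r + (a₂ + b₂) + p + y
        lemma a₁ y b₁ r a₂ b₂ p a₀ b₀ q = solve (a₁ ∷ y ∷ b₁ ∷ r ∷ a₂ ∷ b₂ ∷ p ∷ a₀ ∷ b₀ ∷ q ∷ [])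

      module R = Facts (rot T)

      free-A₁ : Free A₁
      free-A₁ = R.free₀ (first-on g₁)

      in-own-seg : ∀ {t} → Free t → lab t ≡ lab A₁ → t ≡ A₁ ⊎ t ≡ B₁
      in-own-seg ft eq = on₂ (Seg.body g₁) (proj₂ sh₁) (same-seg g₁ _ (Tri.whole (rot T)) ft (trans eq (R.lab₀ (first-on g₁))))

      -- As degrees are at least 3, `A₁` has a neighbour besides `p₁` and `B₁`. It is not in `A` by
      -- `bridge-A`, and if free, it can only be `B₂` by `kind`. Off the cycle, it would have a
      -- neighbour on `C` besides `A₁` and `p₁`, which completes a forbidden bridge or an insertion
      -- between `A₁` and `B₁`.
      third-chord : A₁ ~ B₂
      third-chord = decide (A₁ ~? B₂)
        where
        edge-case : ¬ A₁ ~ B₂ → ∀ {y} → A₁ ~ y → y ≢ B₁ → Free y → ⊥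
        edge-case ¬f₁ {y} e y≢ fy = go (lab y Fin.≟ lab A₁)
          where
          from : ∀ {u v} → u ≡ A₁ → Kind T u v ⊎ Kind T v u → ⊥
          from eq (inj₁ (f₁₂ h)) = ¬f₁ h
          from eq (inj₂ (f₁₂ h)) = ¬f₁ h
          from eq (inj₁ (f₀₁ h)) = Facts.apart₀₁ T (cong lab eq)
          from eq (inj₂ (f₀₁ h)) = ~⇒≢ (proj₁ sh₁) (≡-sym eq)
          from eq (inj₁ (f₂₀ h)) = Facts.apart₀₁ (rot T) (≡-sym (cong lab eq))
          from eq (inj₂ (f₂₀ h)) = Facts.apart₀₁ T (trans (trans (Facts.lab₀ T (first-on g₀)) (≡-sym (Facts.lab₀ T (Facts.on-b₀ T)))) (cong lab eq))
          from eq (inj₁ (r₀₁ h)) = Facts.apart₀₁ T (trans (trans (Facts.lab₀ T (first-on g₀)) (≡-sym (Facts.lab₀ T (Facts.on-b₀ T)))) (cong lab eq))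
          from eq (inj₂ (r₀₁ h)) = Facts.not-both T f h
          from eq (inj₁ (r₁₂ h)) = ~⇒≢ (proj₁ sh₁) (≡-sym eq)
          from eq (inj₂ (r₁₂ h)) = Facts.apart₀₁ (rot T) (≡-sym (cong lab eq))
          from eq (inj₁ (r₂₀ h)) = Facts.apart₀₁ (rot T) (trans (≡-sym (cong lab eq)) (trans (Facts.lab₀ (rot (rot T)) (Facts.on-b₀ (rot (rot T)))) (≡-sym (Facts.lab₀ (rot (rot T)) (first-on g₂)))))
          from eq (inj₂ (r₂₀ h)) = Facts.apart₀₁ T (cong lab eq)
          go : Dec (lab y ≡ lab A₁) → ⊥
          go (yes eq) = [ (λ eq′ → ~⇒≢ e (≡-sym eq′)) , y≢ ]′ (in-own-seg fy eq)
          go (no ap) = from refl (kind T free-A₁ fy (λ eq → ap (≡-sym eq)) e)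
        on-case : ¬ A₁ ~ B₂ → ∀ {y} → A₁ ~ y → y ≢ p₁ → y ≢ B₁ → OnC y → Dec (A y) → ⊥
        on-case ¬f₁ e y≢p y≢B o (yes ay) = bridge-A ay y≢p (edge e)
        on-case ¬f₁ e y≢p y≢B o (no ¬ay) = edge-case ¬f₁ e y≢B (o , ¬ay)
        off-case : ∀ {y} → A₁ ~ y → ¬ OnC y → ⊥
        off-case {y} e ¬o = from (pick-third (nbrs-unique y) (nbrs≥3 y) A₁ p₁)
          where
          y≢x : y ≢ x
          y≢x eq = proj₂ free-A₁ (x-A (~-sym (subst (A₁ ~_) eq e)))
          second : ∀ {t} → y ~ t → t ≢ A₁ → t ≢ p₁ → OnC t → Dec (A t) → ⊥
          second yt t≢A t≢p o (yes at) = bridge-A at t≢p (off-bridge ¬o y≢x e yt)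
          second {t} yt t≢A t≢p o (no ¬at) = [ (λ eq → [ t≢A , (λ eq′ → not-inserted ¬o e (subst (y ~_) eq′ yt)) ]′ (in-own-seg (o , ¬at) eq)) ,
              (λ ap → off-apart-⊥ ¬o y≢x e yt free-A₁ (o , ¬at) (λ eq → ap (≡-sym eq))) ]′ (split-dec (lab t Fin.≟ lab A₁))
            where
            split-dec : ∀ {P : Set} → Dec P → P ⊎ ¬ P
            split-dec (yes p) = inj₁ p
            split-dec (no ¬p) = inj₂ ¬p
          from : (∃ λ t → t ∈ nbrs y × t ≢ A₁ × t ≢ p₁) → ⊥
          from (t , t∈ , t≢A , t≢p) = second (∈-nbrs⁻ t∈) t≢A t≢p (nbr-on (record { C = C ; x = y ; x∉C = ¬o }) (∈-nbrs⁻ t∈)) (A? t)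
        decide : Dec (A₁ ~ B₂) → A₁ ~ B₂
        decide (yes h) = h
        decide (no ¬h) = ⊥-elim (from (pick-third (nbrs-unique A₁) (nbrs≥3 A₁) p₁ B₁))
          where
          decide′ : ∀ {y} → A₁ ~ y → y ≢ p₁ → y ≢ B₁ → Dec (OnC y) → ⊥
          decide′ e y≢p y≢B (yes o) = on-case ¬h e y≢p y≢B o (A? _)
          decide′ e y≢p y≢B (no ¬o) = off-case e ¬o
          from : (∃ λ y → y ∈ nbrs A₁ × y ≢ p₁ × y ≢ B₁) → ⊥
          from (y , y∈ , y≢p , y≢B) = decide′ (∈-nbrs⁻ y∈) y≢p y≢B (OnC? y)

    record Petal : Set where
      field
        {r₀ r₁ r₂} : Fin n
        k₀ : Seg r₀ r₁
        k₁ : Seg r₁ r₂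
        k₂ : Seg r₂ r₀
        ring-whole : Whole (k₀ ∷ˢ (k₁ ∷ˢ (k₂ ∷ˢ []ˢ)))
        size₀ : len (Seg.body k₀) ≡ 2
        size₁ : len (Seg.body k₁) ≡ 2
        size₂ : len (Seg.body k₂) ≡ 2
        chord₀₁ : Seg.a k₀ ~ Seg.b k₁
        chord₁₂ : Seg.a k₁ ~ Seg.b k₂
        chord₂₀ : Seg.a k₂ ~ Seg.b k₀

    -- A nonempty arc under a chord is refuted by `no-arc`. Two chords are given and empty the arcs
    -- `s₀` and `s₂`; only then does `Tight.third-chord` supply the chord over `s₁`.
    petal : Petal
    petal = from (two-fwd T₀)
      where
      from : Σ[ T ∈ Tri ] Fwd T × Fwd (rot (rot T)) → Petal
      from (record { g₀ = g₀ ; s₀ = k ∷ˢ sy ; g₁ = g₁ ; s₁ = s₁ ; g₂ = g₂ ; s₂ = s₂ ; whole = w ; two₀ = l₀ ; two₁ = l₁ ; two₂ = l₂ } , f , f₂) =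
        ⊥-elim (no-arc g₀ k sy g₁ s₁ g₂ s₂ w l₀ l₁ l₂ f)
      from (T@record { g₀ = g₀ ; s₀ = []ˢ ; g₁ = g₁ ; s₁ = s₁ ; g₂ = g₂ ; s₂ = k ∷ˢ sy ; two₀ = l₀ ; two₁ = l₁ ; two₂ = l₂ } , f , f₂) =
        ⊥-elim (no-arc g₂ k sy g₀ []ˢ g₁ s₁ (Tri.whole (rot (rot T))) l₂ l₀ l₁ f₂)
      from (T@record { g₀ = g₀ ; s₀ = []ˢ ; g₁ = g₁ ; s₁ = k ∷ˢ sy ; g₂ = g₂ ; s₂ = []ˢ ; whole = w ; two₀ = l₀ ; two₁ = l₁ ; two₂ = l₂ } , f , f₂) =
        ⊥-elim (no-arc g₁ k sy g₂ []ˢ g₀ []ˢ (Tri.whole (rot T)) l₁ l₂ l₀ (Tight.third-chord g₀ g₁ (k ∷ˢ sy) g₂ w l₀ l₁ l₂ f))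
      from (record { g₀ = g₀ ; s₀ = []ˢ ; g₁ = g₁ ; s₁ = []ˢ ; g₂ = g₂ ; s₂ = []ˢ ; whole = w ; two₀ = l₀ ; two₁ = l₁ ; two₂ = l₂ } , f , f₂) =
        record { k₀ = g₀ ; k₁ = g₁ ; k₂ = g₂ ; ring-whole = w ; size₀ = l₀ ; size₁ = l₁ ; size₂ = l₂ ; chord₀₁ = f
               ; chord₁₂ = Tight.third-chord g₀ g₁ []ˢ g₂ w l₀ l₁ l₂ f ; chord₂₀ = f₂ }

    -- Identification with the Petersen graph.

    module Finish (P : Petal) where

      open Petal P
      open PetersenPaths using (petersen; order; Spanning; spanning; edge-list; listed; simple⇒wt≤)
      module Pt = Paths petersen

      sh₀ = shape₂ (Seg.body k₀) size₀
      sh₁ = shape₂ (Seg.body k₁) size₁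
      sh₂ = shape₂ (Seg.body k₂) size₂

      -- The outer pentagon runs from `r₀` through the first segment to `r₁` and closes through `x`.
      -- The inner vertices are listed as its spoke partners: two spokes are chords, two are cycle
      -- edges at `r₀` and `r₁`, and one joins `x` to `r₂`.
      ψ : Fin 10 → Fin n
      ψ = Vec.lookup (r₀ Vec.∷ Seg.a k₀ Vec.∷ Seg.b k₀ Vec.∷ r₁ Vec.∷ x Vec.∷ Seg.b k₂ Vec.∷ Seg.b k₁ Vec.∷ Seg.a k₂ Vec.∷ Seg.a k₁ Vec.∷ r₂ Vec.∷ Vec.[])

      ring : ∀ f → f (Seg.a k₀) + f (Seg.b k₀) + f r₁ + (f (Seg.a k₁) + f (Seg.b k₁)) + f r₂ + (f (Seg.a k₂) + f (Seg.b k₂)) + f r₀ ≡ total f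
      ring f = ring₃ k₀ []ˢ k₁ []ˢ k₂ []ˢ ring-whole (proj₂ sh₀) (proj₂ sh₁) (proj₂ sh₂) f

      sum-ψ : ∀ f → sumOf (λ i → f (ψ i)) (allFin 10) ≡ total f + f x
      sum-ψ f = trans (lemma (f r₀) (f (Seg.a k₀)) (f (Seg.b k₀)) (f r₁) (f x) (f (Seg.b k₂)) (f (Seg.b k₁)) (f (Seg.a k₂)) (f (Seg.a k₁)) (f r₂)) (cong (_+ f x) (ring f))
        where
        lemma : ∀ p a b q x b₂ b₁ a₂ a₁ r → p + (a + (b + (q + (x + (b₂ + (b₁ + (a₂ + (a₁ + (r + 0))))))))) ≡ a + b + q + (a₁ + b₁) + r + (a₂ + b₂) + p + x
        lemma p a b q x b₂ b₁ a₂ a₁ r = solve (p ∷ a ∷ b ∷ q ∷ x ∷ b₂ ∷ b₁ ∷ a₂ ∷ a₁ ∷ r ∷ [])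

      c≡9 : c ≡ 9
      c≡9 = trans (≡-sym len≡) (≡-sym (ring one))

      plus-x≤1 : ∀ z → total (ind z) + ind z x ≤ 1
      plus-x≤1 z with z Fin.≟ x
      ... | yes refl = ℕₚ.≤-reflexive (cong (_+ 1) (¬On⇒0 x∉C))
      ... | no _ = ℕₚ.≤-trans (ℕₚ.≤-reflexive (ℕₚ.+-identityʳ _)) (total≤1 z)

      ψ-edges : All (λ (i , j) → ψ i ~ ψ j) edge-list
      ψ-edges = Seg.enter k₀ All.∷ proj₁ sh₀ All.∷ Seg.leave k₀ All.∷ A-x (Seg.p∈A k₁) All.∷ ~-sym (A-x (Seg.p∈A k₀)) All.∷
                ~-sym (proj₁ sh₂) All.∷ ~-sym (Seg.enter k₂) All.∷ ~-sym (Seg.leave k₁) All.∷ ~-sym (proj₁ sh₁) All.∷ chord₁₂ All.∷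
                ~-sym (Seg.leave k₂) All.∷ chord₀₁ All.∷ ~-sym chord₂₀ All.∷ Seg.enter k₁ All.∷ ~-sym (A-x (Seg.p∈A k₂)) All.∷ All.[]

      ψ-adj : ∀ i j → petersenAdj i j ≡ true → ψ i ~ ψ j
      ψ-adj i j e = go (listed i j e) ψ-edges
        where
        go : ∀ {l} → Any.Any (λ (k , m) → (i ≡ k × j ≡ m) ⊎ (j ≡ k × i ≡ m)) l → All (λ (k , m) → ψ k ~ ψ m) l → ψ i ~ ψ j
        go (here (inj₁ (refl , refl))) (h All.∷ _) = h
        go (here (inj₂ (refl , refl))) (h All.∷ _) = ~-sym h
        go (there a) (_ All.∷ hs) = go a hs

      image : ∀ {i j} → Pt.LPath i j → Path (ψ i) (ψ j)
      image Pt.[ i ]ˡ = [ ψ i ]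
      image (Pt._∷⟨_⟩_ i {w} e p) = [ ψ i ] ⊕⟨ ψ-adj i w e ⟩ image p

      wt-image : ∀ f {i j} (p : Pt.LPath i j) → wt f (image p) ≡ Pt.wt (λ k → f (ψ k)) (Pt.fromL p)
      wt-image f Pt.[ i ]ˡ = refl
      wt-image f (i Pt.∷⟨ e ⟩ p) = cong (f (ψ i) +_) (wt-image f p)

      image≤ : ∀ f {i j} ((p , _) : Spanning i j) → wt f (image p) ≤ total f + f x
      image≤ f (p , s , _) = ℕₚ.≤-trans (ℕₚ.≤-reflexive (wt-image f p)) (ℕₚ.≤-trans (simple⇒wt≤ (λ k → f (ψ k)) p s) (ℕₚ.≤-reflexive (sum-ψ f)))

      image-len : ∀ {i j} ((p , _) : Spanning i j) → order i j ≤ len (image p)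
      image-len (p , _ , l) = ℕₚ.≤-trans l (ℕₚ.≤-reflexive (≡-sym (wt-image one p)))

      -- An edge beyond the fifteen would close a Hamiltonian path of the Petersen graph to a cycle
      -- of length 10, but `c` is 9.
      not-adjacent : ∀ i j → i ≢ j → petersenAdj i j ≡ false → ¬ ψ i ~ ψ j
      not-adjacent i j ne na e = ℕₚ.<-irrefl refl (ℕₚ.≤-trans (ℕₚ.≤-trans (ℕₚ.≤-reflexive (≡-sym (cong (λ b → if b then 9 else 10) na))) (image-len sp))
          (ℕₚ.≤-trans (simple⇒len≤c (image (proj₁ sp)) (~-sym e) (mkSimple (λ z → ℕₚ.≤-trans (image≤ (ind z) sp) (plus-x≤1 z)))) (ℕₚ.≤-reflexive c≡9)))
        where
        sp = spanning i j ne

      order≥9 : ∀ i j → 9 ≤ order i j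
      order≥9 i j with petersenAdj i j
      ... | true = ℕₚ.≤-refl
      ... | false = ℕₚ.n≤1+n 9

      ψ-onto : ∀ {y} → OnC y → ∃ λ i → ψ i ≡ y
      ψ-onto {y} o = go (allFin 10) (ℕₚ.≤-trans (occ o) (ℕₚ.≤-trans (ℕₚ.m≤m+n _ (ind y x)) (ℕₚ.≤-reflexive (≡-sym (sum-ψ (ind y))))))
        where
        go : ∀ l → 1 ≤ sumOf (λ i → ind y (ψ i)) l → ∃ λ i → ψ i ≡ y
        go (i ∷ l) h with sum≥1 (ind y (ψ i)) h
        ... | inj₁ h′ = i , ≡-sym (ind-≡ h′)
        ... | inj₂ h′ = go l h′

      ψ-injective : ∀ i j → ψ i ≡ ψ j → i ≡ j
      ψ-injective i j eq with i Fin.≟ j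
      ... | yes i≡j = i≡j
      ... | no ne = contradiction (ℕₚ.≤-trans (unique-⊆⇒sum≤ (λ k → ind (ψ i) (ψ k)) {i ∷ j ∷ []} {allFin 10} ((ne All.∷ All.[]) AllPairs.∷ All.[] AllPairs.∷ AllPairs.[]) (λ _ → ∈ₚ.∈-allFin _))
              (ℕₚ.≤-trans (ℕₚ.≤-reflexive (sum-ψ (ind (ψ i)))) (plus-x≤1 (ψ i))))
              (λ h → twice (subst (λ k → ind (ψ i) (ψ i) + (ind (ψ i) k + 0) ≤ 1) (≡-sym eq) h))
        where
        twice : ¬ ind (ψ i) (ψ i) + (ind (ψ i) (ψ i) + 0) ≤ 1
        twice h with subst (λ k → k + (k + 0) ≤ 1) (ind-refl (ψ i)) h
        ... | s≤s ()

      -- A further vertex would have two different neighbours on `C`. The image of a path on at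
      -- least nine vertices joins them, and with the new vertex it becomes a cycle of length at
      -- least 10.
      spanned : ∀ y → OnC y ⊎ y ≡ x
      spanned y with OnC? y | y Fin.≟ x
      ... | yes o | _ = inj₁ o
      ... | _ | yes eq = inj₂ eq
      ... | no ¬o | no y≢x = ⊥-elim (from (pick-third (nbrs-unique y) (nbrs≥3 y) y y))
        where
        close-up : ∀ i j → i ≢ j → y ~ ψ i → y ~ ψ j → ⊥
        close-up i j ne yi yj = ℕₚ.<-irrefl refl (ℕₚ.≤-trans (s≤s (ℕₚ.≤-trans (order≥9 i j) (image-len sp)))
            (ℕₚ.≤-trans (simple⇒len≤c ([ y ] ⊕⟨ yi ⟩ image (proj₁ sp)) (~-sym yj) (mkSimple mul)) (ℕₚ.≤-reflexive c≡9)))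
          where
          sp = spanning i j ne
          mul : ∀ z → ind z y + wt (ind z) (image (proj₁ sp)) ≤ 1
          mul z with z Fin.≟ y
          ... | yes refl = s≤s (ℕₚ.≤-trans (image≤ (ind y) sp) (ℕₚ.≤-reflexive (cong₂ _+_ (¬On⇒0 ¬o) (ind-≢ y≢x))))
          ... | no _ = ℕₚ.≤-trans (image≤ (ind z) sp) (plus-x≤1 z)
        from₂ : ∀ {t} → y ~ t → (∃ λ i → ψ i ≡ t) → (∃ λ t′ → t′ ∈ nbrs y × t′ ≢ t × t′ ≢ t) → ⊥
        from₂ yt (i , refl) (t′ , t′∈ , ne , _) with ψ-onto (nbr-on (record { C = C ; x = y ; x∉C = ¬o }) (∈-nbrs⁻ t′∈))
        ... | j , refl = close-up i j (λ eq → ne (cong ψ (≡-sym eq))) yt (∈-nbrs⁻ t′∈)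
        from : (∃ λ t → t ∈ nbrs y × t ≢ y × t ≢ y) → ⊥
        from (t , t∈ , _) = from₂ (∈-nbrs⁻ t∈) (ψ-onto (nbr-on (record { C = C ; x = y ; x∉C = ¬o }) (∈-nbrs⁻ t∈))) (pick-third (nbrs-unique y) (nbrs≥3 y) t t)

      name : ∀ y → ∃ λ i → ψ i ≡ y
      name y = [ ψ-onto , (λ eq → # 4 , ≡-sym eq) ]′ (spanned y)

      φ : Fin n → Fin 10
      φ y = proj₁ (name y)

      ψφ : ∀ y → ψ (φ y) ≡ y
      ψφ y = proj₂ (name y)

      adj≡ : ∀ i j → adj G (ψ i) (ψ j) ≡ petersenAdj i j
      adj≡ i j with petersenAdj i j in eq
      ... | true = ψ-adj i j eq
      ... | false with adj G (ψ i) (ψ j) in eq′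
      ... | false = refl
      ... | true with i Fin.≟ j
      ... | yes refl = contradiction eq′ ~-irrefl
      ... | no ne = contradiction eq′ (not-adjacent i j ne eq)

      is-petersen : IsPetersen G
      is-petersen = mk⤖ {to = φ} (injective , surjective) ,
          λ u v → trans (cong₂ (adj G) (≡-sym (ψφ u)) (≡-sym (ψφ v))) (adj≡ (φ u) (φ v))
        where
        injective : Injective _≡_ _≡_ φ
        injective {y} {z} eq = trans (≡-sym (ψφ y)) (trans (cong ψ eq) (ψφ z))
        surjective : Surjective _≡_ _≡_ φ
        surjective i = ψ i , λ { refl → ψ-injective _ i (ψφ (ψ i)) }

-- From a longest cycle with a vertex off it to the Petersen graph.

module Short (S : Setting) where

  open Setting S
  open Paths G
  open LongestCycle S

  module _ (X : OffVertex S) where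

    open OffVertex X
    open Walks G
    open Frames S X
    open Outside X

    nbr-on-cycle : (F : Frame) → Frame.d F ≡ 0 → ∀ {v} → x ~ v → OnC v
    nbr-on-cycle F d≡0 {v} e = decide (OnC? v)
      where
      decide : Dec (OnC v) → OnC v
      decide (yes o) = o
      decide (no ¬o) = contradiction (Frame.lone F d≡0 (step x∉C e (stop ¬o))) (λ eq → ~⇒≢ e (≡-sym eq))

    -- `Analysis.special` yields d = 0 for every longest cycle and every vertex off it, so this
    -- vertex is alone in its component. This is the parameter `nbr-on` of `Core`.
    nbr-on-longest : ∀ {v} → x ~ v → OnC v
    nbr-on-longest = nbr-on-cycle frame (Analysis.Special.d≡0 (Analysis.special S X frame))

  module _ (X : OffVertex S) (F : Frames.Frame S X) (special-pattern : Analysis.Special S X F) where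

    open Outside X
    open Analysis S X F
    open Special special-pattern
    open Core S X F d≡0 nbr-on-longest

    two-vertices : ∀ {z p q} (g : Seg p q) (rest : Segs q p) → Whole (g ∷ˢ rest) → On z (Seg.body g) → e z ≡ 1 → len (Seg.body g) ≡ 2
    two-vertices g rest w o eq = trans (len-here g rest w o) (cong₂ (λ i j → suc i + j) d≡0 eq)

    tri : ∀ {u v w} → e u ≡ 1 → e v ≡ 1 → e w ≡ 1 → Three u v w → Tri
    tri eu ev ew (mkThree g₀ s₀ g₁ s₁ g₂ s₂ w on₀ on₁ on₂) = record
      { g₀ = g₀ ; s₀ = s₀ ; g₁ = g₁ ; s₁ = s₁ ; g₂ = g₂ ; s₂ = s₂ ; whole = w
      ; two₀ = two-vertices g₀ _ w on₀ eu
      ; two₁ = two-vertices g₁ _ (rotate (g₀ ∷ˢ s₀) (g₁ ∷ˢ (s₁ ++ˢ (g₂ ∷ˢ s₂))) w) on₁ ev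
      ; two₂ = two-vertices g₂ _ (rotate (g₀ ∷ˢ (s₀ ++ˢ (g₁ ∷ˢ s₁))) (g₂ ∷ˢ s₂)
          (subst (λ s → Whole (g₀ ∷ˢ s)) (≡-sym (++ˢ-assoc s₀ (g₁ ∷ˢ s₁) (g₂ ∷ˢ s₂))) w)) on₂ ew }

    petersen-from : Tri → IsPetersen G
    petersen-from T = Tightening.Finish.is-petersen T (Tightening.petal T)

    short⇒petersen : IsPetersen G
    short⇒petersen = [ (λ t → petersen-from (tri e₀ e₁ e₂ t)) , (λ t → petersen-from (tri e₀ e₂ e₁ t)) ]′ (three f₀ f₁ f₂ ap₀₁ ap₀₂ ap₁₂)

  short-cycle : OffVertex S → IsPetersen G
  short-cycle X = short⇒petersen X F (Analysis.special S X F)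
    where
    F = Frames.frame S X

spanning⇒≤ : ∀ {n c} (G : Graph n) (C : Paths.Closed G c) → (∀ z → Paths.On G z (Paths.Closed.path C)) → n ≤ c
spanning⇒≤ {n} G C all = ℕₚ.≤-trans (ℕₚ.≤-reflexive (≡-sym (Listₚ.length-tabulate {n = n} id)))
    (ℕₚ.≤-trans (unique-⊆⇒length≤ {ys = verts (toL path)} (Uniqueₚ.allFin⁺ n)
      (λ {z} _ → on-verts (toL path) (mkOn (ℕₚ.≤-trans (occ (all z)) (ℕₚ.≤-reflexive (≡-sym (wt-toL (ind z) path)))))))
    (ℕₚ.≤-reflexive (trans (length-verts (toL path)) (trans (wt-toL one path) len≡))))
  where
  open Paths G
  open Closed C
  verts : ∀ {u v} → LPath u v → List (Fin n)
  verts [ v ]ˡ = v ∷ []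
  verts (u ∷⟨ _ ⟩ p) = u ∷ verts p
  length-verts : ∀ {u v} (p : LPath u v) → length (verts p) ≡ len (fromL p)
  length-verts [ v ]ˡ = refl
  length-verts (u ∷⟨ _ ⟩ p) = cong suc (length-verts p)
  on-verts : ∀ {u v z} (p : LPath u v) → On z (fromL p) → z ∈ verts p
  on-verts [ v ]ˡ o = here (On-[] o)
  on-verts (u ∷⟨ _ ⟩ p) o = [ (λ o′ → here (On-[] o′)) , (λ o′ → there (on-verts p o′)) ]′ (On-⊕ o)

theorem1 : (n : ℕ) → 3 ≤ n → (G : Graph n) → (δ c : ℕ) →
    IsMinDegree G δ → IsCircumference G c →
    ToughnessGreaterThanOne G →
    (n ⊓ (2 * δ + 4) ≤ c) ⊎ IsPetersen G
theorem1 n _ G δ c (δ≤deg , _) (cyc , longest) tgh = decide (2 * δ + 4 ≤? c) (Finₚ.any? (λ z → ¬? (On? z path)))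
  where
  open Paths G
  C = Cycle⇒Closed cyc
  open Closed C
  decide : Dec (2 * δ + 4 ≤ c) → Dec (∃ λ z → ¬ On z path) → (n ⊓ (2 * δ + 4) ≤ c) ⊎ IsPetersen G
  decide (yes le) _ = inj₁ (ℕₚ.≤-trans (ℕₚ.m⊓n≤n n (2 * δ + 4)) le)
  decide (no _) (no none) = inj₁ (ℕₚ.≤-trans (ℕₚ.m⊓n≤m n (2 * δ + 4)) (spanning⇒≤ G C on))
    where
    on : ∀ z → On z path
    on z with On? z path
    ... | yes o = o
    ... | no ¬o = contradiction (z , ¬o) none
  decide (no ¬le) (yes (x , x∉C)) = inj₂ (Short.short-cycle
    (record { G = G ; tgh = tgh ; 3≤c = Cycle.length≥3 cyc ; longest = longest ; δ≤deg = δ≤deg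
            ; c≤ = ℕₚ.≤-pred (ℕₚ.≤-trans (ℕₚ.≰⇒> ¬le) (ℕₚ.≤-reflexive (ℕₚ.+-suc (2 * δ) 3))) })
    (record { C = C ; x = x ; x∉C = x∉C }))
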